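{- For a positive integer $n$ and a family $\mathcal{F}\subset\mathcal{P}([n])$, write $w(\mathcal{F})=|\mathcal{F}|/2^n$. Let $W(n)$ denote the maximum of $w(\mathcal{F})$ over all families $\mathcal{F}\subset\mathcal{P}([n])$ that are both $3$-wise intersecting (any three members $A_1,A_2,A_3\in\mathcal{F}$, not necessarily distinct, satisfy $A_1\cap A_2\cap A_3\neq\emptyset$) and $3$-intersecting (any two members $A_1,A_2\in\mathcal{F}$ satisfy $|A_1\cap A_2|\ge 3$). For odd $n\ge 7$ define $$\mathcal{F}_n=\{A\subset[n]:1\in A,\ |A|\ge \tfrac{n+3}{2}\}\cup\{A\subset[n]:1\notin A,\ |A|\ge n-2\}.$$ For $\mathcal{F}\subset\mathcal{P}([m])$ and $k\ge 1$ let $\mathcal{F}\times\{0,1\}^k=\{A\subset[m+k]: A\cap[m]\in\mathcal{F}\}$. Then for $n\ge 7$: (i) If $7\le n\le 72$, then $W(n)=w(\mathcal{F}_7)$, and the unique left-compressed family $\mathcal{F}\subset\mathcal{P}([n])$ that is $3$-wise intersecting and $3$-intersecting with $w(\mathcal{F})=W(n)$ is $\mathcal{F}_7\times\{0,1\}^{n-7}$. (ii) If $n\ge 73$ is odd, then $W(n)=w(\mathcal{F}_n)$, and the unique such left-compressed family attaining $W(n)$ is $\mathcal{F}_n$. (iii) If $n\ge 74$ is even, then $W(n)=w(\mathcal{F}_{n-1})$, and the unique such left-compressed family attaining $W(n)$ is $\mathcal{F}_{n-1}\times\{0,1\}$.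
   Context: A family $\mathcal{F}\subset\mathcal{P}([n])$ is left-compressed if for all $1\le i<j\le n$ and every $A\in\mathcal{F}$ with $j\in A$, $i\notin A$, the set $(A\setminus\{j\})\cup\{i\}$ also belongs to $\mathcal{F}$. Note $w(\mathcal{F}_n)=\frac14+2^{ -n}\left(-\frac12\binom{n-1}{(n-1)/2}+n\right)$ for odd $n\ge7$. -}

module Defs where

open import Data.Bool using (Bool; true; false; if_then_else_)
open import Data.Nat using (ℕ; zero; suc; _+_; _*_; _∸_; _^_; _≤_; _<_; _≤ᵇ_)
open import Data.Nat.Properties using (m^n≢0)
open import Data.Fin using (Fin; zero; suc; inject≤)
open import Data.Fin.Subset using (Subset; _∈_; _∉_; _∩_; ∣_∣; Nonempty; inside; outside)
open import Data.Vec using (Vec; []; _∷_; lookup; tabulate; _[_]≔_)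
open import Data.List using (List; []; _∷_; _++_; map; length)
open import Data.Integer using (+_)
open import Data.Rational using (ℚ; _/_)
open import Relation.Binary.PropositionalEquality using (_≡_)

-- A family of subsets of [n] = Fin n, given by its characteristic function.
-- (Element 1 of [n] is Fin index zero.)
Family : ℕ → Set
Family n = Subset n → Bool

_∈F_ : ∀ {n} → Subset n → Family n → Set
A ∈F F = F A ≡ true

allSubsets : (n : ℕ) → List (Subset n)
allSubsets zero = [] ∷ []
allSubsets (suc n) = map (true ∷_) (allSubsets n) ++ map (false ∷_) (allSubsets n)

countTrue : ∀ {A : Set} → (A → Bool) → List A → ℕ
countTrue p [] = 0
countTrue p (x ∷ xs) = if p x then suc (countTrue p xs) else countTrue p xs

card : ∀ {n} → Family n → ℕ
card {n} F = countTrue F (allSubsets n)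

w : ∀ {n} → Family n → ℚ
w {n} F = (+ card F) / (2 ^ n)
  where instance _ = m^n≢0 2 n

ThreeWiseIntersecting : ∀ {n} → Family n → Set
ThreeWiseIntersecting F =
  ∀ A₁ A₂ A₃ → A₁ ∈F F → A₂ ∈F F → A₃ ∈F F → Nonempty (A₁ ∩ A₂ ∩ A₃)

ThreeIntersecting : ∀ {n} → Family n → Set
ThreeIntersecting F = ∀ A₁ A₂ → A₁ ∈F F → A₂ ∈F F → 3 ≤ ∣ A₁ ∩ A₂ ∣

record Admissible {n} (F : Family n) : Set where
  field
    threeWise : ThreeWiseIntersecting F
    threeInt  : ThreeIntersecting F

LeftCompressed : ∀ {n} → Family n → Set
LeftCompressed {n} F =
  ∀ (i j : Fin n) → i Data.Fin.< j → ∀ A → A ∈F F → j ∈ A → i ∉ A →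
    ((A [ j ]≔ outside) [ i ]≔ inside) ∈F F

IsW : ℕ → ℚ → Set
IsW n q = (∀ (F : Family n) → Admissible F → w F Data.Rational.≤ q)
        × Σ (Family n) (λ F → Admissible F × w F ≡ q)
  where open import Data.Product using (Σ; _×_)

UniqueLCOptimum : ∀ {n} → ℚ → Family n → Set
UniqueLCOptimum {n} q T =
  (Admissible T × LeftCompressed T × w T ≡ q)
  × (∀ (F : Family n) → Admissible F → LeftCompressed F → w F ≡ q → ∀ A → F A ≡ T A)
  where open import Data.Product using (_×_)

-- 𝓕_n = {A : 1 ∈ A, |A| ≥ (n+3)/2} ∪ {A : 1 ∉ A, |A| ≥ n-2}
-- (for odd n, |A| ≥ (n+3)/2 is written as n + 3 ≤ 2|A|); meaningful for odd n ≥ 7.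
𝓕 : (n : ℕ) → Family n
𝓕 zero [] = false
𝓕 (suc m) (true ∷ B) = (suc m + 3) ≤ᵇ (2 * ∣ true ∷ B ∣)
𝓕 (suc m) (false ∷ B) = (suc m ∸ 2) ≤ᵇ ∣ false ∷ B ∣

restrict : ∀ {m n} → m ≤ n → Subset n → Subset m
restrict p A = tabulate (λ i → lookup A (inject≤ i p))

extend : ∀ {m n} → m ≤ n → Family m → Family n
extend p F A = F (restrict p A)

{-# OPTIONS --safe #-}
-- Compressing, one may assume that F is closed under moving elements to the left and adding
-- elements. Such a family is governed by walks: for any three members some initial segment [j]
-- has at most j − 1 missing incidences, and for any two members at most j − 3. Pairing a set with
-- its reflection after a suitable hitting time turns each such condition into a bound on densities.
-- The walk with steps +1 and −2 bounds the sets A without 1, and Katona's theorem bounds the sets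
-- containing 1; a sparse A in F forces pairs containing 1 to conflict earlier and so improves the
-- latter bound.
-- If F is not contained in 𝓕₇ × {0,1}ⁿ⁻⁷, it contains {1,2,3,4,8,…,n}. Let s be least such that F
-- contains the highest set without 1 whose walk stays at height at most s. For s ≤ 8 a decision tree
-- with linear programming certificates on the first seven elements gives a density below 29/128,
-- for 8 < s ≤ 32 the walk bounds give it numerically, and for larger s the sets without 1 are
-- exponentially rare, so that they cannot make up for the loss in Katona's bound unless all
-- of them miss at most one of the relevant elements.
module Submission where

open import Defs
open import Data.Bool using (Bool; true; false; not; if_then_else_; _∨_; _∧_; T)
open import Data.Bool.Properties using (T-≡)
open import Data.Empty using (⊥; ⊥-elim)
open import Data.Fin using (Fin)
import Data.Fin as Fin
open import Data.Fin.Subset using (Subset; _∩_; ∣_∣; _∈_; _∉_; inside; outside; Nonempty)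
open import Data.Fin.Subset.Properties using (∩-identityʳ)
import Data.Integer as ℤ
import Data.Integer.Properties as ℤ
open import Data.List using (List; []; _∷_)
import Data.List as List
open import Data.List.Relation.Unary.All using (All; []; _∷_)
open import Data.Maybe using (Maybe; just; nothing)
open import Data.Nat
open import Data.Nat.Combinatorics
  using (nC1≡n; k>n⇒nCk≡0; nCk≡nC[n∸k]; nCk+nC[k+1]≡[n+1]C[k+1]) renaming (_C_ to _choose_)
open import Data.Nat.DivMod using (m≡m%n+[m/n]*n)
open import Data.Nat.Induction using (<-wellFounded)
open import Data.Nat.Properties
open import Data.Nat.Tactic.RingSolver using (solve-∀)
open import Data.Product using (_×_; _,_; Σ; proj₁; proj₂)
import Data.Rational as ℚ
import Data.Rational.Properties as ℚ
import Data.Rational.Unnormalised as ℚᵘ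
import Data.Rational.Unnormalised.Properties as ℚᵘ
open import Data.Sum using (_⊎_; inj₁; inj₂)
open import Data.Unit using (⊤; tt)
open import Data.Vec using ([]; _∷_; _++_; map; replicate; _[_]≔_; here; there)
open import Function using (_∘_; Equivalence)
open import Induction.WellFounded using (Acc; acc)
open import Relation.Binary.PropositionalEquality
open import Relation.Nullary using (¬_; yes; no)

-- A set with d misses among the first j elements has height j - 3d, so `Meet r A B C` says that at
-- some time the three heights add up to at least 3r; hence the steps +1 and -2. The equation 1 + x³
-- = 2x of that walk has the root (√5 - 1)/2, and 5/8 lies just above it. The obstacle is that
-- little room is left: Katona's densities in dimensions two apart differ by a polynomially small
-- amount (`kat-gap`), and around n = 72 the competing families have nearly equal density. A line in
-- F without 1 forces conflicts among the sets with 1. The larger s, the weaker this gain, but the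
-- rarer, at rate (5/8)^s, are the sets without 1; the estimates balance the two. Only n = 4 + 2k
-- with k ≥ 34 is treated directly. Free elements embed lower dimensions into higher ones, so all n
-- ≤ 72 follow from n = 72 and odd n ≥ 73 from n + 1. The density of 𝓕₇ is 29/128; it appears as
-- 29/64 when the sets with and without 1 are counted on the n - 1 other elements.

-- Cardinalities and walks

countTrue-++ : ∀ {A : Set} (p : A → Bool) xs ys →
  countTrue p (xs List.++ ys) ≡ countTrue p xs + countTrue p ys
countTrue-++ p [] ys = refl
countTrue-++ p (x ∷ xs) ys with p x
... | true = cong suc (countTrue-++ p xs ys)
... | false = countTrue-++ p xs ys

countTrue-map : ∀ {A B : Set} (p : B → Bool) (f : A → B) xs →
  countTrue p (List.map f xs) ≡ countTrue (p ∘ f) xs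
countTrue-map p f [] = refl
countTrue-map p f (x ∷ xs) with p (f x)
... | true = cong suc (countTrue-map p f xs)
... | false = countTrue-map p f xs

_at_ : ∀ {n} → Family (suc n) → Bool → Family n
(F at b) A = F (b ∷ A)

card-split : ∀ {n} (F : Family (suc n)) → card F ≡ card (F at true) + card (F at false)
card-split {n} F =
  trans (countTrue-++ F (List.map (true ∷_) (allSubsets n)) _)
        (cong₂ _+_ (countTrue-map F (true ∷_) (allSubsets n)) (countTrue-map F (false ∷_) (allSubsets n)))

card-mono : ∀ {n} (F G : Family n) → (∀ A → A ∈F F → A ∈F G) → card F ≤ card G
card-mono {zero} F G h with F [] | G [] | h []
... | true | true | _ = ≤-refl
... | true | false | h[] with () ← h[] refl
... | false | _ | _ = z≤n
card-mono {suc n} F G h rewrite card-split F | card-split G =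
  +-mono-≤ (card-mono _ _ λ A → h (true ∷ A)) (card-mono _ _ λ A → h (false ∷ A))

card-cong : ∀ {n} (F G : Family n) → (∀ A → F A ≡ G A) → card F ≡ card G
card-cong F G h = ≤-antisym (card-mono F G λ A p → trans (sym (h A)) p)
                            (card-mono G F λ A p → trans (h A) p)

card-empty : ∀ {n} (F : Family n) → (∀ A → ¬ (A ∈F F)) → card F ≡ 0
card-empty {zero} F h with F [] in eq
... | true = ⊥-elim (h [] eq)
... | false = refl
card-empty {suc n} F h rewrite card-split F
  | card-empty (F at true) (λ A → h (true ∷ A)) | card-empty (F at false) (λ A → h (false ∷ A)) = refl

2^suc : ∀ n → 2 ^ suc n ≡ 2 ^ n + 2 ^ n
2^suc n = cong (2 ^ n +_) (+-identityʳ (2 ^ n))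

card-compl : ∀ {n} (G H : Family n) → (∀ A → A ∈F G → map not A ∈F H → ⊥) → card G + card H ≤ 2 ^ n
card-compl {zero} G H h with G [] in p | H [] in q
... | true | true = ⊥-elim (h [] p q)
... | true | false = ≤-refl
... | false | true = ≤-refl
... | false | false = z≤n
card-compl {suc n} G H h = begin
  card G + card H
    ≡⟨ cong₂ _+_ (card-split G) (card-split H) ⟩
  (card (G at true) + card (G at false)) + (card (H at true) + card (H at false))
    ≡⟨ cross (card (G at true)) (card (G at false)) (card (H at true)) (card (H at false)) ⟩
  (card (G at true) + card (H at false)) + (card (G at false) + card (H at true))
    ≤⟨ +-mono-≤ (card-compl (G at true) (H at false) λ A → h (true ∷ A))
                (card-compl (G at false) (H at true) λ A → h (false ∷ A)) ⟩
  2 ^ n + 2 ^ n ≡⟨ sym (2^suc n) ⟩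
  2 ^ suc n ∎
  where
  open ≤-Reasoning
  cross : ∀ a b c d → (a + b) + (c + d) ≡ (a + d) + (b + c)
  cross = solve-∀

card-≤ : ∀ {n} (F : Family n) → card F ≤ 2 ^ n
card-≤ {n} F = ≤-trans (m≤m+n (card F) _) (card-compl F (λ _ → false) λ _ _ ())

card-self : ∀ {n} (G : Family n) → (∀ A → A ∈F G → map not A ∈F G → ⊥) → 2 * card G ≤ 2 ^ n
card-self G h rewrite +-identityʳ (card G) = card-compl G G h

gap : Bool → ℕ
gap true = 0
gap false = 1

-- For some j, the three sets together miss at most j − r of the first j elements
-- (counted with multiplicity).
Meet : ∀ {n} → ℕ → Subset n → Subset n → Subset n → Set
Meet zero _ _ _ = ⊤
Meet (suc r) [] [] [] = ⊥
Meet (suc r) (a ∷ A) (b ∷ B) (c ∷ C) = Meet (gap a + (gap b + (gap c + r))) A B C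

-- Among the first j elements, Y misses at most δ more than X, for every j.
Dom : ∀ {n} → ℕ → Subset n → Subset n → Set
Dom δ [] [] = ⊤
Dom δ (true ∷ Y) (true ∷ X) = Dom δ Y X
Dom δ (false ∷ Y) (false ∷ X) = Dom δ Y X
Dom δ (true ∷ Y) (false ∷ X) = Dom (suc δ) Y X
Dom zero (false ∷ Y) (true ∷ X) = ⊥
Dom (suc δ) (false ∷ Y) (true ∷ X) = Dom δ Y X

Closed : ∀ {n} → Family n → Set
Closed F = ∀ X Y → Dom 0 Y X → X ∈F F → Y ∈F F

full : ∀ n → Subset n
full n = replicate n true

Dom-refl : ∀ {n} δ (X : Subset n) → Dom δ X X
Dom-refl δ [] = tt
Dom-refl δ (true ∷ X) = Dom-refl δ X
Dom-refl δ (false ∷ X) = Dom-refl δ X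

Dom-full : ∀ {n} δ (X : Subset n) → Dom δ (full n) X
Dom-full δ [] = tt
Dom-full δ (true ∷ X) = Dom-full δ X
Dom-full δ (false ∷ X) = Dom-full (suc δ) X

record Good {n} (F : Family n) : Set where
  field
    closed : Closed F
    meet₁ : ∀ A B C → A ∈F F → B ∈F F → C ∈F F → Meet 1 A B C
    meet₃ : ∀ A B → A ∈F F → B ∈F F → Meet 3 A B (full n)

-- The set highest in the order Dom among those whose walk (one step up for an element,
-- two steps down for a missing one) stays at height at most s.
line : ∀ n → ℕ → Subset n
line zero s = []
line (suc n) zero = false ∷ line n 2
line (suc n) (suc s) = true ∷ line n s

-- That walk reaches height g.
Hit : ∀ {n} → ℕ → Subset n → Set
Hit zero _ = ⊤
Hit (suc g) [] = ⊥
Hit (suc g) (true ∷ A) = Hit g A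
Hit (suc g) (false ∷ A) = Hit (3 + g) A

-- A miss in place of an element costs three units of height, so an allowance of δ extra misses
-- raises the height to be reached by 3δ.
line-or-hit : ∀ {n} δ s (A : Subset n) → Dom δ (line n s) A ⊎ Hit (suc (s + δ * 3)) A
line-or-hit δ s [] = inj₁ tt
line-or-hit δ zero (false ∷ A) = line-or-hit δ 2 A
line-or-hit zero zero (true ∷ A) = inj₂ tt
line-or-hit (suc δ) zero (true ∷ A) = line-or-hit δ 2 A
line-or-hit δ (suc s) (true ∷ A) = line-or-hit δ s A
line-or-hit δ (suc s) (false ∷ A) with line-or-hit (suc δ) s A
... | inj₁ d = inj₁ d
... | inj₂ h = inj₂ (subst (λ g → Hit g A) (lem s (δ * 3)) h)
  where
  lem : ∀ s x → suc (s + (3 + x)) ≡ 3 + (suc s + x)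
  lem = solve-∀

-- At every position exactly one of A and its complement misses, so among the first j elements there
-- are at least j misses.
meet-compl : ∀ {n} r (A : Subset n) E → ¬ Meet (suc r) A (map not A) E
meet-compl r [] [] ()
meet-compl r (true ∷ A) (e ∷ E) = meet-compl (gap e + r) A E
meet-compl r (false ∷ A) (e ∷ E) = meet-compl (gap e + r) A E

-- (5/8)^g is a supersolution of the walk's harmonic equation: 1 + (5/8)³ ≤ 2 (5/8).
drift : ∀ g a b P → 8 ^ g * a ≤ 5 ^ g * P → 8 ^ (3 + g) * b ≤ 5 ^ (3 + g) * P →
  8 ^ suc g * (a + b) ≤ 5 ^ suc g * (P + P)
drift g a b P ha hb = *-cancelˡ-≤ 64 (begin
  64 * (8 ^ suc g * (a + b)) ≡⟨ l1 (8 ^ g) a b ⟩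
  512 * (8 ^ g * a) + 8 ^ (3 + g) * b ≤⟨ +-mono-≤ (*-monoʳ-≤ 512 ha) hb ⟩
  512 * (5 ^ g * P) + 5 ^ (3 + g) * P ≡⟨ l2 (5 ^ g) P ⟩
  637 * (5 ^ g * P) ≤⟨ *-monoˡ-≤ (5 ^ g * P) (m≤m+n 637 3) ⟩
  640 * (5 ^ g * P) ≡⟨ l3 (5 ^ g) P ⟩
  64 * (5 ^ suc g * (P + P)) ∎)
  where
  open ≤-Reasoning
  l1 : ∀ x a b → 64 * (8 * x * (a + b)) ≡ 512 * (x * a) + 8 * (8 * (8 * x)) * b
  l1 = solve-∀
  l2 : ∀ x P → 512 * (x * P) + 5 * (5 * (5 * x)) * P ≡ 637 * (x * P)
  l2 = solve-∀
  l3 : ∀ x P → 640 * (x * P) ≡ 64 * (5 * x * (P + P))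
  l3 = solve-∀

-- In probabilistic terms, the walk of a uniformly random set reaches height g with probability at
-- most (5/8)^g.
card-hit : ∀ {n} g (G : Family n) → (∀ A → A ∈F G → Hit g A) → 8 ^ g * card G ≤ 5 ^ g * 2 ^ n
card-hit zero G h = *-monoʳ-≤ 1 (card-≤ G)
card-hit {zero} (suc g) G h rewrite card-empty G (λ { [] → h [] }) | *-zeroʳ (8 ^ suc g) = z≤n
card-hit {suc n} (suc g) G h rewrite card-split G | +-identityʳ (2 ^ n) =
  drift g _ _ (2 ^ n) (card-hit g (G at true) λ A → h (true ∷ A))
    (card-hit (3 + g) (G at false) λ A → h (false ∷ A))

-- Two members agree until the walk is about to reach the required height; from there on a set
-- and its complement cannot both continue.
card-half : ∀ {n} r s g (G : Family n) → (∀ A B → A ∈F G → B ∈F G → Meet r A B (line n s)) →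
  suc (s + 2 * g) ≤ 3 * r → 8 ^ g * (2 * card G) ≤ 5 ^ g * 2 ^ n
card-half {n} (suc r) s zero G h _ =
  *-monoʳ-≤ 1 (card-self G λ A p q → meet-compl r A (line n s) (h A (map not A) p q))
card-half {zero} (suc r) s (suc g) G h _
  rewrite card-empty G (λ { [] p → h [] [] p p }) | *-zeroʳ (8 ^ suc g) = z≤n
card-half {suc n} (suc r) s (suc g) G h le
  rewrite card-split G | *-distribˡ-+ 2 (card (G at true)) (card (G at false)) | +-identityʳ (2 ^ n) =
  -- For two equal members of height h and a line of height at most s, meeting requires 2h + s ≥ 3r.
  -- The difference between 3r and s + 2g is unchanged by every step, so at height g the requirement
  -- is still open.
  drift g (2 * card (G at true)) (2 * card (G at false)) (2 ^ n) (up s le h) (down s le h)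
  where
  up : ∀ s → suc (s + 2 * suc g) ≤ 3 * suc r →
    (∀ A B → A ∈F G → B ∈F G → Meet (suc r) A B (line (suc n) s)) →
    8 ^ g * (2 * card (G at true)) ≤ 5 ^ g * 2 ^ n
  up zero le h = card-half (suc r) 2 g (G at true) (λ A B → h (true ∷ A) (true ∷ B))
    (subst (_≤ 3 * suc r) (lem g) le)
    where
    lem : ∀ g → suc (2 * suc g) ≡ suc (2 + 2 * g)
    lem = solve-∀
  up (suc s) le h = card-half r s g (G at true) (λ A B → h (true ∷ A) (true ∷ B))
    (+-cancelˡ-≤ 3 _ _ (subst₂ _≤_ (lem s g) (lem′ r) le))
    where
    lem : ∀ s g → suc (suc s + 2 * suc g) ≡ 3 + suc (s + 2 * g)
    lem = solve-∀
    lem′ : ∀ r → 3 * suc r ≡ 3 + 3 * r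
    lem′ = solve-∀
  down : ∀ s → suc (s + 2 * suc g) ≤ 3 * suc r →
    (∀ A B → A ∈F G → B ∈F G → Meet (suc r) A B (line (suc n) s)) →
    8 ^ (3 + g) * (2 * card (G at false)) ≤ 5 ^ (3 + g) * 2 ^ n
  down zero le h = card-half (3 + r) 2 (3 + g) (G at false) (λ A B → h (false ∷ A) (false ∷ B))
    (subst₂ _≤_ (lem g) (lem′ r) (+-monoʳ-≤ 6 le))
    where
    lem : ∀ g → 6 + suc (2 * suc g) ≡ suc (2 + 2 * (3 + g))
    lem = solve-∀
    lem′ : ∀ r → 6 + 3 * suc r ≡ 3 * (3 + r)
    lem′ = solve-∀
  down (suc s) le h = card-half (2 + r) s (3 + g) (G at false) (λ A B → h (false ∷ A) (false ∷ B))
    (subst₂ _≤_ (lem s g) (lem′ r) (+-monoʳ-≤ 3 le))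
    where
    lem : ∀ s g → 3 + suc (suc s + 2 * suc g) ≡ suc (s + 2 * (3 + g))
    lem = solve-∀
    lem′ : ∀ r → 3 + 3 * suc r ≡ 3 * (2 + r)
    lem′ = solve-∀

-- Linear programming certificates

-- The part of the requirement r that is left for the tails after these prefixes; zero means that it
-- is already met.
run : ∀ {d} → ℕ → Subset d → Subset d → Subset d → ℕ
run zero _ _ _ = zero
run (suc r) [] [] [] = suc r
run (suc r) (a ∷ A) (b ∷ B) (c ∷ C) = run (gap a + (gap b + (gap c + r))) A B C

meet-run : ∀ {d n} r (P Q E : Subset d) (A B C : Subset n) →
  Meet r (P ++ A) (Q ++ B) (E ++ C) → Meet (run r P Q E) A B C
meet-run zero P Q E A B C m = tt
meet-run (suc r) [] [] [] A B C m = m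
meet-run (suc r) (a ∷ P) (b ∷ Q) (c ∷ E) A B C m = meet-run (gap a + (gap b + (gap c + r))) P Q E A B C m

-- The allowance left for the tails, or `nothing` if the prefixes already violate `Dom`.
lead : ∀ {d} → ℕ → Subset d → Subset d → Maybe ℕ
lead δ [] [] = just δ
lead δ (true ∷ Y) (true ∷ X) = lead δ Y X
lead δ (false ∷ Y) (false ∷ X) = lead δ Y X
lead δ (true ∷ Y) (false ∷ X) = lead (suc δ) Y X
lead zero (false ∷ Y) (true ∷ X) = nothing
lead (suc δ) (false ∷ Y) (true ∷ X) = lead δ Y X

dom-lead : ∀ {d n} δ {δ′} (E P : Subset d) (Y X : Subset n) →
  lead δ E P ≡ just δ′ → Dom δ′ Y X → Dom δ (E ++ Y) (P ++ X)
dom-lead δ [] [] Y X refl D = D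
dom-lead δ (true ∷ E) (true ∷ P) Y X l D = dom-lead δ E P Y X l D
dom-lead δ (false ∷ E) (false ∷ P) Y X l D = dom-lead δ E P Y X l D
dom-lead δ (true ∷ E) (false ∷ P) Y X l D = dom-lead (suc δ) E P Y X l D
dom-lead (suc δ) (false ∷ E) (true ∷ P) Y X l D = dom-lead δ E P Y X l D

sumV : ∀ d → (Subset d → ℕ) → ℕ
sumV zero f = f []
sumV (suc d) f = sumV d (f ∘ (true ∷_)) + sumV d (f ∘ (false ∷_))

sumV-mono : ∀ d {f g : Subset d → ℕ} → (∀ P → f P ≤ g P) → sumV d f ≤ sumV d g
sumV-mono zero h = h []
sumV-mono (suc d) h = +-mono-≤ (sumV-mono d (h ∘ (true ∷_))) (sumV-mono d (h ∘ (false ∷_)))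

sumV-cong : ∀ d {f g : Subset d → ℕ} → (∀ P → f P ≡ g P) → sumV d f ≡ sumV d g
sumV-cong zero h = h []
sumV-cong (suc d) h = cong₂ _+_ (sumV-cong d (h ∘ (true ∷_))) (sumV-cong d (h ∘ (false ∷_)))

sumV-+ : ∀ d (f g : Subset d → ℕ) → sumV d (λ P → f P + g P) ≡ sumV d f + sumV d g
sumV-+ zero f g = refl
sumV-+ (suc d) f g = trans
  (cong₂ _+_ (sumV-+ d (f ∘ (true ∷_)) (g ∘ (true ∷_))) (sumV-+ d (f ∘ (false ∷_)) (g ∘ (false ∷_))))
  (lem (sumV d (f ∘ (true ∷_))) _ _ _)
  where
  lem : ∀ a b c e → (a + b) + (c + e) ≡ (a + c) + (b + e)
  lem = solve-∀

sumV-* : ∀ d c (f : Subset d → ℕ) → sumV d (λ P → c * f P) ≡ c * sumV d f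
sumV-* zero c f = refl
sumV-* (suc d) c f = trans
  (cong₂ _+_ (sumV-* d c (f ∘ (true ∷_))) (sumV-* d c (f ∘ (false ∷_))))
  (sym (*-distribˡ-+ c (sumV d (f ∘ (true ∷_))) _))

sumV-0 : ∀ d → sumV d (λ _ → 0) ≡ 0
sumV-0 zero = refl
sumV-0 (suc d) = cong₂ _+_ (sumV-0 d) (sumV-0 d)

_at*_ : ∀ {d n} → Family (d + n) → Subset d → Family n
(F at* P) A = F (P ++ A)

card-sum : ∀ d {n} (F : Family (d + n)) → card F ≡ sumV d (λ P → card (F at* P))
card-sum zero F = refl
card-sum (suc d) F = trans (card-split F) (cong₂ _+_ (card-sum d (F at true)) (card-sum d (F at false)))

δ[_,_] : ∀ {d} → Subset d → Subset d → ℕ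
δ[ [] , [] ] = 1
δ[ true ∷ A , true ∷ B ] = δ[ A , B ]
δ[ false ∷ A , false ∷ B ] = δ[ A , B ]
δ[ true ∷ A , false ∷ B ] = 0
δ[ false ∷ A , true ∷ B ] = 0

sumV-δ : ∀ {d} (A : Subset d) (f : Subset d → ℕ) → sumV d (λ P → δ[ A , P ] * f P) ≡ f A
sumV-δ [] f = +-identityʳ (f [])
sumV-δ {suc d} (true ∷ A) f
  rewrite sumV-δ A (f ∘ (true ∷_)) | sumV-0 d = +-identityʳ _
sumV-δ {suc d} (false ∷ A) f
  rewrite sumV-δ A (f ∘ (false ∷_)) | sumV-0 d = refl

multiplicity : ∀ {d} → List (Subset d × Subset d) → Subset d → ℕ
multiplicity [] P = 0
multiplicity ((A , B) ∷ ps) P = (δ[ A , P ] + δ[ B , P ]) + multiplicity ps P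

sum-pairs : ∀ {d} (x : Subset d → ℕ) Ω ps → All (λ p → x (proj₁ p) + x (proj₂ p) ≤ Ω) ps →
  sumV d (λ P → multiplicity ps P * x P) ≤ List.length ps * Ω
sum-pairs {d} x Ω [] [] = ≤-reflexive (sumV-0 d)
sum-pairs {d} x Ω ((A , B) ∷ ps) (h ∷ hs) = begin
  sumV d (λ P → ((δ[ A , P ] + δ[ B , P ]) + multiplicity ps P) * x P)
    ≡⟨ sumV-cong d (λ P → lem δ[ A , P ] δ[ B , P ] (multiplicity ps P) (x P)) ⟩
  sumV d (λ P → (δ[ A , P ] * x P + δ[ B , P ] * x P) + multiplicity ps P * x P)
    ≡⟨ sumV-+ d _ _ ⟩
  sumV d (λ P → δ[ A , P ] * x P + δ[ B , P ] * x P) + sumV d (λ P → multiplicity ps P * x P)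
    ≡⟨ cong (_+ _) (trans (sumV-+ d _ _) (cong₂ _+_ (sumV-δ A x) (sumV-δ B x))) ⟩
  (x A + x B) + sumV d (λ P → multiplicity ps P * x P)
    ≤⟨ +-mono-≤ h (sum-pairs x Ω ps hs) ⟩
  Ω + List.length ps * Ω ∎
  where
  open ≤-Reasoning
  lem : ∀ a b m y → ((a + b) + m) * y ≡ (a * y + b * y) + m * y
  lem = solve-∀

∧-split : ∀ {a b} → a ∧ b ≡ true → a ≡ true × b ≡ true
∧-split {true} e = refl , e

≡⇒T : ∀ {b} → b ≡ true → T b
≡⇒T = Equivalence.from T-≡

T⇒≡ : ∀ {b} → T b → b ≡ true
T⇒≡ = Equivalence.to T-≡

data Tail : Set where
  ↗ : Tail
  upTo : ℕ → Tail

tailSet : ∀ n → Tail → Subset n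
tailSet n ↗ = full n
tailSet n (upTo s) = line n s

Elem : ℕ → Set
Elem d = Subset d × Tail

set : ∀ {d} n → Elem d → Subset (d + n)
set n (E , t) = E ++ tailSet n t

-- Some condition, with a known member or the whole set in the third place, is still open after P
-- and Q. Then a tail after P and its complement after Q cannot both occur.
clash : ∀ {d} → List (Elem d) → Subset d → Subset d → Bool
clash [] P Q = 0 <ᵇ run 3 P Q (full _)
clash ((E , _) ∷ es) P Q = (0 <ᵇ run 1 P Q E) ∨ clash es P Q

data Tree (d : ℕ) : Set where
  leaf : List (Subset d × Subset d) → Tree d
  branch : Elem d → Tree d → Tree d → Tree d

module Certificate (G : ℕ) where

  -- Weights of a certificate are measured in units of 8 ^ G.
  U : ℕ
  U = 8 ^ G

  -- This is (5/8)^g in units of 1/U. Exponents beyond G would not be integral and fall back to the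
  -- trivial bound 1.
  weight : ℕ → ℕ
  weight g = if g ≤ᵇ G then 5 ^ g * 8 ^ (G ∸ g) else U

  weight-sound : ∀ g x Ω → 8 ^ g * x ≤ 5 ^ g * Ω → x ≤ Ω → U * x ≤ weight g * Ω
  weight-sound g x Ω h h′ with g ≤ᵇ G in eq
  ... | false = *-monoʳ-≤ U h′
  ... | true = begin
    U * x ≡⟨ cong (λ z → 8 ^ z * x) (sym (m∸n+n≡m (≤ᵇ⇒≤ g G (subst T (sym eq) tt)))) ⟩
    8 ^ (G ∸ g + g) * x ≡⟨ cong (_* x) (^-distribˡ-+-* 8 (G ∸ g) g) ⟩
    8 ^ (G ∸ g) * 8 ^ g * x ≡⟨ *-assoc (8 ^ (G ∸ g)) (8 ^ g) x ⟩
    8 ^ (G ∸ g) * (8 ^ g * x) ≤⟨ *-monoʳ-≤ (8 ^ (G ∸ g)) h ⟩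
    8 ^ (G ∸ g) * (5 ^ g * Ω) ≡⟨ lem (8 ^ (G ∸ g)) (5 ^ g) Ω ⟩
    5 ^ g * 8 ^ (G ∸ g) * Ω ∎
    where
    open ≤-Reasoning
    lem : ∀ a b c → a * (b * c) ≡ b * a * c
    lem = solve-∀

  -- Unlike _⊓_, this evaluates without unary recursion.
  min : ℕ → ℕ → ℕ
  min a b = if a ≤ᵇ b then a else b

  -- Caps bound twice the density of the sets with prefix P, so 2U is trivial and U is what
  -- reflection gives. The exponent is the largest g for which `card-half` allows s + 1 + 2g ≤ 3(r +
  -- 1).
  halfCap : ∀ {d} → Elem d → Subset d → ℕ
  halfCap (E , t) P with run 1 P P E | t
  ... | zero | _ = 2 * U
  ... | suc r | ↗ = U
  ... | suc r | upTo s = weight ⌊ 3 * suc r ∸ suc s /2⌋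

  -- If E leads P with allowance δ, closure excludes every tail dominated by the tail of e with that
  -- allowance: all tails for a full one, and for a line those whose walk does not reach s + 1 + 3δ.
  deadCap : ∀ {d} → Elem d → Subset d → ℕ
  deadCap (E , t) P with lead 0 E P | t
  ... | nothing | _ = 2 * U
  ... | just δ | ↗ = 0
  ... | just δ | upTo s = 2 * weight (suc (s + δ * 3))

  cap : ∀ {d} → List (Elem d) → List (Elem d) → Subset d → ℕ
  cap (e ∷ alive) dead P = min (halfCap e P) (cap alive dead P)
  cap [] (e ∷ dead) P = min (deadCap e P) (cap [] dead P)
  cap [] [] P with run 3 P P (full _)
  ... | zero = 2 * U
  ... | suc _ = U

  module _ {d n} (F : Family (d + n)) (good : Good F) where
    open Good good

    private
      Ω = 2 ^ n
      x : Subset d → ℕ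
      x P = card (F at* P)

    full-++ : ∀ d n → full (d + n) ≡ full d ++ full n
    full-++ zero n = refl
    full-++ (suc d) n = cong (true ∷_) (full-++ d n)

    run₃ : ∀ P Q A B → (P ++ A) ∈F F → (Q ++ B) ∈F F → Meet (run 3 P Q (full d)) A B (full n)
    run₃ P Q A B p q = meet-run 3 P Q (full d) A B (full n)
      (subst (Meet 3 (P ++ A) (Q ++ B)) (full-++ d n) (meet₃ _ _ p q))

    run₁ : ∀ P Q (e : Elem d) A B → set n e ∈F F → (P ++ A) ∈F F → (Q ++ B) ∈F F →
      Meet (run 1 P Q (proj₁ e)) A B (tailSet n (proj₂ e))
    run₁ P Q e A B m p q = meet-run 1 P Q (proj₁ e) A B _ (meet₁ _ _ _ p q m)

    clash-sound : ∀ alive → All (λ e → set n e ∈F F) alive → ∀ P Q → clash alive P Q ≡ true →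
      x P + x Q ≤ Ω
    clash-sound [] [] P Q c with run 3 P Q (full d) | run₃ P Q
    ... | suc r | h = card-compl _ _ λ A p q → meet-compl r A _ (h A _ p q)
    clash-sound (e ∷ es) (m ∷ ms) P Q c with run 1 P Q (proj₁ e) | run₁ P Q e
    ... | zero | _ = clash-sound es ms P Q c
    ... | suc r | h = card-compl _ _ λ A p q → meet-compl r A _ (h A _ m p q)

    trivial : ∀ P → U * (2 * x P) ≤ 2 * U * Ω
    trivial P = subst (_≤ 2 * U * Ω) (lem U (x P)) (*-monoʳ-≤ (2 * U) (card-≤ (F at* P)))
      where
      lem : ∀ u y → 2 * u * y ≡ u * (2 * y)
      lem = solve-∀

    half-sound : ∀ e → set n e ∈F F → ∀ P → U * (2 * x P) ≤ halfCap e P * Ω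
    half-sound (E , t) m P with run 1 P P E | t | run₁ P P (E , t)
    ... | zero | _ | _ = trivial P
    ... | suc r | ↗ | h = *-monoʳ-≤ U (card-self _ λ A p q → meet-compl r A _ (h A _ m p q))
    ... | suc r | upTo s | h =
      weight-sound g (2 * x P) Ω (narrow g refl) (card-self _ λ A p q → meet-compl r A _ (h A _ m p q))
      where
      g = ⌊ 3 * suc r ∸ suc s /2⌋
      narrow : ∀ g′ → g′ ≡ g → 8 ^ g * (2 * x P) ≤ 5 ^ g * Ω
      -- The truncated subtraction also gives g = 0 when the side condition of `card-half` fails, so
      -- plain reflection is used here.
      narrow zero eq rewrite sym eq = *-monoʳ-≤ 1 (card-self _ λ A p q → meet-compl r A _ (h A _ m p q))
      narrow (suc g′) eq = card-half (suc r) s g _ (λ A B → h A B m) (begin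
        suc s + 2 * g ≡⟨ cong (suc s +_) (cong (g +_) (+-identityʳ g)) ⟩
        suc s + (g + g) ≤⟨ +-monoʳ-≤ (suc s) (≤-trans (+-monoʳ-≤ g (⌊n/2⌋≤⌈n/2⌉ k)) (≤-reflexive (⌊n/2⌋+⌈n/2⌉≡n k))) ⟩
        suc s + k ≡⟨ m+[n∸m]≡n {suc s} {3 * suc r} le ⟩
        3 * suc r ∎)
        where
        open ≤-Reasoning
        k = 3 * suc r ∸ suc s
        le : suc s ≤ 3 * suc r
        le with suc s ≤? 3 * suc r
        ... | yes l = l
        ... | no l with () ← trans eq (cong ⌊_/2⌋ (m≤n⇒m∸n≡0 (≰⇒≥ l)))

    dead-sound : ∀ e → ¬ (set n e ∈F F) → ∀ P → U * (2 * x P) ≤ deadCap e P * Ω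
    dead-sound (E , t) m P with lead 0 E P in eq | t
    ... | nothing | _ = trivial P
    ... | just δ | ↗ rewrite card-empty (F at* P)
      (λ A p → m (closed _ _ (dom-lead 0 E P (full n) A eq (Dom-full δ A)) p)) | *-zeroʳ U = z≤n
    ... | just δ | upTo s = begin
      U * (2 * x P) ≡⟨ lem U (x P) ⟩
      2 * (U * x P) ≤⟨ *-monoʳ-≤ 2 (weight-sound g (x P) Ω (card-hit g (F at* P) hit) (card-≤ (F at* P))) ⟩
      2 * (weight g * Ω) ≡⟨ sym (*-assoc 2 (weight g) Ω) ⟩
      2 * weight g * Ω ∎
      where
      open ≤-Reasoning
      g = suc (s + δ * 3)
      lem : ∀ u y → u * (2 * y) ≡ 2 * (u * y)
      lem = solve-∀
      hit : ∀ A → A ∈F (F at* P) → Hit g A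
      hit A p with line-or-hit δ s A
      ... | inj₂ h = h
      ... | inj₁ D = ⊥-elim (m (closed _ _ (dom-lead 0 E P (line n s) A eq D) p))

    min-sound : ∀ a b {y} → y ≤ a * Ω → y ≤ b * Ω → y ≤ min a b * Ω
    min-sound a b ha hb with a ≤ᵇ b
    ... | true = ha
    ... | false = hb

    cap-sound : ∀ alive dead → All (λ e → set n e ∈F F) alive → All (λ e → ¬ (set n e ∈F F)) dead →
      ∀ P → U * (2 * x P) ≤ cap alive dead P * Ω
    cap-sound (e ∷ alive) dead (m ∷ ms) ns P =
      min-sound (halfCap e P) (cap alive dead P) (half-sound e m P) (cap-sound alive dead ms ns P)
    cap-sound [] (e ∷ dead) [] (m ∷ ns) P =
      min-sound (deadCap e P) (cap [] dead P) (dead-sound e m P) (cap-sound [] dead [] ns P)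
    cap-sound [] [] [] [] P with run 3 P P (full d) | run₃ P P
    ... | zero | _ = trivial P
    ... | suc r | h = *-monoʳ-≤ U (card-self _ λ A p q → meet-compl r A _ (h A _ p q))

  -- The dual solution is half-integral: each prefix must be covered twice, and what the pairs leave
  -- uncovered is paid by its cap. This doubling and the one inside the caps give the factor 4U.
  total : ∀ {d} → List (Elem d) → List (Elem d) → List (Subset d × Subset d) → ℕ
  total {d} alive dead ps =
    2 * U * List.length ps + sumV d (λ P → (2 ∸ multiplicity ps P) * cap alive dead P)

  clashes : ∀ {d} → List (Elem d) → List (Subset d × Subset d) → Bool
  clashes alive [] = true
  clashes alive ((P , Q) ∷ ps) = clash alive P Q ∧ clashes alive ps

  -- Weak linear programming duality: clashing pairs bound sums of two densities, caps bound the rest.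
  leaf-sound : ∀ {d n} (F : Family (d + n)) → Good F → ∀ alive dead ps →
    All (λ e → set n e ∈F F) alive → All (λ e → ¬ (set n e ∈F F)) dead →
    clashes alive ps ≡ true → 4 * U * card F ≤ total alive dead ps * 2 ^ n
  leaf-sound {d} {n} F good alive dead ps as ds c = begin
    4 * U * card F ≡⟨ cong (4 * U *_) (card-sum d F) ⟩
    4 * U * sumV d x ≡⟨ sym (sumV-* d (4 * U) x) ⟩
    sumV d (λ P → 4 * U * x P) ≤⟨ sumV-mono d (λ P → split U (m P) (x P) (2≤ (m P))) ⟩
    sumV d (λ P → 2 * U * (m P * x P) + (2 ∸ m P) * (U * (2 * x P)))
      ≤⟨ sumV-mono d (λ P → +-monoʳ-≤ (2 * U * (m P * x P))
          (*-monoʳ-≤ (2 ∸ m P) (cap-sound F good alive dead as ds P))) ⟩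
    sumV d (λ P → 2 * U * (m P * x P) + (2 ∸ m P) * (cap alive dead P * Ω))
      ≡⟨ sumV-+ d _ _ ⟩
    sumV d (λ P → 2 * U * (m P * x P)) + sumV d (λ P → (2 ∸ m P) * (cap alive dead P * Ω))
      ≡⟨ cong₂ _+_ (sumV-* d (2 * U) (λ P → m P * x P))
          (trans (sumV-cong d (λ P → lem₁ (2 ∸ m P) (cap alive dead P) Ω))
                 (sumV-* d Ω (λ P → (2 ∸ m P) * cap alive dead P))) ⟩
    2 * U * sumV d (λ P → m P * x P) + Ω * S
      ≤⟨ +-monoˡ-≤ (Ω * S) (*-monoʳ-≤ (2 * U) (sum-pairs x Ω ps (pairs ps c))) ⟩
    2 * U * (List.length ps * Ω) + Ω * S ≡⟨ lem₂ U (List.length ps) Ω S ⟩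
    total alive dead ps * Ω ∎
    where
    open ≤-Reasoning
    Ω = 2 ^ n
    x : Subset d → ℕ
    x P = card (F at* P)
    m = multiplicity ps
    S = sumV d (λ P → (2 ∸ m P) * cap alive dead P)
    2≤ : ∀ k → 2 ≤ k + (2 ∸ k)
    2≤ k = m≤n+m∸n 2 k
    lem₁ : ∀ k c Ω → k * (c * Ω) ≡ Ω * (k * c)
    lem₁ = solve-∀
    lem₂ : ∀ u l Ω S → 2 * u * (l * Ω) + Ω * S ≡ (2 * u * l + S) * Ω
    lem₂ = solve-∀
    split : ∀ u k y → 2 ≤ k + (2 ∸ k) → 4 * u * y ≤ 2 * u * (k * y) + (2 ∸ k) * (u * (2 * y))
    split u k y le = subst₂ _≤_ (l₁ u y) (l₂ u k (2 ∸ k) y) (*-monoˡ-≤ (2 * u * y) le)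
      where
      l₁ : ∀ u y → 2 * (2 * u * y) ≡ 4 * u * y
      l₁ = solve-∀
      l₂ : ∀ u k j y → (k + j) * (2 * u * y) ≡ 2 * u * (k * y) + j * (u * (2 * y))
      l₂ = solve-∀
    pairs : ∀ ps → clashes alive ps ≡ true → All (λ p → x (proj₁ p) + x (proj₂ p) ≤ Ω) ps
    pairs [] _ = []
    pairs ((P , Q) ∷ ps) c with c₁ , c₂ ← ∧-split {clash alive P Q} c =
      clash-sound F good alive as P Q c₁ ∷ pairs ps c₂

  -- A branching asks whether the set e belongs to the family: yes in the first subtree, no in the second.
  check : ∀ {d} → ℕ → List (Elem d) → List (Elem d) → Tree d → Bool
  check bound alive dead (leaf ps) = clashes alive ps ∧ (total alive dead ps <ᵇ 4 * U * bound)
  check bound alive dead (branch e t u) = check bound (e ∷ alive) dead t ∧ check bound alive (e ∷ dead) u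

  check-sound : ∀ {d n} bound (F : Family (d + n)) → Good F → ∀ alive dead t →
    All (λ e → set n e ∈F F) alive → All (λ e → ¬ (set n e ∈F F)) dead →
    check bound alive dead t ≡ true → card F < bound * 2 ^ n
  check-sound {n = n} bound F good alive dead (leaf ps) as ds c
    with c₁ , c₂ ← ∧-split {clashes alive ps} c =
    *-cancelˡ-< (4 * U) _ _ (begin-strict
      4 * U * card F ≤⟨ leaf-sound F good alive dead ps as ds c₁ ⟩
      total alive dead ps * 2 ^ n <⟨ *-monoˡ-< (2 ^ n) ⦃ m^n≢0 2 n ⦄ (<ᵇ⇒< (total alive dead ps) (4 * U * bound) (≡⇒T c₂)) ⟩
      4 * U * bound * 2 ^ n ≡⟨ *-assoc (4 * U) bound (2 ^ n) ⟩
      4 * U * (bound * 2 ^ n) ∎)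
    where open ≤-Reasoning
  check-sound {n = n} bound F good alive dead (branch e t u) as ds c
    with c₁ , c₂ ← ∧-split {check bound (e ∷ alive) dead t} c | F (set n e) in eq
  ... | true = check-sound bound F good (e ∷ alive) dead t (eq ∷ as) ds c₁
  ... | false = check-sound bound F good alive (e ∷ dead) u as
    ((λ p → case (trans (sym eq) p)) ∷ ds) c₂
    where
    case : ¬ (false ≡ true)
    case ()

-- A pair of 7-bit prefixes, packed as 128 a + b.
bits : ∀ d → ℕ → Subset d
bits zero _ = []
bits (suc d) c = (not (c / 2 ^ d % 2 ≡ᵇ 0)) ∷ bits d c
  where instance _ = m^n≢0 2 d

unpack : ∀ {d} → List ℕ → List (Subset d × Subset d)
unpack {d} = List.map λ c → bits d (c / 2 ^ d) , bits d c
  where instance _ = m^n≢0 2 d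

-- The branchings and the clashing pairs were found by a computer search.
-- At every leaf the bound on 128 |F| / 2^n is below 28.95.
tree : Tree 7
tree =
  (branch (f ∷ t ∷ t ∷ t ∷ t ∷ t ∷ t ∷ [] , upTo 0)
    (branch (f ∷ t ∷ t ∷ t ∷ t ∷ t ∷ f ∷ [] , upTo 2)
      (branch (t ∷ f ∷ t ∷ f ∷ t ∷ t ∷ t ∷ [] , upTo 1)
        (branch (f ∷ f ∷ t ∷ t ∷ f ∷ t ∷ t ∷ [] , upTo 6)
          (leaf (unpack (4090 ∷ 6136 ∷ 7161 ∷ 7670 ∷ 7799 ∷ 8048 ∷ 8177 ∷ 8703 ∷ 9211 ∷ 9725 ∷ 9982 ∷ 10236 ∷ 
            12149 ∷ 12276 ∷ 14195 ∷ 14322 ∷ 14398 ∷ 14527 ∷ 14703 ∷ 14830 ∷ 14943 ∷ 15070 ∷ 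
            15135 ∷ 15292 ∷ 15407 ∷ 15543 ∷ 15695 ∷ 15815 ∷ 15959 ∷ 16075 ∷ 16205 ∷ 16323 ∷ [])))
          (branch (f ∷ t ∷ t ∷ f ∷ f ∷ t ∷ t ∷ [] , upTo 4)
            (leaf (unpack (4083 ∷ 6133 ∷ 7160 ∷ 7668 ∷ 8039 ∷ 8172 ∷ 10230 ∷ 12139 ∷ 12266 ∷ 12415 ∷ 12542 ∷ 
              12669 ∷ 12796 ∷ 12923 ∷ 13050 ∷ 13177 ∷ 13246 ∷ 13431 ∷ 13535 ∷ 13790 ∷ 13887 ∷ 
              14066 ∷ 14193 ∷ 14320 ∷ 14447 ∷ 14574 ∷ 14701 ∷ 14751 ∷ 14895 ∷ 15055 ∷ 15209 ∷ 
              15336 ∷ 15415 ∷ 15590 ∷ 15717 ∷ 15844 ∷ 15971 ∷ 16098 ∷ 16225 ∷ 16352 ∷ [])))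
            (branch (t ∷ f ∷ f ∷ t ∷ t ∷ f ∷ t ∷ [] , ↗)
              (branch (f ∷ t ∷ t ∷ t ∷ t ∷ f ∷ t ∷ [] , upTo 1)
                (branch (f ∷ t ∷ t ∷ f ∷ t ∷ t ∷ t ∷ [] , upTo 1)
                  (leaf (unpack (3807 ∷ 4062 ∷ 6126 ∷ 7160 ∷ 7670 ∷ 7759 ∷ 7895 ∷ 8027 ∷ 8170 ∷ 10172 ∷ 
                    11197 ∷ 11710 ∷ 11881 ∷ 12018 ∷ 12145 ∷ 12189 ∷ 12415 ∷ 12542 ∷ 12669 ∷ 
                    12796 ∷ 12923 ∷ 13050 ∷ 13177 ∷ 13276 ∷ 13431 ∷ 13557 ∷ 13631 ∷ 13812 ∷ 
                    13939 ∷ 13983 ∷ 14127 ∷ 14320 ∷ 14447 ∷ 14557 ∷ 14701 ∷ 14828 ∷ 14955 ∷ 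
                    15031 ∷ 15163 ∷ 15336 ∷ 15463 ∷ 15590 ∷ 15717 ∷ 15844 ∷ 15971 ∷ 16098 ∷ 
                    16225 ∷ 16352 ∷ [])))
                  (leaf (unpack (4090 ∷ 7646 ∷ 7759 ∷ 7895 ∷ 8027 ∷ 8178 ∷ 10172 ∷ 11197 ∷ 11359 ∷ 11502 ∷ 
                    11637 ∷ 11710 ∷ 11882 ∷ 11935 ∷ 12145 ∷ 12248 ∷ 12415 ∷ 12542 ∷ 12669 ∷ 
                    12796 ∷ 12923 ∷ 12991 ∷ 13177 ∷ 13304 ∷ 13431 ∷ 13558 ∷ 13660 ∷ 13812 ∷ 
                    13939 ∷ 14011 ∷ 14169 ∷ 14320 ∷ 14447 ∷ 14557 ∷ 14701 ∷ 14828 ∷ 14955 ∷ 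
                    15066 ∷ 15209 ∷ 15336 ∷ 15463 ∷ 15590 ∷ 15717 ∷ 15844 ∷ 15971 ∷ 16098 ∷ 
                    16225 ∷ 16352 ∷ []))))
                (leaf (unpack (8015 ∷ 8170 ∷ 10099 ∷ 10174 ∷ 11129 ∷ 11228 ∷ 11375 ∷ 11510 ∷ 11637 ∷ 11756 ∷ 
                  11863 ∷ 12018 ∷ 12145 ∷ 12248 ∷ 12415 ∷ 12542 ∷ 12669 ∷ 12796 ∷ 12923 ∷ 13050 ∷ 
                  13149 ∷ 13304 ∷ 13431 ∷ 13534 ∷ 13631 ∷ 13812 ∷ 13915 ∷ 14030 ∷ 14169 ∷ 14320 ∷ 
                  14431 ∷ 14574 ∷ 14701 ∷ 14806 ∷ 14955 ∷ 15066 ∷ 15209 ∷ 15336 ∷ 15463 ∷ 15590 ∷ 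
                  15717 ∷ 15844 ∷ 15971 ∷ 16098 ∷ 16225 ∷ 16352 ∷ []))))
              (leaf (unpack (4055 ∷ 7119 ∷ 7644 ∷ 7795 ∷ 7922 ∷ 8049 ∷ 8176 ∷ 10093 ∷ 10167 ∷ 10463 ∷ 10734 ∷ 
                11129 ∷ 11256 ∷ 11327 ∷ 11486 ∷ 11637 ∷ 11764 ∷ 11835 ∷ 11982 ∷ 12115 ∷ 12241 ∷ 
                12415 ∷ 12542 ∷ 12669 ∷ 12796 ∷ 12923 ∷ 13050 ∷ 13117 ∷ 13292 ∷ 13431 ∷ 13558 ∷ 
                13756 ∷ 13915 ∷ 14038 ∷ 14169 ∷ 14296 ∷ 14447 ∷ 14526 ∷ 14685 ∷ 14810 ∷ 14955 ∷ 
                15082 ∷ 15209 ∷ 15336 ∷ 15463 ∷ 15590 ∷ 15717 ∷ 15844 ∷ 15971 ∷ 16098 ∷ 16225 ∷ 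
                16352 ∷ []))))))
        (leaf (unpack (7231 ∷ 7390 ∷ 7533 ∷ 7612 ∷ 7739 ∷ 7922 ∷ 8049 ∷ 8176 ∷ 11359 ∷ 11502 ∷ 11637 ∷ 11740 ∷ 
          11867 ∷ 12010 ∷ 12089 ∷ 12248 ∷ 12415 ∷ 12542 ∷ 12669 ∷ 12796 ∷ 12923 ∷ 13050 ∷ 13177 ∷ 
          13304 ∷ 13431 ∷ 13558 ∷ 13629 ∷ 13812 ∷ 13939 ∷ 14010 ∷ 14169 ∷ 14264 ∷ 14447 ∷ 14526 ∷ 
          14685 ∷ 14828 ∷ 14955 ∷ 15066 ∷ 15209 ∷ 15336 ∷ 15463 ∷ 15590 ∷ 15717 ∷ 15844 ∷ 15971 ∷ 
          16098 ∷ 16225 ∷ 16352 ∷ []))))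
      (leaf (unpack (8135 ∷ 9151 ∷ 10093 ∷ 10204 ∷ 11123 ∷ 11244 ∷ 11375 ∷ 11502 ∷ 11637 ∷ 11764 ∷ 11855 ∷ 
        12018 ∷ 12145 ∷ 12248 ∷ 12415 ∷ 12542 ∷ 12669 ∷ 12796 ∷ 12923 ∷ 13050 ∷ 13177 ∷ 13304 ∷ 
        13431 ∷ 13558 ∷ 13659 ∷ 13774 ∷ 13911 ∷ 14038 ∷ 14169 ∷ 14320 ∷ 14431 ∷ 14558 ∷ 14685 ∷ 
        14810 ∷ 14955 ∷ 15082 ∷ 15209 ∷ 15336 ∷ 15463 ∷ 15590 ∷ 15717 ∷ 15844 ∷ 15971 ∷ 16098 ∷ 
        16225 ∷ 16352 ∷ []))))
    (leaf (unpack (8135 ∷ 9151 ∷ 9710 ∷ 9971 ∷ 10101 ∷ 10204 ∷ 10748 ∷ 11002 ∷ 11129 ∷ 11244 ∷ 11359 ∷ 11510 ∷ 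
      11611 ∷ 11764 ∷ 11855 ∷ 12018 ∷ 12145 ∷ 12272 ∷ 12415 ∷ 12542 ∷ 12669 ∷ 12766 ∷ 12923 ∷ 
      13304 ∷ 13431 ∷ 13785 ∷ 13911 ∷ 14027 ∷ 14157 ∷ 14296 ∷ 14447 ∷ 14557 ∷ 14701 ∷ 14798 ∷ 
      14955 ∷ 15059 ∷ 15189 ∷ 15336 ∷ 15463 ∷ 15574 ∷ 15717 ∷ 15844 ∷ 15971 ∷ 16098 ∷ 16225 ∷ 
      16352 ∷ []))))
  where
  t = true
  f = false

-- The line of height 8 consists of six elements followed by the line of height 2, which makes the
-- seven-element prefix of the root. Exponents up to 24 are represented exactly in the certificate.
low-line : ∀ {n} (F : Family (7 + n)) → Good F →
  (false ∷ line (6 + n) 8) ∈F F → (true ∷ true ∷ true ∷ true ∷ false ∷ false ∷ false ∷ full n) ∈F F →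
  card F < 29 * 2 ^ n
low-line F good p q = Certificate.check-sound 24 29 F good root [] tree (p ∷ q ∷ []) [] refl
  where
  root : List (Elem 7)
  root = (false ∷ true ∷ true ∷ true ∷ true ∷ true ∷ true ∷ [] , upTo 2)
       ∷ (true ∷ true ∷ true ∷ true ∷ false ∷ false ∷ false ∷ [] , ↗) ∷ []

-- Compression

bit : Bool → ℕ
bit true = 1
bit false = 0

∣∷∣ : ∀ {n} b (A : Subset n) → ∣ b ∷ A ∣ ≡ bit b + ∣ A ∣
∣∷∣ true A = refl
∣∷∣ false A = refl

-- Splitting off the first element leads to three different families, and the offset k records the
-- common elements already found.
Cross : ∀ {n} → ℕ → ℕ → Family n → Family n → Family n → Set
Cross r k F G H = ∀ A B C → A ∈F F → B ∈F G → C ∈F H → r ≤ k + ∣ A ∩ (B ∩ C) ∣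

Dom-true : ∀ {n} b δ (Y X : Subset n) → Dom (gap b + δ) Y X → Dom δ (true ∷ Y) (b ∷ X)
Dom-true true δ Y X D = D
Dom-true false δ Y X D = D

Spread : ∀ {n} → ℕ → ℕ → ℕ → ℕ → Subset n → Subset n → Subset n → Set
Spread {n} a b c u A B C = Σ (Subset n) λ A′ → Σ (Subset n) λ B′ → Σ (Subset n) λ C′ →
  Dom a A′ A × Dom b B′ B × Dom c C′ C × ∣ A′ ∩ (B′ ∩ C′) ∣ ≤ u

spread-1 : ∀ u a b c y z → 1 + (u + (a + ((y + b) + (z + c)))) ≡ 1 + (y + (z + (u + (a + (b + c)))))
spread-1 = solve-∀

spread-2 : ∀ u a b c y z → 1 + (u + (a + ((y + b) + (z + c)))) ≡ y + (z + (u + ((1 + a) + (b + c))))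
spread-2 = solve-∀

spread-3 : ∀ u b c z → 1 + (u + (b + (z + c))) ≡ 1 + (z + (u + (b + c)))
spread-3 = solve-∀

spread-4 : ∀ u b c z → 1 + (u + (b + (z + c))) ≡ z + (u + ((1 + b) + c))
spread-4 = solve-∀

-- Greedily let each element be missed by one set that still may miss one.
meet-or-spread : ∀ {n} a b c u (A B C : Subset n) →
  Meet (suc (u + (a + (b + c)))) A B C ⊎ Spread a b c u A B C
meet-or-spread a b c u [] [] [] = inj₂ ([] , [] , [] , tt , tt , tt , z≤n)
meet-or-spread a b c u (false ∷ A) (y ∷ B) (z ∷ C)
  with meet-or-spread a (gap y + b) (gap z + c) u A B C
... | inj₁ m = inj₁ (subst (λ r → Meet r A B C) (spread-1 u a b c (gap y) (gap z)) m)
... | inj₂ (A′ , B′ , C′ , p , q , r , h) =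
  inj₂ (false ∷ A′ , true ∷ B′ , true ∷ C′ , p , Dom-true y b B′ B q , Dom-true z c C′ C r , h)
meet-or-spread (suc a) b c u (true ∷ A) (y ∷ B) (z ∷ C)
  with meet-or-spread a (gap y + b) (gap z + c) u A B C
... | inj₁ m = inj₁ (subst (λ r → Meet r A B C) (spread-2 u a b c (gap y) (gap z)) m)
... | inj₂ (A′ , B′ , C′ , p , q , r , h) =
  inj₂ (false ∷ A′ , true ∷ B′ , true ∷ C′ , p , Dom-true y b B′ B q , Dom-true z c C′ C r , h)
meet-or-spread zero b c u (true ∷ A) (false ∷ B) (z ∷ C)
  with meet-or-spread zero b (gap z + c) u A B C
... | inj₁ m = inj₁ (subst (λ r → Meet r A B C) (spread-3 u b c (gap z)) m)
... | inj₂ (A′ , B′ , C′ , p , q , r , h) =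
  inj₂ (true ∷ A′ , false ∷ B′ , true ∷ C′ , p , q , Dom-true z c C′ C r , h)
meet-or-spread zero (suc b) c u (true ∷ A) (true ∷ B) (z ∷ C)
  with meet-or-spread zero b (gap z + c) u A B C
... | inj₁ m = inj₁ (subst (λ r → Meet r A B C) (spread-4 u b c (gap z)) m)
... | inj₂ (A′ , B′ , C′ , p , q , r , h) =
  inj₂ (true ∷ A′ , false ∷ B′ , true ∷ C′ , p , q , Dom-true z c C′ C r , h)
meet-or-spread zero zero c u (true ∷ A) (true ∷ B) (false ∷ C)
  with meet-or-spread zero zero c u A B C
... | inj₁ m = inj₁ m
... | inj₂ (A′ , B′ , C′ , p , q , r , h) =
  inj₂ (true ∷ A′ , true ∷ B′ , false ∷ C′ , p , q , r , h)
meet-or-spread zero zero (suc c) u (true ∷ A) (true ∷ B) (true ∷ C)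
  with meet-or-spread zero zero c u A B C
... | inj₁ m = inj₁ (subst (λ r → Meet r A B C) (sym (+-suc u c)) m)
... | inj₂ (A′ , B′ , C′ , p , q , r , h) =
  inj₂ (true ∷ A′ , true ∷ B′ , false ∷ C′ , p , q , r , h)
meet-or-spread zero zero zero zero (true ∷ A) (true ∷ B) (true ∷ C) = inj₁ tt
meet-or-spread zero zero zero (suc u) (true ∷ A) (true ∷ B) (true ∷ C)
  with meet-or-spread zero zero zero u A B C
... | inj₁ m = inj₁ m
... | inj₂ (A′ , B′ , C′ , p , q , r , h) =
  inj₂ (true ∷ A′ , true ∷ B′ , true ∷ C′ , p , q , r , s≤s h)

-- If the walks did not meet, `meet-or-spread` would move the three sets, within the closed
-- families, to sets with at most u common elements.
meet-cross : ∀ {n} u (F G H : Family n) → Closed F → Closed G → Closed H →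
  Cross (suc u) 0 F G H → ∀ A B C → A ∈F F → B ∈F G → C ∈F H → Meet (suc u) A B C
meet-cross u F G H cF cG cH cr A B C p q r with meet-or-spread 0 0 0 u A B C
... | inj₁ m = subst (λ r → Meet r A B C) (cong suc (+-identityʳ u)) m
... | inj₂ (A′ , B′ , C′ , a , b , c , h) =
  ⊥-elim (<⇒≱ (cr A′ B′ C′ (cF A A′ a p) (cG B B′ b q) (cH C C′ c r)) h)

isFull : ∀ {n} → Family n
isFull [] = true
isFull (true ∷ A) = isFull A
isFull (false ∷ A) = false

full-isFull : ∀ n → full n ∈F isFull
full-isFull zero = refl
full-isFull (suc n) = full-isFull n

isFull⇒full : ∀ {n} (A : Subset n) → A ∈F isFull → A ≡ full n
isFull⇒full [] _ = refl
isFull⇒full (true ∷ A) h = cong (true ∷_) (isFull⇒full A h)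

isFull-closed : ∀ {n} → Closed (isFull {n})
isFull-closed [] [] D h = refl
isFull-closed (true ∷ X) (true ∷ Y) D h = isFull-closed X Y D h

-- The condition on pairs is read as one on triples whose third family consists of the whole set
-- alone, so one compression lemma serves both.
Cross₁ Cross₃ : ∀ {n} → Family n → Set
Cross₁ F = Cross 1 0 F F F
Cross₃ F = Cross 3 0 F F isFull

nonempty⇒pos : ∀ {n} (A : Subset n) → Nonempty A → 1 ≤ ∣ A ∣
nonempty⇒pos (true ∷ A) _ = s≤s z≤n
nonempty⇒pos (false ∷ A) (Fin.suc i , there p) = nonempty⇒pos A (i , p)

pos⇒nonempty : ∀ {n} (A : Subset n) → 1 ≤ ∣ A ∣ → Nonempty A
pos⇒nonempty (true ∷ A) _ = Fin.zero , here
pos⇒nonempty (false ∷ A) h with i , p ← pos⇒nonempty A h = Fin.suc i , there p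

∩-full : ∀ {n} (A : Subset n) → A ∩ full n ≡ A
∩-full = ∩-identityʳ

admissible⇒cross : ∀ {n} {F : Family n} → Admissible F → Cross₁ F × Cross₃ F
admissible⇒cross adm =
  (λ A B C p q r → nonempty⇒pos _ (threeWise A B C p q r)) ,
  (λ A B C p q r → subst (λ Z → 3 ≤ ∣ A ∩ Z ∣)
    (sym (trans (cong (B ∩_) (isFull⇒full C r)) (∩-full B))) (threeInt A B p q))
  where open Admissible adm

cross⇒admissible : ∀ {n} {F : Family n} → Cross₁ F → Cross₃ F → Admissible F
cross⇒admissible {n} c₁ c₃ = record
  { threeWise = λ A B C p q r → pos⇒nonempty _ (c₁ A B C p q r)
  ; threeInt = λ A B p q → subst (λ Z → 3 ≤ ∣ A ∩ Z ∣) (∩-full B) (c₃ A B (full n) p q (full-isFull n))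
  }

good : ∀ {n} (F : Family n) → Closed F → Admissible F → Good F
good {n} F cl adm with c₁ , c₃ ← admissible⇒cross adm = record
  { closed = cl
  ; meet₁ = meet-cross 0 F F F cl cl cl c₁
  ; meet₃ = λ A B p q → meet-cross 2 F F isFull cl cl isFull-closed c₃ A B (full n) p q (full-isFull n)
  }

-- Adding one element and exchanging two adjacent ones suffice to generate `Dom`. `under` acts at a
-- later position in both halves at once, as it must for intersections across the halves to survive.
data Op : ℕ → Set where
  raise : ∀ {n} → Op (suc n)
  swap : ∀ {n} → Op (suc (suc n))
  under : ∀ {n} → Op n → Op (suc n)

apply : ∀ {n} → Op n → Family n → Family n
apply raise F (true ∷ A) = F (true ∷ A) ∨ F (false ∷ A)
apply raise F (false ∷ A) = F (true ∷ A) ∧ F (false ∷ A)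
apply swap F (true ∷ true ∷ A) = F (true ∷ true ∷ A)
apply swap F (true ∷ false ∷ A) = F (true ∷ false ∷ A) ∨ F (false ∷ true ∷ A)
apply swap F (false ∷ true ∷ A) = F (true ∷ false ∷ A) ∧ F (false ∷ true ∷ A)
apply swap F (false ∷ false ∷ A) = F (false ∷ false ∷ A)
apply (under o) F (b ∷ A) = apply o (F at b) A

∨-split : ∀ {a b} → a ∨ b ≡ true → a ≡ true ⊎ b ≡ true
∨-split {true} _ = inj₁ refl
∨-split {false} e = inj₂ e

∨-inl : ∀ {a b} → a ≡ true → a ∨ b ≡ true
∨-inl refl = refl

apply-full : ∀ {n} (o : Op n) (F : Family n) → full n ∈F F → full n ∈F apply o F
apply-full raise F h = ∨-inl h
apply-full swap F h = h
apply-full (under o) F h = apply-full o (F at true) h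

raise-some : ∀ {n} (F : Family (suc n)) b A → (b ∷ A) ∈F apply raise F → Σ Bool λ b′ → (b′ ∷ A) ∈F F
raise-some F true A h with ∨-split h
... | inj₁ e = true , e
... | inj₂ e = false , e
raise-some F false A h = false , proj₂ (∧-split h)

-- How a set starting with two given bits lies in a family compressed by swap: its two bits, and,
-- for true ∷ false, the order they had in the original family.
data Kind : Set where
  both none kept moved held : Kind

new : Kind → Bool × Bool
new both = true , true
new none = false , false
new kept = true , false
new moved = true , false
new held = false , true

old : Bool → Kind → Bool × Bool
old c both = true , true
old c none = false , false
old c kept = true , false
old c moved = false , true
old c held = c , not c

swap-kind : ∀ {n} (F : Family (suc (suc n))) x y A → (x ∷ y ∷ A) ∈F apply swap F →
  Σ Kind λ k → new k ≡ (x , y) × (∀ c → (proj₁ (old c k) ∷ proj₂ (old c k) ∷ A) ∈F F)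
swap-kind F true true A h = both , refl , λ _ → h
swap-kind F false false A h = none , refl , λ _ → h
swap-kind F true false A h with ∨-split h
... | inj₁ e = kept , refl , λ _ → e
... | inj₂ e = moved , refl , λ _ → e
swap-kind F false true A h with e , e′ ← ∧-split h = held , refl , λ { true → e ; false → e′ }

isMoved : Kind → Bool
isMoved moved = true
isMoved _ = false

common : Bool × Bool → Bool × Bool → Bool × Bool → ℕ
common (x , y) (x′ , y′) (x″ , y″) = bit (x ∧ (x′ ∧ x″)) + bit (y ∧ (y′ ∧ y″))

everyKind : (Kind → Bool) → Bool
everyKind p = p both ∧ (p none ∧ (p kept ∧ (p moved ∧ p held)))

everyKind-sound : ∀ p → everyKind p ≡ true → ∀ k → p k ≡ true
everyKind-sound p h k with h₁ , h′ ← ∧-split {p both} h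
  with h₂ , h″ ← ∧-split {p none} h′
  with h₃ , h‴ ← ∧-split {p kept} h″
  with h₄ , h₅ ← ∧-split {p moved} h‴ with k
... | both = h₁
... | none = h₂
... | kept = h₃
... | moved = h₄
... | held = h₅

-- If some set was moved, the sets that could have been moved but were held back are read
-- in the opposite order; otherwise nothing changes.
choice : Kind → Kind → Kind → Bool
choice a b c = isMoved a ∨ (isMoved b ∨ isMoved c)

-- A finite check over the 125 triples of kinds.
common-≤ : ∀ a b c → let h = choice a b c in
  common (old h a) (old h b) (old h c) ≤ common (new a) (new b) (new c)
common-≤ a b c = ≤ᵇ⇒≤ _ _ (≡⇒T
  (everyKind-sound (λ c → test a b c)
    (everyKind-sound (λ b → everyKind λ c → test a b c)
      (everyKind-sound (λ a → everyKind λ b → everyKind λ c → test a b c) refl a) b) c))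
  where
  test : Kind → Kind → Kind → Bool
  test a b c = let h = choice a b c in
    common (old h a) (old h b) (old h c) ≤ᵇ common (new a) (new b) (new c)

∣∩₂∣ : ∀ {n} x y x′ y′ x″ y″ (A B C : Subset n) →
  ∣ (x ∷ y ∷ A) ∩ ((x′ ∷ y′ ∷ B) ∩ (x″ ∷ y″ ∷ C)) ∣ ≡
  common (x , y) (x′ , y′) (x″ , y″) + ∣ A ∩ (B ∩ C) ∣
∣∩₂∣ x y x′ y′ x″ y″ A B C = trans (∣∷∣ (x ∧ (x′ ∧ x″)) ((y ∧ (y′ ∧ y″)) ∷ R))
  (trans (cong (bit (x ∧ (x′ ∧ x″)) +_) (∣∷∣ (y ∧ (y′ ∧ y″)) R))
    (sym (+-assoc (bit (x ∧ (x′ ∧ x″))) (bit (y ∧ (y′ ∧ y″))) ∣ R ∣)))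
  where R = A ∩ (B ∩ C)

-- For `raise`, a compressed member lacking the first element was already present as it stands, so
-- that element is common neither before nor after; if all three have it, the intersection can only
-- have grown. For `swap`, `choice` selects original members with no more common elements.
cross-apply : ∀ {n} (o : Op n) r k (F G H : Family n) →
  Cross r k F G H → Cross r k (apply o F) (apply o G) (apply o H)
cross-apply raise r k F G H cr (true ∷ A) (true ∷ B) (true ∷ C) p q s
  with a , p′ ← raise-some F true A p | b , q′ ← raise-some G true B q | c , s′ ← raise-some H true C s =
  ≤-trans (cr (a ∷ A) (b ∷ B) (c ∷ C) p′ q′ s′)
    (+-monoʳ-≤ k (≤-trans (≤-reflexive (∣∷∣ (a ∧ (b ∧ c)) (A ∩ (B ∩ C))))
      (+-monoˡ-≤ ∣ A ∩ (B ∩ C) ∣ (bit-≤ (a ∧ (b ∧ c))))))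
  where
  bit-≤ : ∀ b → bit b ≤ 1
  bit-≤ true = ≤-refl
  bit-≤ false = z≤n
cross-apply raise r k F G H cr (false ∷ A) (y ∷ B) (z ∷ C) p q s
  with b , q′ ← raise-some G y B q | c , s′ ← raise-some H z C s =
  cr (false ∷ A) (b ∷ B) (c ∷ C) (proj₂ (∧-split p)) q′ s′
cross-apply raise r k F G H cr (true ∷ A) (false ∷ B) (z ∷ C) p q s
  with a , p′ ← raise-some F true A p | c , s′ ← raise-some H z C s =
  subst (λ v → r ≤ k + ∣ v ∷ (A ∩ (B ∩ C)) ∣) (∧-false a)
    (cr (a ∷ A) (false ∷ B) (c ∷ C) p′ (proj₂ (∧-split q)) s′)
  where
  ∧-false : ∀ a → a ∧ false ≡ false
  ∧-false true = refl
  ∧-false false = refl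
cross-apply raise r k F G H cr (true ∷ A) (true ∷ B) (false ∷ C) p q s
  with a , p′ ← raise-some F true A p | b , q′ ← raise-some G true B q =
  subst (λ v → r ≤ k + ∣ v ∷ (A ∩ (B ∩ C)) ∣) (∧-false a b)
    (cr (a ∷ A) (b ∷ B) (false ∷ C) p′ q′ (proj₂ (∧-split s)))
  where
  ∧-false : ∀ a b → a ∧ (b ∧ false) ≡ false
  ∧-false true true = refl
  ∧-false true false = refl
  ∧-false false _ = refl
cross-apply swap r k F G H cr (x ∷ y ∷ A) (x′ ∷ y′ ∷ B) (x″ ∷ y″ ∷ C) p q s
  with a , refl , p′ ← swap-kind F x y A p | b , refl , q′ ← swap-kind G x′ y′ B q
  | c , refl , s′ ← swap-kind H x″ y″ C s = begin
  r ≤⟨ cr (proj₁ a′ ∷ proj₂ a′ ∷ A) (proj₁ b′ ∷ proj₂ b′ ∷ B) (proj₁ c′ ∷ proj₂ c′ ∷ C) (p′ h) (q′ h) (s′ h) ⟩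
  k + ∣ (proj₁ a′ ∷ proj₂ a′ ∷ A) ∩ ((proj₁ b′ ∷ proj₂ b′ ∷ B) ∩ (proj₁ c′ ∷ proj₂ c′ ∷ C)) ∣
    ≡⟨ cong (k +_) (∣∩₂∣ (proj₁ a′) (proj₂ a′) (proj₁ b′) (proj₂ b′) (proj₁ c′) (proj₂ c′) A B C) ⟩
  k + (common a′ b′ c′ + N) ≤⟨ +-monoʳ-≤ k (+-monoˡ-≤ N (common-≤ a b c)) ⟩
  k + (common (new a) (new b) (new c) + N) ≡⟨ cong (k +_) (sym (∣∩₂∣ x y x′ y′ x″ y″ A B C)) ⟩
  k + ∣ (x ∷ y ∷ A) ∩ ((x′ ∷ y′ ∷ B) ∩ (x″ ∷ y″ ∷ C)) ∣ ∎
  where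
  open ≤-Reasoning
  h = choice a b c
  a′ = old h a
  b′ = old h b
  c′ = old h c
  N = ∣ A ∩ (B ∩ C) ∣
cross-apply (under o) r k F G H cr (a ∷ A) (b ∷ B) (c ∷ C) p q s =
  subst (r ≤_) (sym (shift A B C))
    (cross-apply o r (k + β) (F at a) (G at b) (H at c)
      (λ A B C p q s → subst (r ≤_) (shift A B C) (cr (a ∷ A) (b ∷ B) (c ∷ C) p q s)) A B C p q s)
  where
  β = bit (a ∧ (b ∧ c))
  shift : ∀ A B C → k + ∣ (a ∷ A) ∩ ((b ∷ B) ∩ (c ∷ C)) ∣ ≡ k + β + ∣ A ∩ (B ∩ C) ∣
  shift A B C = trans (cong (k +_) (∣∷∣ (a ∧ (b ∧ c)) (A ∩ (B ∩ C)))) (sym (+-assoc k β ∣ A ∩ (B ∩ C) ∣))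

admissible-apply : ∀ {n} (o : Op n) (F : Family n) → Admissible F → Admissible (apply o F)
admissible-apply {n} o F adm with c₁ , c₃ ← admissible⇒cross adm = cross⇒admissible
  (cross-apply o 1 0 F F F c₁)
  -- The third family is compressed along with F, but its image still contains the whole set.
  (λ A B C p q s → subst (λ Z → 3 ≤ ∣ A ∩ (B ∩ Z) ∣) (sym (isFull⇒full C s))
    (cross-apply o 3 0 F F isFull c₃ A B (full n) p q (apply-full o isFull (full-isFull n))))

card-∨∧ : ∀ {n} (F G : Family n) →
  card (λ A → F A ∨ G A) + card (λ A → F A ∧ G A) ≡ card F + card G
card-∨∧ {zero} F G with F [] | G []
... | true | true = refl
... | true | false = refl
... | false | true = refl
... | false | false = refl
card-∨∧ {suc n} F G
  rewrite card-split (λ A → F A ∨ G A) | card-split (λ A → F A ∧ G A) | card-split F | card-split G =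
  trans (lem (card ∨₁) (card ∨₀) (card ∧₁) (card ∧₀))
    (trans (cong₂ _+_ (card-∨∧ (F at true) (G at true)) (card-∨∧ (F at false) (G at false)))
      (lem (card (F at true)) (card (G at true)) (card (F at false)) (card (G at false))))
  where
  ∨₁ = (λ A → F A ∨ G A) at true
  ∨₀ = (λ A → F A ∨ G A) at false
  ∧₁ = (λ A → F A ∧ G A) at true
  ∧₀ = (λ A → F A ∧ G A) at false
  lem : ∀ a b c d → (a + b) + (c + d) ≡ (a + c) + (b + d)
  lem = solve-∀

-- A potential: a missing element weighs one more than the number of elements after it. `raise`
-- removes the weight of a miss, `swap` moves a miss one place to the right and saves one unit per
-- moved set.
Φ : ∀ {n} → Family n → ℕ
Φ {zero} F = 0
Φ {suc n} F = (Φ (F at true) + Φ (F at false)) + suc n * card (F at false)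

Φ-∨∧ : ∀ {n} (F G : Family n) → Φ (λ A → F A ∨ G A) + Φ (λ A → F A ∧ G A) ≡ Φ F + Φ G
Φ-∨∧ {zero} F G = refl
Φ-∨∧ {suc n} F G = trans
  (lem (Φ (∨F at true)) (Φ (∨F at false)) (suc n) (card (∨F at false)) (Φ (∧F at true)) (Φ (∧F at false)) (card (∧F at false)))
  (trans (cong₂ _+_ (cong₂ _+_ (Φ-∨∧ (F at true) (G at true)) (Φ-∨∧ (F at false) (G at false)))
      (cong (suc n *_) (card-∨∧ (F at false) (G at false))))
    (sym (lem (Φ (F at true)) (Φ (F at false)) (suc n) (card (F at false)) (Φ (G at true)) (Φ (G at false)) (card (G at false)))))
  where
  ∨F = λ A → F A ∨ G A
  ∧F = λ A → F A ∧ G A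
  lem : ∀ a b m c d e f → ((a + b) + m * c) + ((d + e) + m * f) ≡ ((a + d) + (b + e)) + m * (c + f)
  lem = solve-∀

card-split₂ : ∀ {n} (F : Family (suc (suc n))) → card F ≡
  (card ((F at true) at true) + card ((F at true) at false)) +
  (card ((F at false) at true) + card ((F at false) at false))
card-split₂ F = trans (card-split F) (cong₂ _+_ (card-split (F at true)) (card-split (F at false)))

card-apply : ∀ {n} (o : Op n) (F : Family n) → card (apply o F) ≡ card F
card-apply raise F = trans (card-split (apply raise F))
  (trans (trans (card-∨∧ (F at true) (F at false)) refl) (sym (card-split F)))
card-apply swap F = begin
  card (apply swap F) ≡⟨ card-split₂ (apply swap F) ⟩
  (a + card (λ A → G A ∨ H A)) + (card (λ A → G A ∧ H A) + d) ≡⟨ lem a _ _ d ⟩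
  (a + d) + (card (λ A → G A ∨ H A) + card (λ A → G A ∧ H A)) ≡⟨ cong ((a + d) +_) (card-∨∧ G H) ⟩
  (a + d) + (card G + card H) ≡⟨ sym (lem a _ _ d) ⟩
  (a + card G) + (card H + d) ≡⟨ sym (card-split₂ F) ⟩
  card F ∎
  where
  open ≡-Reasoning
  G = (F at true) at false
  H = (F at false) at true
  a = card ((F at true) at true)
  d = card ((F at false) at false)
  lem : ∀ a b c d → (a + b) + (c + d) ≡ (a + d) + (b + c)
  lem = solve-∀
card-apply (under o) F = trans (card-split (apply (under o) F))
  (trans (cong₂ _+_ (card-apply o (F at true)) (card-apply o (F at false))) (sym (card-split F)))

_⊑_ : ∀ {n} → Family n → Family n → Set
F ⊑ G = ∀ A → A ∈F F → A ∈F G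

⊑-full : ∀ {n} (F G : Family n) → F ⊑ G → card G ≤ card F → G ⊑ F
⊑-full {zero} F G h le [] q with F []
... | true = refl
... | false with G [] | q
...   | true | _ with () ← le
⊑-full {suc n} F G h le (b ∷ A) q
  rewrite card-split F | card-split G = half b A q
  where
  lower : ∀ b → card (F at b) ≤ card (G at b)
  lower b = card-mono (F at b) (G at b) (λ A → h (b ∷ A))
  half : ∀ b → (G at b) ⊑ (F at b)
  half true = ⊑-full (F at true) (G at true) (λ A → h (true ∷ A))
    (+-cancelʳ-≤ (card (G at false)) _ _ (≤-trans le (+-monoʳ-≤ (card (F at true)) (lower false))))
  half false = ⊑-full (F at false) (G at false) (λ A → h (false ∷ A))
    (+-cancelˡ-≤ (card (G at true)) _ _ (≤-trans le (+-monoˡ-≤ (card (F at false)) (lower true))))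

Swap : ∀ {n} → Family (suc n) → Set
Swap {zero} F = ⊤
Swap {suc n} F = ((F at false) at true) ⊑ ((F at true) at false)

Stable : ∀ {n} → Family n → Set
Stable {zero} F = ⊤
Stable {suc n} F = ((F at false) ⊑ (F at true)) × Swap F × Stable (F at true) × Stable (F at false)

⊑-or-< : ∀ {n} (F G : Family n) → G ⊑ F ⊎ card (λ A → F A ∧ G A) < card G
⊑-or-< F G with card G ≤? card (λ A → F A ∧ G A)
... | yes le = inj₁ (λ A q → proj₁ (∧-split
        (⊑-full (λ A → F A ∧ G A) G (λ A e → proj₂ (∧-split e)) le A q)))
... | no nle = inj₂ (≰⇒> nle)

card-∧-≤ : ∀ {n} (F G : Family n) → card (λ A → F A ∧ G A) ≤ card G
card-∧-≤ F G = card-mono _ G λ A e → proj₂ (∧-split e)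

Φ-raise : ∀ {n} (F : Family (suc n)) → Φ (apply raise F) ≡
  (Φ (F at true) + Φ (F at false)) + suc n * card (λ A → F (true ∷ A) ∧ F (false ∷ A))
Φ-raise {n} F = cong (_+ suc n * card (apply raise F at false)) (Φ-∨∧ (F at true) (F at false))

module _ {n} (F : Family (suc (suc n))) where
  private
    G = (F at true) at false
    H = (F at false) at true
    FF = (F at false) at false
    base = Φ ((F at true) at true) + Φ FF + (Φ G + Φ H) + (suc n + suc (suc n)) * card FF +
      suc n * (card G + card H)

  Φ-swap : Φ (apply swap F) ≡ base + card (λ A → G A ∧ H A)
  Φ-swap = begin
    Φ (apply swap F)
      ≡⟨ cong (λ c → ((Φ ((F at true) at true) + Φ ∨F + suc n * card ∨F) + (Φ ∧F + Φ FF + suc n * card FF)) +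
           suc (suc n) * c) (card-split (apply swap F at false)) ⟩
    ((Φ ((F at true) at true) + Φ ∨F + suc n * card ∨F) + (Φ ∧F + Φ FF + suc n * card FF)) +
      suc (suc n) * (card ∧F + card FF)
      ≡⟨ lem (Φ ((F at true) at true)) (Φ FF) (Φ ∨F) (Φ ∧F) n (card ∨F) (card ∧F) (card FF) ⟩
    Φ ((F at true) at true) + Φ FF + (Φ ∨F + Φ ∧F) + (suc n + suc (suc n)) * card FF +
      suc n * (card ∨F + card ∧F) + card ∧F
      ≡⟨ cong₂ (λ x y → Φ ((F at true) at true) + Φ FF + x + (suc n + suc (suc n)) * card FF +
           suc n * y + card ∧F) (Φ-∨∧ G H) (card-∨∧ G H) ⟩
    base + card ∧F ∎
    where
    open ≡-Reasoning
    ∨F = λ A → G A ∨ H A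
    ∧F = λ A → G A ∧ H A
    lem : ∀ a d g h n x y c → ((a + g + suc n * x) + (h + d + suc n * c)) + suc (suc n) * (y + c) ≡
      a + d + (g + h) + (suc n + suc (suc n)) * c + suc n * (x + y) + y
    lem = solve-∀

  Φ-noswap : Φ F ≡ base + card H
  Φ-noswap = trans (cong (λ c → ((Φ ((F at true) at true) + Φ G + suc n * card G) + (Φ H + Φ FF + suc n * card FF)) +
      suc (suc n) * c) (card-split (F at false)))
    (lem (Φ ((F at true) at true)) (Φ FF) (Φ G) (Φ H) n (card G) (card H) (card FF))
    where
    lem : ∀ a d g h n x y c → ((a + g + suc n * x) + (h + d + suc n * c)) + suc (suc n) * (y + c) ≡
      a + d + (g + h) + (suc n + suc (suc n)) * c + suc n * (x + y) + y
    lem = solve-∀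

Φ-≤ : ∀ {n} (o : Op n) (F : Family n) → Φ (apply o F) ≤ Φ F
Φ-≤ {suc n} raise F rewrite Φ-raise F =
  +-monoʳ-≤ (Φ (F at true) + Φ (F at false)) (*-monoʳ-≤ (suc n) (card-∧-≤ (F at true) (F at false)))
Φ-≤ swap F rewrite Φ-swap F | Φ-noswap F = +-monoʳ-≤ _ (card-∧-≤ ((F at true) at false) _)
Φ-≤ {suc n} (under o) F =
  +-mono-≤ (+-mono-≤ (Φ-≤ o (F at true)) (Φ-≤ o (F at false)))
    (*-monoʳ-≤ (suc n) (≤-reflexive (card-apply o (F at false))))

improve : ∀ {n} (F : Family n) → Stable F ⊎ Σ (Op n) λ o → Φ (apply o F) < Φ F
improve {zero} F = inj₁ tt
improve {suc n} F with ⊑-or-< (F at true) (F at false)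
... | inj₂ lt = inj₂ (raise , subst (_< Φ F) (sym (Φ-raise F)) (+-monoʳ-< (Φ (F at true) + Φ (F at false)) (*-monoʳ-< (suc n) lt)))
... | inj₁ r with improve (F at true) | improve (F at false)
-- The operation found for one half is applied to both; `Φ-≤` ensures that the other half does not
-- get worse.
...   | inj₂ (o , lt) | _ = inj₂ (under o , +-mono-<-≤ (+-mono-<-≤ lt (Φ-≤ o (F at false)))
          (*-monoʳ-≤ (suc n) (≤-reflexive (card-apply o (F at false)))))
...   | inj₁ _ | inj₂ (o , lt) = inj₂ (under o , +-mono-<-≤ (+-mono-≤-< (Φ-≤ o (F at true)) lt)
          (*-monoʳ-≤ (suc n) (≤-reflexive (card-apply o (F at false)))))
...   | inj₁ s | inj₁ s′ = swaps F r s s′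
  where
  swaps : ∀ {n} (F : Family (suc n)) → (F at false) ⊑ (F at true) → Stable (F at true) → Stable (F at false) →
    Stable F ⊎ Σ (Op (suc n)) λ o → Φ (apply o F) < Φ F
  swaps {zero} F r s s′ = inj₁ (r , tt , s , s′)
  swaps {suc n} F r s s′ with ⊑-or-< ((F at true) at false) ((F at false) at true)
  ... | inj₁ w = inj₁ (r , w , s , s′)
  ... | inj₂ lt = inj₂ (swap , subst₂ _<_ (sym (Φ-swap F)) (sym (Φ-noswap F)) (+-monoʳ-< _ lt))

compress : ∀ {n} (F : Family n) → Admissible F →
  Σ (Family n) λ G → Stable G × Admissible G × card G ≡ card F
compress F adm = go F adm (<-wellFounded (Φ F))
  where
  go : ∀ {n} (F : Family n) → Admissible F → Acc _<_ (Φ F) →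
    Σ (Family n) λ G → Stable G × Admissible G × card G ≡ card F
  go F adm (acc rs) with improve F
  ... | inj₁ s = F , s , adm , refl
  ... | inj₂ (o , lt) with G , s , adm′ , e ← go (apply o F) (admissible-apply o F adm) (rs lt) =
    G , s , adm′ , trans e (card-apply o F)

dropFirst : ∀ {n} → Subset n → Subset n
dropFirst [] = []
dropFirst (true ∷ A) = false ∷ A
dropFirst (false ∷ A) = false ∷ dropFirst A

Dom-dropFirst : ∀ {n} δ (Y X : Subset n) → Dom (suc δ) Y X → Dom δ Y (dropFirst X)
Dom-dropFirst δ [] [] D = tt
Dom-dropFirst δ (true ∷ Y) (true ∷ X) D = D
Dom-dropFirst δ (false ∷ Y) (true ∷ X) D = D
Dom-dropFirst δ (true ∷ Y) (false ∷ X) D = Dom-dropFirst (suc δ) Y X D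
Dom-dropFirst δ (false ∷ Y) (false ∷ X) D = Dom-dropFirst δ Y X D

stable-front : ∀ {n} (F : Family (suc n)) → Stable F → ∀ X → (false ∷ X) ∈F F → (true ∷ dropFirst X) ∈F F
stable-front F (r , _) [] h = r [] h
stable-front F (_ , w , _) (true ∷ X) h = w X h
stable-front F (_ , w , _ , s) (false ∷ X) h = w (dropFirst X) (stable-front (F at false) s X h)

-- Where Y has an element and X has a gap, the next element of X is carried to the gap by exchanges,
-- or one is added if X has none left. By `Dom-dropFirst`, Y still dominates the rest.
stable⇒closed : ∀ {n} (F : Family n) → Stable F → Closed F
stable⇒closed F s [] [] D h = h
stable⇒closed F (_ , _ , s , _) (true ∷ X) (true ∷ Y) D h = stable⇒closed (F at true) s X Y D h
stable⇒closed F (_ , _ , _ , s) (false ∷ X) (false ∷ Y) D h = stable⇒closed (F at false) s X Y D h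
stable⇒closed F st@(_ , _ , s , _) (false ∷ X) (true ∷ Y) D h =
  stable⇒closed (F at true) s (dropFirst X) Y (Dom-dropFirst 0 Y X D) (stable-front F st X h)

-- Katona's theorem

Pairwise : ∀ {n} → ℕ → Subset n → Family n → Set
Pairwise r E G = ∀ A B → A ∈F G → B ∈F G → Meet r A B E

-- kat r i / 2^r is the probability that a simple random walk of r steps starting at −i
-- reaches height 0.
kat : ℕ → ℕ → ℕ
kat r zero = 2 ^ r
kat zero (suc i) = 0
kat (suc r) (suc i) = kat r i + kat r (2 + i)

meet-length : ∀ {n} t (A B : Subset n) E → Meet t A B E → t ≤ n
meet-length zero A B E m = z≤n
meet-length (suc t) [] [] [] ()
meet-length (suc t) (a ∷ A) (b ∷ B) (e ∷ E) m = s≤s (≤-trans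
  (≤-trans (m≤n+m t (gap e)) (≤-trans (m≤n+m _ (gap b)) (m≤n+m _ (gap a))))
  (meet-length (gap a + (gap b + (gap e + t))) A B E m))

pairwise-half : ∀ {n} ρ (E : Subset n) (G : Family n) → Pairwise (suc ρ) E G → 2 * card G ≤ 2 ^ n
pairwise-half ρ E G h = card-self G λ A p q → meet-compl ρ A E (h A (map not A) p q)

double-split : ∀ {n} (G : Family (suc n)) → 2 * card G ≡ 2 * card (G at true) + 2 * card (G at false)
double-split G = trans (cong (2 *_) (card-split G)) (*-distribˡ-+ 2 (card (G at true)) _)

-- Wang's induction: the members containing the first element meet in one element less on the rest,
-- the others in one element more.
katona : ∀ r i (G : Family (suc r)) → Pairwise (suc i) (full (suc r)) G → 2 * card G ≤ 2 * kat r i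
katona r zero G h = pairwise-half 0 (full (suc r)) G h
katona zero (suc i) G h rewrite card-empty G
  (λ A p → <⇒≱ (s≤s (s≤s z≤n)) (meet-length (2 + i) A A (full 1) (h A A p p))) = z≤n
katona (suc r) (suc i) G h = begin
  2 * card G ≡⟨ double-split G ⟩
  2 * card (G at true) + 2 * card (G at false)
    ≤⟨ +-mono-≤ (katona r i (G at true) λ A B → h (true ∷ A) (true ∷ B))
                (katona r (2 + i) (G at false) λ A B → h (false ∷ A) (false ∷ B)) ⟩
  2 * kat r i + 2 * kat r (2 + i) ≡⟨ sym (*-distribˡ-+ 2 (kat r i) _) ⟩
  2 * kat (suc r) (suc i) ∎
  where open ≤-Reasoning

-- The highest set that misses two elements other than the last: a closed family without it contains
-- only sets missing at most one of them (`near-or-few`).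
near : ∀ r → Subset (3 + r)
near zero = false ∷ false ∷ true ∷ []
near (suc r) = true ∷ near r

-- As `near r` is full on the first r elements, the induction of `katona` runs until three elements
-- remain. The result is the mean of Katona's bound `kat (2 + r) i` and of `4 * kat r i`, its value
-- for families decided two elements earlier.
katona-near : ∀ r i (G : Family (3 + r)) → Pairwise (suc i) (full (3 + r)) G → Pairwise i (near r) G →
  2 * card G ≤ 4 * kat r i + kat (2 + r) i
katona-near r zero G h _ = ≤-trans (pairwise-half 0 (full (3 + r)) G h) (≤-reflexive (lem (2 ^ r)))
  where
  lem : ∀ x → 2 * (2 * (2 * x)) ≡ 4 * x + 2 * (2 * x)
  lem = solve-∀
katona-near zero (suc zero) G h e = *-monoʳ-≤ 2 (card-mono G isFull only)
  where
  only : ∀ A → A ∈F G → A ∈F isFull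
  only A p with A | h A A p p | e A A p p
  ... | true ∷ true ∷ true ∷ [] | _ | _ = refl
  ... | true ∷ true ∷ false ∷ [] | _ | ()
  ... | true ∷ false ∷ true ∷ [] | _ | ()
  ... | true ∷ false ∷ false ∷ [] | _ | ()
  ... | false ∷ A′@(_ ∷ _ ∷ []) | _ | m with s≤s (s≤s ()) ← meet-length 3 A′ A′ (false ∷ true ∷ []) m
katona-near zero (suc (suc i)) G h e = ≤-trans (≤-reflexive (cong (2 *_) (card-empty G empty))) z≤n
  where
  empty : ∀ A → ¬ (A ∈F G)
  empty A p with A | e A A p p
  ... | true ∷ true ∷ A′ | m with s≤s () ← meet-length (2 + i) A′ A′ (true ∷ []) m
  ... | true ∷ false ∷ A′ | m with s≤s () ← meet-length (4 + i) A′ A′ (true ∷ []) m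
  ... | false ∷ A′ | m with s≤s (s≤s ()) ← meet-length (4 + i) A′ A′ (false ∷ true ∷ []) m
katona-near (suc r) (suc i) G h e = begin
  2 * card G ≡⟨ double-split G ⟩
  2 * card (G at true) + 2 * card (G at false)
    ≤⟨ +-mono-≤
      (katona-near r i (G at true) (λ A B → h (true ∷ A) (true ∷ B)) (λ A B → e (true ∷ A) (true ∷ B)))
      (katona-near r (2 + i) (G at false) (λ A B → h (false ∷ A) (false ∷ B))
        (λ A B → e (false ∷ A) (false ∷ B))) ⟩
  (4 * kat r i + kat (2 + r) i) + (4 * kat r (2 + i) + kat (2 + r) (2 + i))
    ≡⟨ lem (kat r i) (kat (2 + r) i) (kat r (2 + i)) (kat (2 + r) (2 + i)) ⟩
  4 * kat (suc r) (suc i) + kat (2 + suc r) (suc i) ∎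
  where
  open ≤-Reasoning
  lem : ∀ a b c d → (4 * a + b) + (4 * c + d) ≡ 4 * (a + c) + (b + d)
  lem = solve-∀

-- Binomial sums and the growth of Katona's bound

-- The number of subsets of an ℓ-element set that miss fewer than k elements.
below : ℕ → ℕ → ℕ
below ℓ zero = 0
below zero (suc k) = 1
below (suc ℓ) (suc k) = below ℓ (suc k) + below ℓ k

below-all : ∀ ℓ k → ℓ < k → below ℓ k ≡ 2 ^ ℓ
below-all zero (suc k) _ = refl
below-all (suc ℓ) (suc k) (s≤s h) = trans
  (cong₂ _+_ (below-all ℓ (suc k) (m<n⇒m<1+n h)) (below-all ℓ k h)) (sym (2^suc ℓ))

below-sym : ∀ ℓ a b → a + b ≡ suc ℓ → below ℓ a + below ℓ b ≡ 2 ^ ℓ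
below-sym ℓ zero b refl = below-all ℓ (suc ℓ) ≤-refl
below-sym ℓ (suc a) zero eq rewrite +-identityʳ a = trans (+-identityʳ (below ℓ (suc a)))
  (below-all ℓ (suc a) (≤-reflexive (sym eq)))
below-sym zero (suc a) (suc b) eq with () ← trans (sym (+-suc a b)) (suc-injective eq)
below-sym (suc ℓ) (suc a) (suc b) eq = trans
  (lem (below ℓ (suc a)) (below ℓ a) (below ℓ (suc b)) (below ℓ b))
  (trans (cong₂ _+_ (below-sym ℓ (suc a) b (trans (sym (+-suc a b)) (suc-injective eq)))
                    (below-sym ℓ a (suc b) (suc-injective eq)))
         (sym (2^suc ℓ)))
  where
  lem : ∀ x y z w → (x + y) + (z + w) ≡ (x + w) + (y + z)
  lem = solve-∀

kat-0 : ∀ r i → r < i → kat r i ≡ 0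
kat-0 zero (suc i) _ = refl
kat-0 (suc r) (suc i) (s≤s h) = cong₂ _+_ (kat-0 r i h) (kat-0 r (2 + i) (m<n⇒m<1+n (m<n⇒m<1+n h)))

-- The reflection principle, in the parity where the walk cannot end exactly at its target: half of
-- the walks that reach it end above it.
kat-below : ∀ r i k → suc r ≡ i + 2 * k → kat r i ≡ 2 * below r k
kat-below r zero (suc k) eq = sym (trans (cong (below r (suc k) +_) (+-identityʳ (below r (suc k))))
  (below-sym r (suc k) (suc k) (trans (cong (suc k +_) (sym (+-identityʳ (suc k)))) (sym eq))))
kat-below r (suc i) zero eq = kat-0 r (suc i) (≤-reflexive (trans eq (+-identityʳ (suc i))))
kat-below zero (suc i) (suc k) eq with () ← trans (suc-injective eq) (+-suc i _)
kat-below (suc r) (suc i) (suc k) eq = trans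
  (cong₂ _+_ (kat-below r i (suc k) (suc-injective eq))
             (kat-below r (2 + i) k (trans (suc-injective eq) (lem i k))))
  (sym (*-distribˡ-+ 2 (below r (suc k)) (below r k)))
  where
  lem : ∀ i k → i + 2 * (1 + k) ≡ (2 + i) + 2 * k
  lem = solve-∀

below-choose : ∀ ℓ k → below ℓ (suc k) ≡ below ℓ k + ℓ choose k
below-choose zero zero = refl
below-choose zero (suc k) = sym (cong (1 +_) (k>n⇒nCk≡0 {0} {suc k} (s≤s z≤n)))
below-choose (suc ℓ) zero = trans (+-identityʳ (below ℓ 1)) (trans (below-choose ℓ zero) (choose-0 ℓ))
  where
  choose-0 : ∀ ℓ → ℓ choose 0 ≡ suc ℓ choose 0
  choose-0 ℓ = refl
below-choose (suc ℓ) (suc k) = begin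
  below ℓ (2 + k) + below ℓ (suc k) ≡⟨ cong₂ _+_ (below-choose ℓ (suc k)) (below-choose ℓ k) ⟩
  (below ℓ (suc k) + ℓ choose suc k) + (below ℓ k + ℓ choose k)
    ≡⟨ lem (below ℓ (suc k)) (ℓ choose suc k) (below ℓ k) (ℓ choose k) ⟩
  (below ℓ (suc k) + below ℓ k) + (ℓ choose k + ℓ choose suc k)
    ≡⟨ cong ((below ℓ (suc k) + below ℓ k) +_) (nCk+nC[k+1]≡[n+1]C[k+1] ℓ k) ⟩
  below (suc ℓ) (suc k) + suc ℓ choose suc k ∎
  where
  open ≡-Reasoning
  lem : ∀ a b c d → (a + b) + (c + d) ≡ (a + c) + (d + b)
  lem = solve-∀

absorption : ∀ n k → suc k * (suc n choose suc k) ≡ suc n * (n choose k)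
absorption n zero = trans (*-identityˡ (suc n choose 1)) (trans (nC1≡n (suc n)) (sym (*-identityʳ (suc n))))
absorption zero (suc k)
  rewrite k>n⇒nCk≡0 {1} {2 + k} (s≤s (s≤s z≤n)) | k>n⇒nCk≡0 {0} {suc k} (s≤s z≤n) = *-zeroʳ k
absorption (suc n) (suc k) = begin
  (2 + k) * ((2 + n) choose (2 + k))
    ≡⟨ cong ((2 + k) *_) (sym (nCk+nC[k+1]≡[n+1]C[k+1] (suc n) (suc k))) ⟩
  (2 + k) * (x + suc n choose (2 + k)) ≡⟨ lem k x (suc n choose (2 + k)) ⟩
  (suc k * x + x) + (2 + k) * (suc n choose (2 + k))
    ≡⟨ cong₂ (λ a b → (a + x) + b) (absorption n k) (absorption n (suc k)) ⟩
  (suc n * (n choose k) + x) + suc n * (n choose suc k) ≡⟨ lem′ (suc n) (n choose k) x (n choose suc k) ⟩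
  suc n * (n choose k + n choose suc k) + x ≡⟨ cong (λ y → suc n * y + x) (nCk+nC[k+1]≡[n+1]C[k+1] n k) ⟩
  suc n * x + x ≡⟨ +-comm (suc n * x) x ⟩
  (2 + n) * x ∎
  where
  open ≡-Reasoning
  x = suc n choose suc k
  lem : ∀ k x y → (2 + k) * (x + y) ≡ ((1 + k) * x + x) + (2 + k) * y
  lem = solve-∀
  lem′ : ∀ n a x b → (n * a + x) + n * b ≡ n * (a + b) + x
  lem′ = solve-∀

central : ℕ → ℕ
central k = (2 * k) choose k

central-suc : ∀ k → suc k * central (suc k) ≡ 2 * (suc (2 * k) * central k)
central-suc k = begin
  suc k * ((2 * suc k) choose suc k) ≡⟨ cong (λ n → suc k * (n choose suc k)) (lem k) ⟩
  suc k * ((2 + 2 * k) choose suc k) ≡⟨ cong (suc k *_) (sym (nCk+nC[k+1]≡[n+1]C[k+1] (suc (2 * k)) k)) ⟩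
  suc k * (suc (2 * k) choose k + x) ≡⟨ cong (λ y → suc k * (y + x)) flip ⟩
  suc k * (x + x) ≡⟨ lem′ (suc k) x ⟩
  2 * (suc k * x) ≡⟨ cong (2 *_) (absorption (2 * k) k) ⟩
  2 * (suc (2 * k) * central k) ∎
  where
  open ≡-Reasoning
  x = suc (2 * k) choose suc k
  lem : ∀ k → 2 * (1 + k) ≡ 2 + 2 * k
  lem = solve-∀
  lem′ : ∀ a x → a * (x + x) ≡ 2 * (a * x)
  lem′ = solve-∀
  2k+1 : ∀ k → 1 + 2 * k ≡ (1 + k) + k
  2k+1 = solve-∀
  flip : suc (2 * k) choose k ≡ x
  flip = trans (nCk≡nC[n∸k] {k} {suc (2 * k)} (m≤n⇒m≤1+n (m≤m+n k _)))
    (cong (suc (2 * k) choose_) (trans (cong (_∸ k) (2k+1 k)) (m+n∸n≡m (suc k) k)))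

-- The central coefficient is at least the mean of the 2k + 1 coefficients in its row.
central-lower : ∀ k → 4 ^ k ≤ suc (2 * k) * central k
central-lower zero = ≤-refl
central-lower (suc k) = *-cancelˡ-≤ (suc k) (begin
  suc k * (4 * 4 ^ k) ≤⟨ *-monoʳ-≤ (suc k) (*-monoʳ-≤ 4 (central-lower k)) ⟩
  suc k * (4 * (suc (2 * k) * central k)) ≡⟨ lem (suc k) (suc (2 * k) * central k) ⟩
  2 * (suc k) * (2 * (suc (2 * k) * central k)) ≡⟨ cong (2 * suc k *_) (sym (central-suc k)) ⟩
  2 * suc k * (suc k * central (suc k)) ≤⟨ *-monoˡ-≤ (suc k * central (suc k)) (n≤1+n (2 * suc k)) ⟩
  suc (2 * suc k) * (suc k * central (suc k)) ≡⟨ lem′ (suc (2 * suc k)) (suc k) (central (suc k)) ⟩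
  suc k * (suc (2 * suc k) * central (suc k)) ∎)
  where
  open ≤-Reasoning
  lem : ∀ a b → a * (4 * b) ≡ 2 * a * (2 * b)
  lem = solve-∀
  lem′ : ∀ a b c → a * (b * c) ≡ b * (a * c)
  lem′ = solve-∀

kat-central : ∀ k → kat (2 * k) 1 + central k ≡ 4 ^ k
kat-central k = begin
  kat (2 * k) 1 + central k ≡⟨ cong (_+ central k) (kat-below (2 * k) 1 k refl) ⟩
  2 * below (2 * k) k + central k ≡⟨ lem (below (2 * k) k) (central k) ⟩
  below (2 * k) k + (below (2 * k) k + central k) ≡⟨ cong (below (2 * k) k +_) (sym (below-choose (2 * k) k)) ⟩
  below (2 * k) k + below (2 * k) (suc k) ≡⟨ below-sym (2 * k) k (suc k) (lem′ k) ⟩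
  2 ^ (2 * k) ≡⟨ sym (^-*-assoc 2 2 k) ⟩
  4 ^ k ∎
  where
  open ≡-Reasoning
  lem : ∀ a b → 2 * a + b ≡ a + (a + b)
  lem = solve-∀
  lem′ : ∀ k → k + (1 + k) ≡ 1 + 2 * k
  lem′ = solve-∀

-- By `kat-central` the gap is 4b - b′ for consecutive central coefficients b and b′. The recurrence
-- turns it into 2b/(k + 1), and `central-lower` bounds b from below.
kat-gap : ∀ k → suc k * suc (2 * k) * (4 * kat (2 * k) 1) + 2 * 4 ^ k ≤
  suc k * suc (2 * k) * kat (2 * suc k) 1
kat-gap k = +-cancelʳ-≤ (suc (2 * k) * (2 * (suc (2 * k) * b))) _ _ (begin
  (suc k * suc (2 * k) * (4 * K) + 2 * 4 ^ k) + suc (2 * k) * (2 * (suc (2 * k) * b))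
    ≤⟨ +-monoˡ-≤ (suc (2 * k) * (2 * (suc (2 * k) * b)))
         (+-monoʳ-≤ (suc k * suc (2 * k) * (4 * K)) (*-monoʳ-≤ 2 (central-lower k))) ⟩
  (suc k * suc (2 * k) * (4 * K) + 2 * (suc (2 * k) * b)) + suc (2 * k) * (2 * (suc (2 * k) * b))
    ≡⟨ lem k K b ⟩
  suc k * suc (2 * k) * (4 * (K + b)) ≡⟨ cong (λ x → suc k * suc (2 * k) * (4 * x)) (kat-central k) ⟩
  suc k * suc (2 * k) * 4 ^ suc k ≡⟨ cong (suc k * suc (2 * k) *_) (sym (kat-central (suc k))) ⟩
  suc k * suc (2 * k) * (K′ + b′) ≡⟨ lem′ (suc k) (suc (2 * k)) K′ b′ ⟩
  suc k * suc (2 * k) * K′ + suc (2 * k) * (suc k * b′)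
    ≡⟨ cong (λ x → suc k * suc (2 * k) * K′ + suc (2 * k) * x) (central-suc k) ⟩
  suc k * suc (2 * k) * K′ + suc (2 * k) * (2 * (suc (2 * k) * b)) ∎)
  where
  open ≤-Reasoning
  K = kat (2 * k) 1
  K′ = kat (2 * suc k) 1
  b = central k
  b′ = central (suc k)
  lem : ∀ k K b → ((1 + k) * (1 + 2 * k) * (4 * K) + 2 * ((1 + 2 * k) * b)) +
    (1 + 2 * k) * (2 * ((1 + 2 * k) * b)) ≡ (1 + k) * (1 + 2 * k) * (4 * (K + b))
  lem = solve-∀
  lem′ : ∀ s t K b → s * t * (K + b) ≡ s * t * K + t * (s * b)
  lem′ = solve-∀

kat-step : ∀ k → 4 * kat (2 * k) 1 ≤ kat (2 * suc k) 1
kat-step k = *-cancelˡ-≤ (suc k * suc (2 * k)) (≤-trans (m≤m+n _ _) (kat-gap k))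

kat-mono : ∀ d k → 4 ^ d * kat (2 * k) 1 ≤ kat (2 * (d + k)) 1
kat-mono zero k = ≤-reflexive (*-identityˡ (kat (2 * k) 1))
kat-mono (suc d) k = ≤-trans (≤-reflexive (*-assoc 4 (4 ^ d) _))
  (≤-trans (*-monoʳ-≤ 4 (kat-mono d k)) (kat-step (d + k)))

-- Families containing a long line

module Rows (G : ℕ) where
  open Certificate G

  -- Entries of a dynamic program over the first r elements, where the line is still full. Its
  -- boundary value at ρ = 0 is reflection, its terminal value at r = 0 is `card-half` against a
  -- line of height 0.
  Bound : ℕ → ℕ → ℕ → Set
  Bound r ρ v = ∀ n (F : Family (r + n)) → Pairwise (suc ρ) (full (r + n)) F →
    Pairwise ρ (line (r + n) r) F → U * (2 * card F) ≤ v * 2 ^ n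

  Bounds : ℕ → ℕ → List ℕ → Set
  Bounds r ρ [] = ⊤
  Bounds r ρ (v ∷ vs) = Bound r ρ v × Bounds r (suc ρ) vs

  bound-suc : ∀ r ρ v v′ → Bound r ρ v → Bound r (2 + ρ) v′ → Bound (suc r) (suc ρ) (v + v′)
  bound-suc r ρ v v′ b b′ n F h e = begin
    U * (2 * card F) ≡⟨ cong (U *_) (double-split F) ⟩
    U * (2 * card (F at true) + 2 * card (F at false)) ≡⟨ *-distribˡ-+ U (2 * card (F at true)) _ ⟩
    U * (2 * card (F at true)) + U * (2 * card (F at false))
      ≤⟨ +-mono-≤
        (b n (F at true) (λ A B → h (true ∷ A) (true ∷ B)) (λ A B → e (true ∷ A) (true ∷ B)))
        (b′ n (F at false) (λ A B → h (false ∷ A) (false ∷ B)) (λ A B → e (false ∷ A) (false ∷ B))) ⟩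
    v * 2 ^ n + v′ * 2 ^ n ≡⟨ sym (*-distribʳ-+ (2 ^ n) v v′) ⟩
    (v + v′) * 2 ^ n ∎
    where open ≤-Reasoning

  bound-0 : ∀ r → Bound r 0 (U * 2 ^ r)
  bound-0 r n F h _ = begin
    U * (2 * card F) ≤⟨ *-monoʳ-≤ U (pairwise-half 0 (full (r + n)) F h) ⟩
    U * 2 ^ (r + n) ≡⟨ cong (U *_) (^-distribˡ-+-* 2 r n) ⟩
    U * (2 ^ r * 2 ^ n) ≡⟨ sym (*-assoc U (2 ^ r) (2 ^ n)) ⟩
    U * 2 ^ r * 2 ^ n ∎
    where open ≤-Reasoning

  final : ℕ → ℕ → List ℕ
  final zero ρ = []
  final (suc k) ρ = weight ⌊ suc (suc (3 * ρ)) /2⌋ ∷ final k (suc ρ)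

  final-bounds : ∀ k ρ → Bounds 0 (suc ρ) (final k ρ)
  final-bounds zero ρ = tt
  final-bounds (suc k) ρ = (λ n F _ e → weight-sound g (2 * card F) (2 ^ n)
      (card-half (suc ρ) 0 g F e le) (pairwise-half ρ (line n 0) F e)) , final-bounds k (suc ρ)
    where
    g = ⌊ suc (suc (3 * ρ)) /2⌋
    lem : ∀ ρ → 1 + (2 + 3 * ρ) ≡ 3 * (1 + ρ)
    lem = solve-∀
    le : suc (2 * g) ≤ 3 * suc ρ
    le = ≤-trans (s≤s (≤-trans (≤-reflexive (cong (g +_) (+-identityʳ g)))
      (≤-trans (+-monoʳ-≤ g (⌊n/2⌋≤⌈n/2⌉ (2 + 3 * ρ))) (≤-reflexive (⌊n/2⌋+⌈n/2⌉≡n (2 + 3 * ρ))))))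
      (≤-reflexive (lem ρ))

  inner : List ℕ → List ℕ
  inner (x ∷ y ∷ z ∷ vs) = x + z ∷ inner (y ∷ z ∷ vs)
  inner _ = []

  inner-bounds : ∀ r ρ vs → Bounds r ρ vs → Bounds (suc r) (suc ρ) (inner vs)
  inner-bounds r ρ (x ∷ y ∷ z ∷ vs) (bx , by , bz , bs) =
    bound-suc r ρ x z bx bz , inner-bounds r (suc ρ) (y ∷ z ∷ vs) (by , bz , bs)
  inner-bounds r ρ (x ∷ y ∷ []) _ = tt
  inner-bounds r ρ (x ∷ []) _ = tt
  inner-bounds r ρ [] _ = tt

  -- The list starts at ρ = 1. Each step loses one entry at the far end, so 2 + s initial entries
  -- last for s steps.
  rows : ℕ → ℕ → List ℕ
  next : ℕ → List ℕ → List ℕ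
  next a (x ∷ y ∷ vs) = a + y ∷ inner (x ∷ y ∷ vs)
  next a _ = []
  rows k zero = final k 0
  rows k (suc r) = next (U * 2 ^ r) (rows k r)

  next-bounds : ∀ r vs → Bounds r 1 vs → Bounds (suc r) 1 (next (U * 2 ^ r) vs)
  next-bounds r [] _ = tt
  next-bounds r (x ∷ []) _ = tt
  next-bounds r (x ∷ y ∷ vs) (bx , by , bs) =
    bound-suc r 0 (U * 2 ^ r) y (bound-0 r) by , inner-bounds r 1 (x ∷ y ∷ vs) (bx , by , bs)

  rows-bounds : ∀ k r → Bounds r 1 (rows k r)
  rows-bounds k zero = final-bounds k 0
  rows-bounds k (suc r) = next-bounds r (rows k r) (rows-bounds k r)

  first : List ℕ → ℕ
  first [] = 0
  first (v ∷ _) = v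

  first-bound : ∀ r vs → Bounds r 1 vs → 0 < List.length vs → Bound r 1 (first vs)
  first-bound r (v ∷ vs) (b , _) _ = b

  mid-line : ∀ s g m n (F₁ F₀ : Family m) → m ≡ s + n → 0 < List.length (rows (2 + s) s) →
    Pairwise 2 (full m) F₁ → Pairwise 1 (line m s) F₁ → (∀ A → A ∈F F₀ → Hit g A) →
    U * (2 * (card F₁ + card F₀)) ≤ (first (rows (2 + s) s) + 2 * weight g * 2 ^ s) * 2 ^ n
  mid-line s g m n F₁ F₀ refl ne h e t = begin
    U * (2 * (card F₁ + card F₀)) ≡⟨ lem U (card F₁) (card F₀) ⟩
    U * (2 * card F₁) + 2 * (U * card F₀)
      ≤⟨ +-mono-≤ (first-bound s (rows (2 + s) s) (rows-bounds (2 + s) s) ne n F₁ h e)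
           (*-monoʳ-≤ 2 (weight-sound g (card F₀) (2 ^ (s + n)) (card-hit g F₀ t) (card-≤ F₀))) ⟩
    first (rows (2 + s) s) * 2 ^ n + 2 * (weight g * 2 ^ (s + n))
      ≡⟨ cong (λ x → first (rows (2 + s) s) * 2 ^ n + 2 * (weight g * x)) (^-distribˡ-+-* 2 s n) ⟩
    first (rows (2 + s) s) * 2 ^ n + 2 * (weight g * (2 ^ s * 2 ^ n))
      ≡⟨ lem′ (first (rows (2 + s) s)) (2 ^ n) (weight g) (2 ^ s) ⟩
    (first (rows (2 + s) s) + 2 * weight g * 2 ^ s) * 2 ^ n ∎
    where
    open ≤-Reasoning
    lem : ∀ u a b → u * (2 * (a + b)) ≡ u * (2 * a) + 2 * (u * b)
    lem = solve-∀
    lem′ : ∀ f n w s → f * n + 2 * (w * (s * n)) ≡ (f + 2 * w * s) * n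
    lem′ = solve-∀

  mid-line-< : ∀ s g m n (F₁ F₀ : Family m) → m ≡ s + n → (0 <ᵇ List.length (rows (2 + s) s)) ≡ true →
    (64 * (first (rows (2 + s) s) + 2 * weight g * 2 ^ s) <ᵇ 29 * (2 * U * 2 ^ s)) ≡ true →
    Pairwise 2 (full m) F₁ → Pairwise 1 (line m s) F₁ → (∀ A → A ∈F F₀ → Hit g A) →
    64 * (card F₁ + card F₀) < 29 * 2 ^ m
  mid-line-< s g m n F₁ F₀ eq ne num h e t = *-cancelˡ-< (2 * U) _ _ (begin-strict
    2 * U * (64 * S) ≡⟨ lem U S ⟩
    64 * (U * (2 * S)) ≤⟨ *-monoʳ-≤ 64 (mid-line s g m n F₁ F₀ eq (<ᵇ⇒< 0 _ (≡⇒T ne)) h e t) ⟩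
    64 * (c * 2 ^ n) ≡⟨ sym (*-assoc 64 c (2 ^ n)) ⟩
    64 * c * 2 ^ n <⟨ *-monoˡ-< (2 ^ n) ⦃ m^n≢0 2 n ⦄ (<ᵇ⇒< (64 * c) (29 * (2 * U * 2 ^ s)) (≡⇒T num)) ⟩
    29 * (2 * U * 2 ^ s) * 2 ^ n ≡⟨ lem′ U (2 ^ s) (2 ^ n) ⟩
    2 * U * (29 * (2 ^ s * 2 ^ n)) ≡⟨ cong (λ x → 2 * U * (29 * x)) (sym (trans (cong (2 ^_) eq) (^-distribˡ-+-* 2 s n))) ⟩
    2 * U * (29 * 2 ^ m) ∎)
    where
    open ≤-Reasoning
    S = card F₁ + card F₀
    c = first (rows (2 + s) s) + 2 * weight g * 2 ^ s
    lem : ∀ u x → 2 * u * (64 * x) ≡ 64 * (u * (2 * x))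
    lem = solve-∀
    lem′ : ∀ u a b → 29 * (2 * u * a) * b ≡ 2 * u * (29 * (a * b))
    lem′ = solve-∀

-- Height 9 reflects the absence of the line of height 8. The single line of height 32 serves all
-- shorter ones, since closure makes it present whenever one of them is.
mid-line-29 : ∀ m n (F₁ F₀ : Family m) → m ≡ 32 + n →
  Pairwise 2 (full m) F₁ → Pairwise 1 (line m 32) F₁ → (∀ A → A ∈F F₀ → Hit 9 A) →
  64 * (card F₁ + card F₀) < 29 * 2 ^ m
mid-line-29 m n F₁ F₀ eq = Rows.mid-line-< 24 32 9 m n F₁ F₀ eq refl refl

-- Past time r the reflected pairs are controlled by (5/6)^γ, which the walk shrinks
-- by the factor 341/360 = ((6/5) + (5/6)²)/2 at every step up to that time.
escape : ∀ r ℓ i ρ σ γ B (G : Family (r + ℓ)) → Pairwise (suc i) (full (r + ℓ)) G →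
  Pairwise ρ (line (r + ℓ) σ) G → i ≤ ρ → r ≤ γ → suc (σ + 2 * γ) ≤ 3 * ρ + 2 * B →
  5 ^ B * 6 ^ γ * 360 ^ r * (2 * card G) ≤
  5 ^ B * 6 ^ γ * 360 ^ r * (kat r i * 2 ^ ℓ) + 6 ^ B * 5 ^ γ * 341 ^ r * 2 ^ (r + ℓ)
escape r ℓ zero ρ σ γ B G h e _ _ _ = ≤-trans
  (*-monoʳ-≤ (5 ^ B * 6 ^ γ * 360 ^ r)
    (≤-trans (pairwise-half 0 (full (r + ℓ)) G h) (≤-reflexive (^-distribˡ-+-* 2 r ℓ))))
  (m≤m+n _ _)
escape zero ℓ (suc i) (suc ρ) σ γ B G h e _ _ le with γ ≤? B
... | yes γ≤B = ≤-trans (*-mono-≤ (*-monoˡ-≤ 1 swapped) (pairwise-half ρ (line ℓ σ) G e)) (m≤n+m _ _)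
  where
  swapped : 5 ^ B * 6 ^ γ ≤ 6 ^ B * 5 ^ γ
  swapped with d , refl ← m≤n⇒∃[o]m+o≡n γ≤B
    rewrite ^-distribˡ-+-* 5 γ d | ^-distribˡ-+-* 6 γ d = begin
    5 ^ γ * 5 ^ d * 6 ^ γ ≤⟨ *-monoˡ-≤ (6 ^ γ) (*-monoʳ-≤ (5 ^ γ) (^-monoˡ-≤ d (n≤1+n 5))) ⟩
    5 ^ γ * 6 ^ d * 6 ^ γ ≡⟨ lem (5 ^ γ) (6 ^ d) (6 ^ γ) ⟩
    6 ^ γ * 6 ^ d * 5 ^ γ ∎
    where
    open ≤-Reasoning
    lem : ∀ a b c → a * b * c ≡ c * b * a
    lem = solve-∀
... | no γ≰B with d , refl ← m≤n⇒∃[o]m+o≡n (≰⇒≥ γ≰B)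
    rewrite ^-distribˡ-+-* 5 B d | ^-distribˡ-+-* 6 B d = ≤-trans (begin
  5 ^ B * (6 ^ B * 6 ^ d) * 1 * (2 * card G) ≡⟨ lem₁ (5 ^ B) (6 ^ B) (6 ^ d) (2 * card G) ⟩
  6 ^ B * 5 ^ B * (6 ^ d * (2 * card G))
    -- The base 5/8 is deliberately weakened to 5/6. The one-step factor (1/x + x²)/2 is least at x
    -- = 2^(-1/3), close to 5/6, whereas 5/8 would give only 637/640.
    ≤⟨ *-monoʳ-≤ (6 ^ B * 5 ^ B) (*-monoˡ-≤ (2 * card G) (^-monoˡ-≤ d (m≤m+n 6 2))) ⟩
  6 ^ B * 5 ^ B * (8 ^ d * (2 * card G)) ≤⟨ *-monoʳ-≤ (6 ^ B * 5 ^ B) (card-half (suc ρ) σ d G e le′) ⟩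
  6 ^ B * 5 ^ B * (5 ^ d * 2 ^ ℓ) ≡⟨ lem₂ (6 ^ B) (5 ^ B) (5 ^ d) (2 ^ ℓ) ⟩
  6 ^ B * (5 ^ B * 5 ^ d) * 1 * 2 ^ ℓ ∎) (m≤n+m _ _)
  where
  open ≤-Reasoning
  lem₁ : ∀ a b c x → a * (b * c) * 1 * x ≡ b * a * (c * x)
  lem₁ = solve-∀
  lem₂ : ∀ a b c x → a * b * (c * x) ≡ a * (b * c) * 1 * x
  lem₂ = solve-∀
  lem₃ : ∀ σ B d → 1 + (σ + 2 * (B + d)) ≡ (1 + (σ + 2 * d)) + 2 * B
  lem₃ = solve-∀
  le′ : suc (σ + 2 * d) ≤ 3 * suc ρ
  le′ = +-cancelʳ-≤ (2 * B) _ _ (≤-trans (≤-reflexive (sym (lem₃ σ B d))) le)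
escape (suc r) ℓ (suc i) (suc ρ) σ (suc γ) B G h e (s≤s i≤ρ) (s≤s r≤γ) le
  rewrite double-split G = begin
  5 ^ B * 6 ^ suc γ * 360 ^ suc r * (a + b) ≡⟨ l₁ (5 ^ B) (6 ^ γ) (360 ^ r) a b ⟩
  2160 * (5 ^ B * 6 ^ γ * 360 ^ r * a) + 10 * (5 ^ B * 6 ^ (3 + γ) * 360 ^ r * b)
    ≤⟨ +-mono-≤ (*-monoʳ-≤ 2160 (up σ le e)) (*-monoʳ-≤ 10 (down σ le e)) ⟩
  2160 * (5 ^ B * 6 ^ γ * 360 ^ r * (kat r i * 2 ^ ℓ) + 6 ^ B * 5 ^ γ * 341 ^ r * 2 ^ (r + ℓ)) +
  10 * (5 ^ B * 6 ^ (3 + γ) * 360 ^ r * (kat r (2 + i) * 2 ^ ℓ) + 6 ^ B * 5 ^ (3 + γ) * 341 ^ r * 2 ^ (r + ℓ))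
    ≡⟨ l₂ (5 ^ B) (6 ^ γ) (360 ^ r) (kat r i) (kat r (2 + i)) (2 ^ ℓ) (6 ^ B) (5 ^ γ) (341 ^ r) (2 ^ (r + ℓ)) ⟩
  5 ^ B * 6 ^ suc γ * 360 ^ suc r * (kat (suc r) (suc i) * 2 ^ ℓ) +
  6 ^ B * 5 ^ suc γ * 341 ^ suc r * 2 ^ (suc r + ℓ) ∎
  where
  open ≤-Reasoning
  a = 2 * card (G at true)
  b = 2 * card (G at false)
  l₁ : ∀ X Y Z a b → X * (6 * Y) * (360 * Z) * (a + b) ≡
    2160 * (X * Y * Z * a) + 10 * (X * (6 * (6 * (6 * Y))) * Z * b)
  l₁ = solve-∀
  l₂ : ∀ X Y Z k₁ k₂ L W V T P →
    2160 * (X * Y * Z * (k₁ * L) + W * V * T * P) +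
    10 * (X * (6 * (6 * (6 * Y))) * Z * (k₂ * L) + W * (5 * (5 * (5 * V))) * T * P) ≡
    X * (6 * Y) * (360 * Z) * ((k₁ + k₂) * L) + W * (5 * V) * (341 * T) * (2 * P)
  l₂ = solve-∀
  up : ∀ σ → suc (σ + 2 * suc γ) ≤ 3 * suc ρ + 2 * B → Pairwise (suc ρ) (line (suc r + ℓ) σ) G →
    5 ^ B * 6 ^ γ * 360 ^ r * a ≤
    5 ^ B * 6 ^ γ * 360 ^ r * (kat r i * 2 ^ ℓ) + 6 ^ B * 5 ^ γ * 341 ^ r * 2 ^ (r + ℓ)
  up zero le e = escape r ℓ i (suc ρ) 2 γ B (G at true) (λ A B → h (true ∷ A) (true ∷ B))
    (λ A B → e (true ∷ A) (true ∷ B)) (m≤n⇒m≤1+n i≤ρ) r≤γ (≤-trans (≤-reflexive (lem γ)) le)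
    where
    lem : ∀ γ → 1 + (2 + 2 * γ) ≡ 1 + 2 * (1 + γ)
    lem = solve-∀
  up (suc σ) le e = escape r ℓ i ρ σ γ B (G at true) (λ A B → h (true ∷ A) (true ∷ B))
    (λ A B → e (true ∷ A) (true ∷ B)) i≤ρ r≤γ
    (+-cancelˡ-≤ 3 _ _ (≤-trans (≤-reflexive (lem σ γ)) (≤-trans le (≤-reflexive (lem′ ρ B)))))
    where
    lem : ∀ σ γ → 3 + (1 + (σ + 2 * γ)) ≡ 1 + ((1 + σ) + 2 * (1 + γ))
    lem = solve-∀
    lem′ : ∀ ρ B → 3 * (1 + ρ) + 2 * B ≡ 3 + (3 * ρ + 2 * B)
    lem′ = solve-∀
  down : ∀ σ → suc (σ + 2 * suc γ) ≤ 3 * suc ρ + 2 * B → Pairwise (suc ρ) (line (suc r + ℓ) σ) G →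
    5 ^ B * 6 ^ (3 + γ) * 360 ^ r * b ≤
    5 ^ B * 6 ^ (3 + γ) * 360 ^ r * (kat r (2 + i) * 2 ^ ℓ) + 6 ^ B * 5 ^ (3 + γ) * 341 ^ r * 2 ^ (r + ℓ)
  down zero le e = escape r ℓ (2 + i) (3 + ρ) 2 (3 + γ) B (G at false)
    (λ A B → h (false ∷ A) (false ∷ B)) (λ A B → e (false ∷ A) (false ∷ B))
    (s≤s (s≤s (m≤n⇒m≤1+n i≤ρ))) (m≤n⇒m≤o+n 3 r≤γ)
    (≤-trans (≤-reflexive (lem γ)) (≤-trans (+-monoʳ-≤ 6 le) (≤-reflexive (lem′ ρ B))))
    where
    lem : ∀ γ → 1 + (2 + 2 * (3 + γ)) ≡ 6 + (1 + 2 * (1 + γ))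
    lem = solve-∀
    lem′ : ∀ ρ B → 6 + (3 * (1 + ρ) + 2 * B) ≡ 3 * (3 + ρ) + 2 * B
    lem′ = solve-∀
  down (suc σ) le e = escape r ℓ (2 + i) (2 + ρ) σ (3 + γ) B (G at false)
    (λ A B → h (false ∷ A) (false ∷ B)) (λ A B → e (false ∷ A) (false ∷ B))
    (s≤s (s≤s i≤ρ)) (m≤n⇒m≤o+n 3 r≤γ)
    (≤-trans (≤-reflexive (lem σ γ)) (≤-trans (+-monoʳ-≤ 3 le) (≤-reflexive (lem′ ρ B))))
    where
    lem : ∀ σ γ → 1 + (σ + 2 * (3 + γ)) ≡ 3 + (1 + ((1 + σ) + 2 * (1 + γ)))
    lem = solve-∀
    lem′ : ∀ ρ B → 3 + (3 * (1 + ρ) + 2 * B) ≡ 3 * (2 + ρ) + 2 * B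
    lem′ = solve-∀

power-compare : ∀ x y a → x ≤ y → 6 * x ≤ 5 * y → x ^ suc a * 6 ^ a ≤ y ^ suc a * 5 ^ a
power-compare x y a h h′ = begin
  x * x ^ a * 6 ^ a ≡⟨ *-assoc x (x ^ a) (6 ^ a) ⟩
  x * (x ^ a * 6 ^ a) ≤⟨ *-mono-≤ h (powers a) ⟩
  y * (y ^ a * 5 ^ a) ≡⟨ sym (*-assoc y (y ^ a) (5 ^ a)) ⟩
  y * y ^ a * 5 ^ a ∎
  where
  open ≤-Reasoning
  lem : ∀ x p c q → x * p * (c * q) ≡ c * x * (p * q)
  lem = solve-∀
  powers : ∀ a → x ^ a * 6 ^ a ≤ y ^ a * 5 ^ a
  powers zero = ≤-refl
  powers (suc a) = subst₂ _≤_ (sym (lem x (x ^ a) 6 (6 ^ a))) (sym (lem y (y ^ a) 5 (5 ^ a)))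
    (*-mono-≤ h′ (powers a))

^-product : ∀ x y n → (x * y) ^ n ≡ x ^ n * y ^ n
^-product x y zero = refl
^-product x y (suc n) = trans (cong (x * y *_) (^-product x y n)) (lem x y (x ^ n) (y ^ n))
  where
  lem : ∀ x y u v → x * y * (u * v) ≡ x * u * (y * v)
  lem = solve-∀

-- Twenty-four steps at rate 341/360, even after paying 6/5, fall below 25/64 = (5/8)², the rate at
-- which the sets without the first element become rare.
ratio : ∀ a → 64 ^ suc a * 341 ^ (24 * suc a) * 6 ^ a ≤ 25 ^ suc a * 360 ^ (24 * suc a) * 5 ^ a
ratio a = subst₂ _≤_ (cong (_* 6 ^ a) (powers 64 341)) (cong (_* 5 ^ a) (powers 25 360))
  (power-compare (64 * 341 ^ 24) (25 * 360 ^ 24) a (≤ᵇ⇒≤ _ _ tt) (≤ᵇ⇒≤ _ _ tt))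
  where
  powers : ∀ x y → (x * y ^ 24) ^ suc a ≡ x ^ suc a * y ^ (24 * suc a)
  powers x y = trans (^-product x (y ^ 24) (suc a)) (cong (x ^ suc a *_) (^-*-assoc y 24 (suc a)))

-- The geometric decay (25/64)^a eventually beats the gap between consecutive Katona bounds (kat-gap).
decay : ∀ d → let a = suc (d + 16) in 16 * (suc (12 * a) * suc (2 * (12 * a)) * 25 ^ a) < 64 ^ a
decay zero = <ᵇ⇒< _ _ tt
decay (suc d) = begin-strict
  16 * (p (suc a) * (25 * 25 ^ a)) ≡⟨ l₁ (p (suc a)) (25 ^ a) ⟩
  25 * (p (suc a) * (16 * 25 ^ a))
    ≤⟨ *-monoʳ-≤ 25 (*-monoˡ-≤ (16 * 25 ^ a) p-suc) ⟩
  25 * (2 * p a * (16 * 25 ^ a)) ≡⟨ l₃ (p a) (25 ^ a) ⟩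
  50 * (16 * (p a * 25 ^ a)) <⟨ *-monoʳ-< 50 (decay d) ⟩
  50 * 64 ^ a ≤⟨ *-monoˡ-≤ (64 ^ a) (m≤m+n 50 14) ⟩
  64 * 64 ^ a ∎
  where
  open ≤-Reasoning
  a = suc (d + 16)
  p : ℕ → ℕ
  p a = suc (12 * a) * suc (2 * (12 * a))
  l₁ : ∀ p x → 16 * (p * (25 * x)) ≡ 25 * (p * (16 * x))
  l₁ = solve-∀
  l₂ : ∀ d → 2 * ((1 + 12 * (1 + (d + 16))) * (1 + 2 * (12 * (1 + (d + 16))))) ≡
    (1 + 12 * (2 + (d + 16))) * (1 + 2 * (12 * (2 + (d + 16)))) + (288 * (d * d) + 9252 * d + 73729)
  l₂ = solve-∀
  p-suc : p (suc a) ≤ 2 * p a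
  p-suc = ≤-trans (m≤m+n (p (suc a)) (288 * (d * d) + 9252 * d + 73729)) (≤-reflexive (sym (l₂ d)))
  l₃ : ∀ p x → 25 * (2 * p * (16 * x)) ≡ 50 * (16 * (p * x))
  l₃ = solve-∀

hit-64 : ∀ {m} a (F₀ : Family m) → (∀ A → A ∈F F₀ → Hit (suc (2 * a)) A) →
  5 * (64 ^ suc a * card F₀) ≤ 8 * (25 ^ suc a * 2 ^ m)
hit-64 {m} a F₀ h = begin
  5 * (64 * 64 ^ a * card F₀) ≡⟨ cong (λ x → 5 * (64 * x * card F₀)) (^-*-assoc 8 2 a) ⟩
  5 * (64 * 8 ^ (2 * a) * card F₀) ≡⟨ l₁ (8 ^ (2 * a)) (card F₀) ⟩
  40 * (8 ^ suc (2 * a) * card F₀) ≤⟨ *-monoʳ-≤ 40 (card-hit (suc (2 * a)) F₀ h) ⟩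
  40 * (5 ^ suc (2 * a) * 2 ^ m) ≡⟨ l₂ (5 ^ (2 * a)) (2 ^ m) ⟩
  8 * (25 * 5 ^ (2 * a) * 2 ^ m) ≡⟨ cong (λ x → 8 * (25 * x * 2 ^ m)) (sym (^-*-assoc 5 2 a)) ⟩
  8 * (25 ^ suc a * 2 ^ m) ∎
  where
  open ≤-Reasoning
  l₁ : ∀ x c → 5 * (64 * x * c) ≡ 40 * (8 * x * c)
  l₁ = solve-∀
  l₂ : ∀ x c → 40 * (5 * x * c) ≡ 8 * (25 * x * c)
  l₂ = solve-∀

-- Here the sets without the first element are too few to fill the gap left by katona-near.
long-line : ∀ d k {m} (F₁ F₀ : Family m) → let a = d + 16 in suc k ≤ 12 * suc a → m ≡ 2 * k + 3 →
  2 * card F₁ ≤ 4 * kat (2 * k) 1 + kat (2 * suc k) 1 → (∀ A → A ∈F F₀ → Hit (suc (2 * a)) A) →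
  card F₁ + card F₀ < kat (2 * suc k) 1
long-line d k {m} F₁ F₀ le refl h t = *-cancelˡ-< 2 _ _ (begin-strict
  2 * (f₁ + f₀) ≡⟨ *-distribˡ-+ 2 f₁ f₀ ⟩
  2 * f₁ + 2 * f₀ ≤⟨ +-monoˡ-≤ (2 * f₀) h ⟩
  4 * K + K′ + 2 * f₀ ≡⟨ r₁ (4 * K) K′ (2 * f₀) ⟩
  (4 * K + 2 * f₀) + K′ <⟨ +-monoˡ-< K′ gain ⟩
  K′ + K′ ≡⟨ cong (K′ +_) (sym (+-identityʳ K′)) ⟩
  2 * K′ ∎)
  where
  open ≤-Reasoning
  a = d + 16
  f₁ = card F₁
  f₀ = card F₀
  K = kat (2 * k) 1
  K′ = kat (2 * suc k) 1
  p = suc k * suc (2 * k)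
  P = suc (12 * suc a) * suc (2 * (12 * suc a))
  p≤P : p ≤ P
  p≤P = *-mono-≤ (m≤n⇒m≤1+n le) (s≤s (*-monoʳ-≤ 2 (≤-trans (n≤1+n k) le)))
  r₁ : ∀ a b c → a + b + c ≡ (a + c) + b
  r₁ = solve-∀
  r₂ : ∀ s p f → s * (p * f) * 5 ≡ p * (5 * (s * f))
  r₂ = solve-∀
  r₃ : ∀ p t q → p * (8 * (t * (q * 8))) ≡ 16 * (p * t) * (4 * q)
  r₃ = solve-∀
  r₄ : ∀ s q → s * (4 * q) ≡ s * q * 4
  r₄ = solve-∀
  r₅ : ∀ p x f → p * (x + 2 * f) ≡ p * x + 2 * (p * f)
  r₅ = solve-∀
  2^m : 2 ^ (2 * k + 3) ≡ 4 ^ k * 8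
  2^m = trans (^-distribˡ-+-* 2 (2 * k) 3) (cong (_* 8) (sym (^-*-assoc 2 2 k)))
  small : p * f₀ < 4 ^ k
  small = *-cancelˡ-< (64 ^ suc a) _ _ (*-cancelʳ-< 5 _ _ (begin-strict
    64 ^ suc a * (p * f₀) * 5 ≡⟨ r₂ (64 ^ suc a) p f₀ ⟩
    p * (5 * (64 ^ suc a * f₀)) ≤⟨ *-mono-≤ p≤P (hit-64 a F₀ t) ⟩
    P * (8 * (25 ^ suc a * 2 ^ (2 * k + 3))) ≡⟨ cong (λ x → P * (8 * (25 ^ suc a * x))) 2^m ⟩
    P * (8 * (25 ^ suc a * (4 ^ k * 8))) ≡⟨ r₃ P (25 ^ suc a) (4 ^ k) ⟩
    16 * (P * 25 ^ suc a) * (4 * 4 ^ k) <⟨ *-monoˡ-< (4 * 4 ^ k) ⦃ m^n≢0 4 (suc k) ⦄ (decay d) ⟩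
    64 ^ suc a * (4 * 4 ^ k) ≡⟨ r₄ (64 ^ suc a) (4 ^ k) ⟩
    64 ^ suc a * 4 ^ k * 4 ≤⟨ *-monoʳ-≤ (64 ^ suc a * 4 ^ k) (n≤1+n 4) ⟩
    64 ^ suc a * 4 ^ k * 5 ∎))
  gain : 4 * K + 2 * f₀ < K′
  gain = *-cancelˡ-< p _ _ (begin-strict
    p * (4 * K + 2 * f₀) ≡⟨ r₅ p (4 * K) f₀ ⟩
    p * (4 * K) + 2 * (p * f₀) <⟨ +-monoʳ-< (p * (4 * K)) (*-monoʳ-< 2 small) ⟩
    p * (4 * K) + 2 * 4 ^ k ≤⟨ kat-gap k ⟩
    p * K′ ∎)

line-escape : ∀ a ℓ (G : Family (24 * suc a + ℓ)) → Pairwise 2 (full _) G → Pairwise 1 (line _ (2 * suc a)) G →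
  64 ^ suc a * (2 * card G) ≤
  64 ^ suc a * (kat (24 * suc a) 1 * 2 ^ ℓ) + 25 ^ suc a * 2 ^ (24 * suc a + ℓ)
line-escape a ℓ G h e = *-cancelˡ-≤ (5 ^ γ * 6 ^ γ * D) ⦃ nz ⦄ (begin
  5 ^ γ * 6 ^ γ * D * (64 ^ suc a * g) ≡⟨ r₁ (5 ^ γ) (6 ^ γ) (5 ^ a) (360 ^ γ) (64 ^ suc a) g ⟩
  64 ^ suc a * (5 ^ γ * 5 ^ a * 6 ^ γ * 360 ^ γ * g)
    ≡⟨ cong (λ x → 64 ^ suc a * (x * 6 ^ γ * 360 ^ γ * g)) (sym (^-distribˡ-+-* 5 γ a)) ⟩
  64 ^ suc a * (5 ^ (γ + a) * 6 ^ γ * 360 ^ γ * g)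
    -- The offset B = γ + a turns the side condition into an equality and costs the factor (6/5)^a
    -- that `ratio` absorbs.
    ≤⟨ *-monoʳ-≤ (64 ^ suc a) (escape γ ℓ 1 1 (2 * suc a) γ (γ + a) G h e ≤-refl ≤-refl (≤-reflexive (r₀ a γ))) ⟩
  64 ^ suc a * (5 ^ (γ + a) * 6 ^ γ * 360 ^ γ * κ + 6 ^ (γ + a) * 5 ^ γ * 341 ^ γ * Q)
    ≡⟨ cong₂ (λ x y → 64 ^ suc a * (x * 6 ^ γ * 360 ^ γ * κ + y * 5 ^ γ * 341 ^ γ * Q))
         (^-distribˡ-+-* 5 γ a) (^-distribˡ-+-* 6 γ a) ⟩
  64 ^ suc a * (5 ^ γ * 5 ^ a * 6 ^ γ * 360 ^ γ * κ + 6 ^ γ * 6 ^ a * 5 ^ γ * 341 ^ γ * Q)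
    ≡⟨ r₂ (64 ^ suc a) (5 ^ γ) (5 ^ a) (6 ^ γ) (360 ^ γ) κ (6 ^ a) (341 ^ γ) Q ⟩
  5 ^ γ * 6 ^ γ * (D * (64 ^ suc a * κ) + 64 ^ suc a * 341 ^ γ * 6 ^ a * Q)
    ≤⟨ *-monoʳ-≤ (5 ^ γ * 6 ^ γ) (+-monoʳ-≤ (D * (64 ^ suc a * κ)) (*-monoˡ-≤ Q (ratio a))) ⟩
  5 ^ γ * 6 ^ γ * (D * (64 ^ suc a * κ) + 25 ^ suc a * 360 ^ γ * 5 ^ a * Q)
    ≡⟨ r₃ (5 ^ γ * 6 ^ γ) (5 ^ a) (360 ^ γ) (64 ^ suc a * κ) (25 ^ suc a) Q ⟩
  5 ^ γ * 6 ^ γ * D * (64 ^ suc a * κ + 25 ^ suc a * Q) ∎)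
  where
  open ≤-Reasoning
  γ = 24 * suc a
  D = 5 ^ a * 360 ^ γ
  g = 2 * card G
  κ = kat γ 1 * 2 ^ ℓ
  Q = 2 ^ (γ + ℓ)
  nz : NonZero (5 ^ γ * 6 ^ γ * D)
  nz = m*n≢0 _ _ ⦃ m*n≢0 _ _ ⦃ m^n≢0 5 γ ⦄ ⦃ m^n≢0 6 γ ⦄ ⦄ ⦃ m*n≢0 _ _ ⦃ m^n≢0 5 a ⦄ ⦃ m^n≢0 360 γ ⦄ ⦄
  r₀ : ∀ a γ → 1 + (2 * (1 + a) + 2 * γ) ≡ 3 * 1 + 2 * (γ + a)
  r₀ = solve-∀
  r₁ : ∀ f s x y z g → f * s * (x * y) * (z * g) ≡ z * (f * x * s * y * g)
  r₁ = solve-∀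
  r₂ : ∀ z f x s y κ u w Q → z * (f * x * s * y * κ + s * u * f * w * Q) ≡
    f * s * (x * y * (z * κ) + z * w * u * Q)
  r₂ = solve-∀
  r₃ : ∀ c x y κ z Q → c * (x * y * κ + z * y * x * Q) ≡ c * (x * y) * (κ + z * Q)
  r₃ = solve-∀

-- Here Katona's bound at time 24 (a + 1) applies up to an error that line-escape makes small.
short-line : ∀ d e {m} (F₁ F₀ : Family m) → let a = d + 16; k = 12 * suc a in
  m ≡ 24 * suc a + (2 * e + 3) → Pairwise 2 (full m) F₁ → Pairwise 1 (line m (2 * suc a)) F₁ →
  (∀ A → A ∈F F₀ → Hit (suc (2 * a)) A) →
  card F₁ + card F₀ < kat (2 * (e + suc k)) 1
short-line d e F₁ F₀ refl h l t = *-cancelˡ-< (P * (64 ^ suc a * 2)) _ _ (begin-strict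
  P * (64 ^ suc a * 2) * (f₁ + f₀) ≡⟨ r₁ P (64 ^ suc a) f₁ f₀ ⟩
  P * (64 ^ suc a * (2 * f₁) + 2 * (64 ^ suc a * f₀))
    ≤⟨ *-monoʳ-≤ P (+-mono-≤ (line-escape a (2 * e + 3) F₁ h l) hit) ⟩
  P * ((64 ^ suc a * (kat (24 * suc a) 1 * 2 ^ (2 * e + 3)) + 25 ^ suc a * Q) + 4 * (25 ^ suc a * Q))
    ≡⟨ cong₂ (λ x y → P * ((64 ^ suc a * (x * y) + 25 ^ suc a * Q) + 4 * (25 ^ suc a * Q)))
         (cong (λ x → kat x 1) (r₂ a)) 2^ℓ ⟩
  P * ((64 ^ suc a * (K * (4 ^ e * 8)) + 25 ^ suc a * Q) + 4 * (25 ^ suc a * Q))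
    ≡⟨ cong (λ x → P * ((64 ^ suc a * (K * (4 ^ e * 8)) + 25 ^ suc a * x) + 4 * (25 ^ suc a * x))) Q≡ ⟩
  P * ((64 ^ suc a * (K * (4 ^ e * 8)) + 25 ^ suc a * (4 ^ k * (4 ^ e * 8))) + 4 * (25 ^ suc a * (4 ^ k * (4 ^ e * 8))))
    ≡⟨ r₃ P (64 ^ suc a) K (4 ^ e) (25 ^ suc a) (4 ^ k) ⟩
  64 ^ suc a * (2 * (4 ^ e * (P * (4 * K)))) + 10 * (P * 25 ^ suc a) * (4 * (4 ^ e * 4 ^ k))
    <⟨ +-monoʳ-< (64 ^ suc a * (2 * (4 ^ e * (P * (4 * K)))))
         (*-monoˡ-< (4 * (4 ^ e * 4 ^ k)) ⦃ m*n≢0 4 _ ⦃ _ ⦄ ⦃ m*n≢0 _ _ ⦃ m^n≢0 4 e ⦄ ⦃ m^n≢0 4 k ⦄ ⦄ ⦄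
           (≤-<-trans (*-monoˡ-≤ (P * 25 ^ suc a) (m≤m+n 10 6)) (decay d))) ⟩
  64 ^ suc a * (2 * (4 ^ e * (P * (4 * K)))) + 64 ^ suc a * (4 * (4 ^ e * 4 ^ k))
    ≡⟨ r₄ (64 ^ suc a) (4 ^ e) (P * (4 * K)) (4 ^ k) ⟩
  64 ^ suc a * 2 * (4 ^ e * (P * (4 * K) + 2 * 4 ^ k))
    ≤⟨ *-monoʳ-≤ (64 ^ suc a * 2) (*-monoʳ-≤ (4 ^ e) (kat-gap k)) ⟩
  64 ^ suc a * 2 * (4 ^ e * (P * kat (2 * suc k) 1)) ≡⟨ r₅ (64 ^ suc a * 2) (4 ^ e) P (kat (2 * suc k) 1) ⟩
  P * (64 ^ suc a * 2) * (4 ^ e * kat (2 * suc k) 1)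
    -- The gain was made at time 24(a + 1); Katona's density only increases over the remaining
    -- elements.
    ≤⟨ *-monoʳ-≤ (P * (64 ^ suc a * 2)) (kat-mono e (suc k)) ⟩
  P * (64 ^ suc a * 2) * kat (2 * (e + suc k)) 1 ∎)
  where
  open ≤-Reasoning
  a = d + 16
  k = 12 * suc a
  f₁ = card F₁
  f₀ = card F₀
  K = kat (2 * k) 1
  P = suc k * suc (2 * k)
  Q = 2 ^ (24 * suc a + (2 * e + 3))
  r₁ : ∀ p s x y → p * (s * 2) * (x + y) ≡ p * (s * (2 * x) + 2 * (s * y))
  r₁ = solve-∀
  r₂ : ∀ a → 24 * (1 + a) ≡ 2 * (12 * (1 + a))
  r₂ = solve-∀
  2^ℓ : 2 ^ (2 * e + 3) ≡ 4 ^ e * 8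
  2^ℓ = trans (^-distribˡ-+-* 2 (2 * e) 3) (cong (_* 8) (sym (^-*-assoc 2 2 e)))
  Q≡ : Q ≡ 4 ^ k * (4 ^ e * 8)
  Q≡ = trans (^-distribˡ-+-* 2 (24 * suc a) (2 * e + 3))
    (cong₂ _*_ (trans (cong (2 ^_) (r₂ a)) (sym (^-*-assoc 2 2 k))) 2^ℓ)
  r₃ : ∀ P s K e t k → P * ((s * (K * (e * 8)) + t * (k * (e * 8))) + 4 * (t * (k * (e * 8)))) ≡
    s * (2 * (e * (P * (4 * K)))) + 10 * (P * t) * (4 * (e * k))
  r₃ = solve-∀
  r₄ : ∀ s e x k → s * (2 * (e * x)) + s * (4 * (e * k)) ≡ s * 2 * (e * (x + 2 * k))
  r₄ = solve-∀
  r₅ : ∀ s e P x → s * (e * (P * x)) ≡ P * s * (e * x)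
  r₅ = solve-∀
  r₆ : ∀ s x → 5 * (2 * (s * x)) ≡ 2 * (5 * (s * x))
  r₆ = solve-∀
  r₇ : ∀ x → 2 * (8 * x) + 4 * x ≡ 5 * (4 * x)
  r₇ = solve-∀
  hit : 2 * (64 ^ suc a * f₀) ≤ 4 * (25 ^ suc a * Q)
  hit = *-cancelˡ-≤ 5 (≤-trans (≤-reflexive (r₆ (64 ^ suc a) f₀)) (≤-trans (*-monoʳ-≤ 2 (hit-64 a F₀ t))
    (≤-trans (m≤m+n _ _) (≤-reflexive (r₇ (25 ^ suc a * Q))))))

-- The case of a set missing two of the last elements

-- The last element is left out because in even dimension the extremal family ignores it.
missInit : ∀ {n} → Subset n → ℕ
missInit {zero} A = 0
missInit {suc zero} A = 0
missInit {suc (suc n)} (a ∷ A) = gap a + missInit A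

missInit-≤ : ∀ {n} (A : Subset (suc n)) → missInit A ≤ n
missInit-≤ {zero} A = z≤n
missInit-≤ {suc n} (true ∷ A) = m≤n⇒m≤1+n (missInit-≤ A)
missInit-≤ {suc n} (false ∷ A) = s≤s (missInit-≤ A)

near-or-few : ∀ r δ (A : Subset (3 + r)) → Dom δ (near r) A ⊎ δ + missInit A ≤ 1
near-or-few zero zero (true ∷ true ∷ _ ∷ []) = inj₂ z≤n
near-or-few zero (suc zero) (true ∷ true ∷ _ ∷ []) = inj₂ (s≤s z≤n)
near-or-few zero (suc (suc δ)) (true ∷ true ∷ c ∷ []) = inj₁ (Dom-true c δ [] [] tt)
near-or-few zero zero (true ∷ false ∷ _ ∷ []) = inj₂ (s≤s z≤n)
near-or-few zero (suc δ) (true ∷ false ∷ c ∷ []) = inj₁ (Dom-true c δ [] [] tt)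
near-or-few zero zero (false ∷ true ∷ _ ∷ []) = inj₂ (s≤s z≤n)
near-or-few zero (suc δ) (false ∷ true ∷ c ∷ []) = inj₁ (Dom-true c δ [] [] tt)
near-or-few zero δ (false ∷ false ∷ c ∷ []) = inj₁ (Dom-true c δ [] [] tt)
near-or-few (suc r) δ (true ∷ A) = near-or-few r δ A
near-or-few (suc r) δ (false ∷ A) with near-or-few r (suc δ) A
... | inj₁ D = inj₁ D
... | inj₂ le = inj₂ (≤-trans (≤-reflexive (+-suc δ (missInit A))) le)

endOne : ∀ b → Subset (suc b)
endOne zero = true ∷ []
endOne (suc b) = false ∷ endOne b

-- 1ᵃ⁺¹ 0ᵇ 1
early : ∀ a b → Subset (suc (a + suc b))
early zero b = true ∷ endOne b
early (suc a) b = true ∷ early a b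

-- 0ᵃ 1ᵇ⁺¹ 0
late : ∀ a b → Subset (suc (a + suc b))
late zero zero = true ∷ false ∷ []
late zero (suc b) = true ∷ late zero b
late (suc a) b = false ∷ late a b

endOne-dom : ∀ b δ (A : Subset (suc b)) → b ≤ δ + missInit A → Dom δ (endOne b) A
endOne-dom zero δ (c ∷ []) _ = Dom-true c δ [] [] tt
endOne-dom (suc b) zero (true ∷ A) le = ⊥-elim (<⇒≱ le (missInit-≤ A))
endOne-dom (suc b) (suc δ) (true ∷ A) (s≤s le) = endOne-dom b δ A le
endOne-dom (suc b) δ (false ∷ A) le =
  endOne-dom b δ A (s≤s⁻¹ (≤-trans le (≤-reflexive (+-suc δ (missInit A)))))

-- For δ = 0: `early a b` is the highest set missing at least b elements other than the last.
early-dom : ∀ a b δ (A : Subset (suc (a + suc b))) → b ≤ δ + missInit A → Dom δ (early a b) A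
early-dom zero b δ (true ∷ A) le = endOne-dom b δ A le
early-dom zero b δ (false ∷ A) le = endOne-dom b (suc δ) A (≤-trans le (≤-reflexive (+-suc δ (missInit A))))
early-dom (suc a) b δ (true ∷ A) le = early-dom a b δ A le
early-dom (suc a) b δ (false ∷ A) le = early-dom a b (suc δ) A
  (≤-trans le (≤-reflexive (+-suc δ (missInit A))))

endOne-late : ∀ b → ¬ Meet 1 (endOne (suc b)) (late zero b) (full (2 + b))
endOne-late zero ()
endOne-late (suc b) m = endOne-late b m

early-late : ∀ a b → ¬ Meet 2 (early a (suc b)) (late a (suc b)) (full (suc (a + (2 + b))))
early-late zero b m = endOne-late b m
early-late (suc a) b m = early-late a b m

-- After the prefix 0ᵃ 1ᵇ, equality in Katona's bound forces exactly the two endings 11 and 10.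
strict-late₀ : ∀ b (G : Family (2 + b)) → Closed G → Pairwise (suc b) (full (2 + b)) G →
  ¬ (late zero b ∈F G) → 2 * card G < 2 * kat (suc b) b
strict-late₀ zero G cl h out = s≤s (≤-trans (*-monoʳ-≤ 2 (card-mono G isFull only)) (n≤1+n 2))
  where
  only : ∀ A → A ∈F G → A ∈F isFull
  only (true ∷ true ∷ []) p = refl
  only (true ∷ false ∷ []) p = ⊥-elim (out p)
  only (false ∷ true ∷ []) p = ⊥-elim (out (cl _ (true ∷ false ∷ []) tt p))
  only (false ∷ false ∷ []) p = ⊥-elim (out (cl _ (true ∷ false ∷ []) tt p))
strict-late₀ (suc b) G cl h out = begin-strict
  2 * card G ≡⟨ double-split G ⟩
  2 * card (G at true) + 2 * card (G at false)
    <⟨ +-mono-<-≤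
      (strict-late₀ b (G at true) (λ X Y → cl (true ∷ X) (true ∷ Y)) (λ A B → h (true ∷ A) (true ∷ B)) out)
      (katona (suc b) (2 + b) (G at false) (λ A B → h (false ∷ A) (false ∷ B))) ⟩
  2 * kat (suc b) b + 2 * kat (suc b) (2 + b) ≡⟨ sym (*-distribˡ-+ 2 (kat (suc b) b) _) ⟩
  2 * kat (2 + b) (suc b) ∎
  where open ≤-Reasoning

-- Katona's bound is a sum over the branches of the induction, so strictness on the branch 0ᵃ
-- suffices.
strict-late : ∀ a b i (G : Family (suc (a + suc b))) → suc i + a ≡ b → Closed G →
  Pairwise (2 + i) (full (suc (a + suc b))) G → ¬ (late a b ∈F G) → 2 * card G < 2 * kat (a + suc b) (suc i)
strict-late zero b i G eq cl h out rewrite trans (sym eq) (+-identityʳ (suc i)) = strict-late₀ (suc i) G cl h out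
strict-late (suc a) b i G eq cl h out = begin-strict
  2 * card G ≡⟨ double-split G ⟩
  2 * card (G at true) + 2 * card (G at false)
    <⟨ +-mono-≤-< (katona (a + suc b) i (G at true) (λ A B → h (true ∷ A) (true ∷ B)))
      (strict-late a b (suc i) (G at false) (trans (cong suc (sym (+-suc i a))) eq)
        (λ X Y → cl (false ∷ X) (false ∷ Y)) (λ A B → h (false ∷ A) (false ∷ B)) out) ⟩
  2 * kat (a + suc b) i + 2 * kat (a + suc b) (2 + i) ≡⟨ sym (*-distribˡ-+ 2 (kat (a + suc b) i) _) ⟩
  2 * kat (suc a + suc b) (suc i) ∎
  where open ≤-Reasoning

-- Without strictness `late k (k + 1)` is a member. A member missing more than k elements would by
-- closure bring in `early k (k + 1)`, and these two conflict.
katona-strict : ∀ k r (G : Family (suc r)) → r ≡ k + (2 + k) → Closed G → Pairwise 2 (full (suc r)) G →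
  2 * card G < 2 * kat r 1 ⊎ (∀ A → A ∈F G → missInit A ≤ k)
katona-strict k r G refl cl h with G (late k (suc k)) in eq
... | false = inj₁ (strict-late k (suc k) 0 G refl cl h λ p → case (trans (sym eq) p))
  where
  case : ¬ (false ≡ true)
  case ()
... | true = inj₂ λ A p → few A p
  where
  few : ∀ A → A ∈F G → missInit A ≤ k
  few A p with missInit A ≤? k
  ... | yes le = le
  ... | no nle = ⊥-elim (early-late k k
    (h _ _ (cl A (early k (suc k)) (early-dom k (suc k) 0 A (≰⇒> nle)) p) eq))

few : ∀ {n} → ℕ → Family n
few k A = missInit A <ᵇ k

card-few : ∀ M k → card {suc M} (few k) ≡ 2 * below M k
card-few zero zero = refl
card-few zero (suc k) = refl
card-few (suc M) zero = trans (card-split {suc M} (few 0))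
  (cong₂ _+_ (card-few M 0) (card-empty {suc M} (few 0 at false) λ _ ()))
card-few (suc M) (suc k) = trans (card-split {suc M} (few (suc k)))
  (trans (cong₂ _+_ (card-few M (suc k)) (card-few M k)) (sym (*-distribˡ-+ 2 (below M (suc k)) _)))

-- In dimension 4 + 2k this is 𝓕₃₊₂ₖ with a free last element, expressed through misses
-- (`target-𝓕`).
target : ∀ {n} → ℕ → Family (suc n)
target k (true ∷ A) = few (suc k) A
target k (false ∷ A) = few 2 A

below-2 : ∀ M → below M 2 ≡ suc M
below-2 M = trans (below-choose M 1) (cong₂ _+_ (trans (below-choose M 0) refl) (nC1≡n M))

card-target : ∀ k → card {4 + 2 * k} (target k) ≡ kat (2 * suc k) 1 + 2 * suc (2 + 2 * k)
card-target k = trans (card-split {3 + 2 * k} (target k)) (cong₂ _+_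
  (trans (card-few (2 + 2 * k) (suc k)) (trans (cong (λ M → 2 * below M (suc k)) (lem k)) (sym (kat-below (2 * suc k) 1 (suc k) refl))))
  (trans (card-few (2 + 2 * k) 2) (cong (2 *_) (below-2 (2 + 2 * k)))))
  where
  lem : ∀ k → 2 + 2 * k ≡ 2 * (1 + k)
  lem = solve-∀

-- For n ≥ 7 it lies outside 𝓕₇ × {0,1}ⁿ⁻⁷ and dominates every other set outside, so its absence
-- confines a closed family to that product (`⊑-seven`).
outside₇ : ∀ n → Subset n
outside₇ (suc (suc (suc (suc (suc (suc (suc n))))))) =
  true ∷ true ∷ true ∷ true ∷ false ∷ false ∷ false ∷ full n
outside₇ n = full n

line-full : ∀ n s → n ≤ s → line n s ≡ full n
line-full zero s _ = refl
line-full (suc n) (suc s) (s≤s le) = cong (true ∷_) (line-full n s le)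

false≢true : ∀ {b} → b ≡ false → ¬ (b ≡ true)
false≢true refl ()

first-member : ∀ (p : ℕ → Bool) N → p 16 ≡ false → p (N + 16) ≡ true →
  Σ ℕ λ d → p (d + 16) ≡ false × p (suc d + 16) ≡ true
first-member p zero out in′ = ⊥-elim (false≢true out in′)
first-member p (suc N) out in′ with p (N + 16) in eq
... | false = N , eq , in′
... | true = first-member p N out eq

-- Case analysis in dimension 4 + 2k

module Core (k : ℕ) (F : Family (4 + 2 * k)) (gd : Good F) (outside₇∈F : outside₇ (4 + 2 * k) ∈F F) where
  open Good gd

  m : ℕ
  m = 3 + 2 * k

  F₁ F₀ : Family m
  F₁ = F at true
  F₀ = F at false

  κ : ℕ
  κ = kat (2 * suc k) 1

  2+2k : 2 + 2 * k ≡ 2 * suc k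
  2+2k = lem k
    where
    lem : ∀ k → 2 + 2 * k ≡ 2 * (1 + k)
    lem = solve-∀

  closed₁ : Closed F₁
  closed₁ X Y = closed (true ∷ X) (true ∷ Y)

  closed₀ : Closed F₀
  closed₀ X Y = closed (false ∷ X) (false ∷ Y)

  pairwise₂ : Pairwise 2 (full m) F₁
  pairwise₂ A B = meet₃ (true ∷ A) (true ∷ B)

  -- The miss of the third set at the first element keeps the requirement at 1, while for pairs it
  -- drops from 3 to 2.
  pairwise₁ : ∀ E → E ∈F F₀ → Pairwise 1 E F₁
  pairwise₁ E e A B p q = meet₁ (true ∷ A) (true ∷ B) (false ∷ E) p q e

  card-F : card F ≡ card F₁ + card F₀
  card-F = card-split F

  2f₁≤2κ : 2 * card F₁ ≤ 2 * κ
  2f₁≤2κ = ≤-trans (katona (2 + 2 * k) 1 F₁ pairwise₂) (≤-reflexive (cong (λ r → 2 * kat r 1) 2+2k))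

  dead-hit : ∀ s → line m s ∈F F₀ ⊎ (∀ A → A ∈F F₀ → Hit (suc s) A)
  dead-hit s with F₀ (line m s) in eq
  ... | true = inj₁ refl
  ... | false = inj₂ λ A p → hit A p (line-or-hit 0 s A)
    where
    hit : ∀ A → A ∈F F₀ → Dom 0 (line m s) A ⊎ Hit (suc (s + 0)) A → Hit (suc s) A
    hit A p (inj₁ D) = ⊥-elim (false≢true eq (closed₀ A (line m s) D p))
    hit A p (inj₂ h) = subst (λ g → Hit (suc g) A) (+-identityʳ s) h

  few₀ : F₀ (near (2 * k)) ≡ false → ∀ A → A ∈F F₀ → A ∈F few 2
  few₀ out A p with near-or-few (2 * k) 0 A
  ... | inj₁ D = ⊥-elim (false≢true out (closed₀ A _ D p))
  ... | inj₂ le = T⇒≡ (<⇒<ᵇ (s≤s le))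

  -- If `near` is absent, F₀ already fits into the target, and `katona-strict` says that F₁ either
  -- fits too or is strictly too small.
  trichotomy : (∀ A → A ∈F F → A ∈F target k) ⊎ card F < card {4 + 2 * k} (target k) ⊎ near (2 * k) ∈F F₀
  trichotomy with F₀ (near (2 * k)) in eq
  ... | true = inj₂ (inj₂ refl)
  ... | false with katona-strict k (2 + 2 * k) F₁ (lem k) closed₁ pairwise₂
    where
    lem : ∀ k → 2 + 2 * k ≡ k + (2 + k)
    lem = solve-∀
  ...   | inj₂ h = inj₁ λ { (true ∷ A) p → T⇒≡ (<⇒<ᵇ (s≤s (h A p))) ; (false ∷ A) p → few₀ eq A p }
  ...   | inj₁ lt = inj₂ (inj₁ (subst₂ _<_ (sym card-F) (sym (card-target k))
      (+-mono-<-≤ (*-cancelˡ-< 2 _ _ (subst (λ r → 2 * card F₁ < 2 * kat r 1) 2+2k lt))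
        (≤-trans (card-mono F₀ (few 2) (few₀ eq))
          (≤-reflexive (trans (card-few (2 + 2 * k) 2) (cong (2 *_) (below-2 (2 + 2 * k)))))))))

  low : ∀ {m} n (G : Family (suc m)) → m ≡ 6 + n → Good G → line m 8 ∈F (G at false) → outside₇ (suc m) ∈F G →
    card G < 29 * 2 ^ n
  low n G refl gd p q = low-line G gd p q

  sparse-or-hit : ∀ j n → m ≡ 6 + j → m ≡ 32 + n →
    64 * card F < 29 * 2 ^ m ⊎ (∀ A → A ∈F F₀ → Hit 33 A)
  sparse-or-hit j n eq eq′ with dead-hit 8
  ... | inj₁ p = inj₁ (subst (64 * card F <_) weigh (*-monoʳ-< 64 (low j F eq gd p outside₇∈F)))
    where
    lem : ∀ x → 64 * (29 * x) ≡ 29 * (64 * x)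
    lem = solve-∀
    weigh : 64 * (29 * 2 ^ j) ≡ 29 * 2 ^ m
    weigh = trans (lem (2 ^ j)) (cong (29 *_) (trans (sym (^-distribˡ-+-* 2 6 j)) (cong (2 ^_) (sym eq))))
  ... | inj₂ h with dead-hit 32
  ...   | inj₁ p = inj₁ (subst (λ c → 64 * c < 29 * 2 ^ m) (sym card-F)
          (mid-line-29 m n F₁ F₀ eq′ pairwise₂ (pairwise₁ _ p) h))
  ...   | inj₂ h′ = inj₂ h′

  near-card : near (2 * k) ∈F F₀ → 2 * card F₁ ≤ 4 * kat (2 * k) 1 + κ
  near-card p = ≤-trans (katona-near (2 * k) 1 F₁ pairwise₂ (pairwise₁ _ p))
    (≤-reflexive (cong (λ r → 4 * kat (2 * k) 1 + kat r 1) 2+2k))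

  -- Between the absent line of height 32 and the whole set there are heights 2a and 2(a + 1) with
  -- the first line absent, which makes F₀ rare, and the second present, which restricts F₁. Even
  -- heights match the rate 25/64. `long-line` covers dimensions small against a, `short-line` the
  -- others.
  late-line : near (2 * k) ∈F F₀ → (∀ A → A ∈F F₀ → Hit 33 A) → card F < κ
  late-line p h = subst (_< κ) (sym card-F) (split (first-member (λ a → F₀ (line m (2 * a))) m dead alive))
    where
    alive : F₀ (line m (2 * (m + 16))) ≡ true
    alive = subst (_∈F F₀) (sym (line-full m (2 * (m + 16)) (≤-trans (m≤m+n m 16) (m≤m+n (m + 16) _))))
      (closed₀ _ (full m) (Dom-full 0 (near (2 * k))) p)
    dead : F₀ (line m 32) ≡ false
    dead with F₀ (line m 32) in eq
    ... | false = refl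
    ... | true = ⊥-elim (no-hit m 32 (h (line m 32) eq))
      where
      no-hit : ∀ n s → ¬ Hit (suc s) (line n s)
      no-hit zero s ()
      no-hit (suc n) zero q = no-hit n 2 q
      no-hit (suc n) (suc s) q = no-hit n s q
    split : (Σ ℕ λ d → F₀ (line m (2 * (d + 16))) ≡ false × F₀ (line m (2 * (suc d + 16))) ≡ true) →
      card F₁ + card F₀ < κ
    split (d , no′ , yes′) with dead-hit (2 * (d + 16))
    ... | inj₁ q = ⊥-elim (false≢true no′ q)
    ... | inj₂ h′ with suc k ≤? 12 * suc (d + 16)
    ...   | yes le = long-line d k F₁ F₀ le (+-comm 3 (2 * k)) (near-card p) h′
    ...   | no nle with e , refl ← m≤n⇒∃[o]m+o≡n (s≤s⁻¹ (≰⇒> nle)) =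
      subst (λ x → card F₁ + card F₀ < kat (2 * x) 1) (+-comm e _ )
        (short-line d e F₁ F₀ (lem (d + 16) e) pairwise₂ (pairwise₁ _ yes′) h′)
      where
      lem : ∀ a e → 3 + 2 * (12 * (1 + a) + e) ≡ 24 * (1 + a) + (2 * e + 3)
      lem = solve-∀

-- Numerical comparisons at the threshold between 72 and 73

numeric-target : ∀ κ c q e y → κ + c ≡ q → (64 * (q + e) <ᵇ y + 64 * c) ≡ true → 64 * (κ + e) < y
numeric-target κ c q e y refl h = +-cancelʳ-< (64 * c) _ _
  (≤-<-trans (≤-reflexive (lem κ e c)) (<ᵇ⇒< (64 * (κ + c + e)) (y + 64 * c) (≡⇒T h)))
  where
  lem : ∀ κ e c → 64 * (κ + e) + 64 * c ≡ 64 * (κ + c + e)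
  lem = solve-∀

numeric-hit : ∀ κ c q f₁ f₀ u v y → κ + c ≡ q → f₁ ≤ κ → u * f₀ ≤ v * y →
  (64 * (u * q + v * y) <ᵇ u * (29 * y) + 64 * (u * c)) ≡ true → 64 * (f₁ + f₀) < 29 * y
numeric-hit κ c q f₁ f₀ u v y refl le₁ le₀ h = *-cancelˡ-< u _ _ (+-cancelʳ-< (64 * (u * c)) _ _ (begin-strict
  u * (64 * (f₁ + f₀)) + 64 * (u * c) ≡⟨ lem u f₁ f₀ c ⟩
  64 * (u * (f₁ + c) + u * f₀) ≤⟨ *-monoʳ-≤ 64 (+-mono-≤ (*-monoʳ-≤ u (+-monoˡ-≤ c le₁)) le₀) ⟩
  64 * (u * (κ + c) + v * y) <⟨ <ᵇ⇒< (64 * (u * (κ + c) + v * y)) (u * (29 * y) + 64 * (u * c)) (≡⇒T h) ⟩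
  u * (29 * y) + 64 * (u * c) ∎))
  where
  open ≤-Reasoning
  lem : ∀ u a b c → u * (64 * (a + b)) + 64 * (u * c) ≡ 64 * (u * (a + c) + u * b)
  lem = solve-∀

numeric-kat : ∀ κ c q y → κ + c ≡ q → (y + 64 * c ≤ᵇ 64 * q) ≡ true → y ≤ 64 * κ
numeric-kat κ c q y refl h = +-cancelʳ-≤ (64 * c) _ _
  (≤-trans (≤ᵇ⇒≤ (y + 64 * c) (64 * (κ + c)) (≡⇒T h)) (≤-reflexive (*-distribˡ-+ 64 κ c)))

-- From n = 74 on, Katona's bound alone reaches the density of 𝓕₇. The first case is computed from
-- `kat-central`, which avoids the branching recursion of `kat`; `kat-step` carries it upwards.
kat-29 : ∀ d k → k ≡ d + 35 → 29 * 2 ^ (3 + 2 * k) ≤ 64 * kat (2 * suc k) 1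
kat-29 zero k eq = base k (kat (2 * suc k) 1) eq (kat-central (suc k))
  where
  base : ∀ k κ → k ≡ 35 → κ + central (suc k) ≡ 4 ^ suc k → 29 * 2 ^ (3 + 2 * k) ≤ 64 * κ
  base k κ refl h = numeric-kat κ (central 36) (4 ^ 36) (29 * 2 ^ 73) h refl
kat-29 (suc d) (suc k) eq = begin
  29 * 2 ^ (3 + 2 * suc k) ≡⟨ cong (λ x → 29 * 2 ^ x) (lem₁ k) ⟩
  29 * 2 ^ (2 + (3 + 2 * k)) ≡⟨ lem₂ (2 ^ (3 + 2 * k)) ⟩
  4 * (29 * 2 ^ (3 + 2 * k)) ≤⟨ *-monoʳ-≤ 4 (kat-29 d k (suc-injective eq)) ⟩
  4 * (64 * kat (2 * suc k) 1) ≡⟨ lem₃ (kat (2 * suc k) 1) ⟩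
  64 * (4 * kat (2 * suc k) 1) ≤⟨ *-monoʳ-≤ 64 (kat-step (suc k)) ⟩
  64 * kat (2 * suc (suc k)) 1 ∎
  where
  open ≤-Reasoning
  lem₁ : ∀ k → 3 + 2 * (1 + k) ≡ 2 + (3 + 2 * k)
  lem₁ = solve-∀
  lem₂ : ∀ x → 29 * (2 * (2 * x)) ≡ 4 * (29 * x)
  lem₂ = solve-∀
  lem₃ : ∀ x → 4 * (64 * x) ≡ 64 * (4 * x)
  lem₃ = solve-∀

offset : ∀ c k → c ≤ k → Σ ℕ λ d → k ≡ d + c
offset c k le with d , eq ← m≤n⇒∃[o]m+o≡n le = d , trans (sym eq) (+-comm c d)

-- At n = 72 the competitor 𝓕₇₁ is still less dense than 𝓕₇. The number 142 = 2 · 71 counts its sets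
-- without the first element.
target-small : ∀ k → k ≡ 34 → 64 * card {4 + 2 * k} (target k) < 29 * 2 ^ (3 + 2 * k)
target-small k eq = subst (λ c → 64 * c < 29 * 2 ^ (3 + 2 * k)) (sym (card-target k)) (num k (kat (2 * suc k) 1) eq (kat-central (suc k)))
  where
  num : ∀ k κ → k ≡ 34 → κ + central (suc k) ≡ 4 ^ suc k →
    64 * (κ + 2 * suc (2 + 2 * k)) < 29 * 2 ^ (3 + 2 * k)
  num k κ refl h = numeric-target κ (central 35) (4 ^ 35) 142 (29 * 2 ^ 71) h refl

module _ (k : ℕ) (F : Family (4 + 2 * k)) (gd : Good F) (b : outside₇ (4 + 2 * k) ∈F F) where
  open Core k F gd b using (trichotomy; sparse-or-hit; late-line; card-F; 2f₁≤2κ)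

  private
    κ = kat (2 * suc k) 1
    F₁ = F at true
    F₀ = F at false
    minus : ∀ c → c ≤ 3 + 2 * k → 3 + 2 * k ≡ c + (3 + 2 * k ∸ c)
    minus c le = sym (m+[n∸m]≡n le)

  sparse-or-hit-34 : 34 ≤ k → 64 * card F < 29 * 2 ^ (3 + 2 * k) ⊎ (∀ A → A ∈F F₀ → Hit 33 A)
  sparse-or-hit-34 le = sparse-or-hit (3 + 2 * k ∸ 6) (3 + 2 * k ∸ 32) (minus 6 (k≥ 6)) (minus 32 (k≥ 32))
    where
    k≥ : ∀ c → {T (c ≤ᵇ 71)} → c ≤ 3 + 2 * k
    k≥ c {t} = ≤-trans (≤ᵇ⇒≤ c 71 t) (+-monoʳ-≤ 3 {68} {2 * k} (*-monoʳ-≤ 2 le))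

  core-34 : k ≡ 34 → 64 * card F < 29 * 2 ^ (3 + 2 * k)
  core-34 eq = cases trichotomy
    where
    -- Here Katona's bound stays below 29/64 with room for a proportion (5/8)³³ of sets without the
    -- first element.
    num : ∀ k κ f₁ f₀ → k ≡ 34 → κ + central (suc k) ≡ 4 ^ suc k → f₁ ≤ κ →
      8 ^ 33 * f₀ ≤ 5 ^ 33 * 2 ^ (3 + 2 * k) → 64 * (f₁ + f₀) < 29 * 2 ^ (3 + 2 * k)
    num k κ f₁ f₀ refl h le₁ le₀ =
      numeric-hit κ (central 35) (4 ^ 35) f₁ f₀ (8 ^ 33) (5 ^ 33) (2 ^ 71) h le₁ le₀ refl
    near-case : 64 * card F < 29 * 2 ^ (3 + 2 * k) ⊎ (∀ A → A ∈F F₀ → Hit 33 A) →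
      64 * card F < 29 * 2 ^ (3 + 2 * k)
    near-case (inj₁ lt) = lt
    near-case (inj₂ h) = subst (λ c → 64 * c < 29 * 2 ^ (3 + 2 * k)) (sym card-F)
      (num k κ (card F₁) (card F₀) eq (kat-central (suc k)) (*-cancelˡ-≤ 2 2f₁≤2κ) (card-hit 33 F₀ h))
    cases : (∀ A → A ∈F F → A ∈F target k) ⊎ card F < card {4 + 2 * k} (target k) ⊎ near (2 * k) ∈F F₀ →
      64 * card F < 29 * 2 ^ (3 + 2 * k)
    cases (inj₁ h) = ≤-<-trans (*-monoʳ-≤ 64 (card-mono F (target k) h)) (target-small k eq)
    cases (inj₂ (inj₁ lt)) = <-trans (*-monoʳ-< 64 lt) (target-small k eq)
    cases (inj₂ (inj₂ p)) = near-case (sparse-or-hit-34 (≤-reflexive (sym eq)))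

  core-35 : 35 ≤ k → (∀ A → A ∈F F → A ∈F target k) ⊎ card F < card {4 + 2 * k} (target k)
  core-35 le = cases trichotomy
    where
    below-κ : near (2 * k) ∈F F₀ → 64 * card F < 29 * 2 ^ (3 + 2 * k) ⊎ (∀ A → A ∈F F₀ → Hit 33 A) → card F < κ
    below-κ p (inj₁ lt) = *-cancelˡ-< 64 (card F) κ
      (<-≤-trans {64 * card F} {29 * 2 ^ (3 + 2 * k)} {64 * κ} lt (let d , eq = offset 35 k le in kat-29 d k eq))
    below-κ p (inj₂ h) = late-line p h
    cases : (∀ A → A ∈F F → A ∈F target k) ⊎ card F < card {4 + 2 * k} (target k) ⊎ near (2 * k) ∈F F₀ →
      (∀ A → A ∈F F → A ∈F target k) ⊎ card F < card {4 + 2 * k} (target k)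
    cases (inj₁ h) = inj₁ h
    cases (inj₂ (inj₁ lt)) = inj₂ lt
    cases (inj₂ (inj₂ p)) = inj₂ (<-≤-trans (below-κ p (sparse-or-hit-34 (≤-trans (n≤1+n 34) le)))
      (≤-trans (m≤m+n κ (2 * suc (2 + 2 * k))) (≤-reflexive (sym (card-target k)))))

-- The extremal families

miss : ∀ {n} → Subset n → ℕ
miss [] = 0
miss (a ∷ A) = gap a + miss A

size-miss : ∀ {n} (A : Subset n) → ∣ A ∣ + miss A ≡ n
size-miss [] = refl
size-miss (true ∷ A) = cong suc (size-miss A)
size-miss (false ∷ A) = trans (+-suc ∣ A ∣ (miss A)) (cong suc (size-miss A))

miss-∩ : ∀ {n} (A B C : Subset n) → n ≤ ∣ A ∩ (B ∩ C) ∣ + (miss A + (miss B + miss C))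
miss-∩ [] [] [] = z≤n
miss-∩ {suc n} (a ∷ A) (b ∷ B) (c ∷ C) = begin
  suc n ≤⟨ +-mono-≤ (head a b c) (miss-∩ A B C) ⟩
  (bit (a ∧ (b ∧ c)) + (gap a + (gap b + gap c))) + (∣ A ∩ (B ∩ C) ∣ + (miss A + (miss B + miss C)))
    ≡⟨ lem (bit (a ∧ (b ∧ c))) (gap a) (gap b) (gap c) ∣ A ∩ (B ∩ C) ∣ (miss A) (miss B) (miss C) ⟩
  (bit (a ∧ (b ∧ c)) + ∣ A ∩ (B ∩ C) ∣) + (gap a + miss A + (gap b + miss B + (gap c + miss C)))
    ≡⟨ cong (_+ (gap a + miss A + (gap b + miss B + (gap c + miss C)))) (sym (∣∷∣ (a ∧ (b ∧ c)) (A ∩ (B ∩ C)))) ⟩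
  ∣ (a ∷ A) ∩ ((b ∷ B) ∩ (c ∷ C)) ∣ + (miss (a ∷ A) + (miss (b ∷ B) + miss (c ∷ C))) ∎
  where
  open ≤-Reasoning
  head : ∀ a b c → 1 ≤ bit (a ∧ (b ∧ c)) + (gap a + (gap b + gap c))
  head true true true = ≤-refl
  head true true false = ≤-refl
  head true false c = s≤s z≤n
  head false b c = s≤s z≤n
  lem : ∀ v a b c s x y z → (v + (a + (b + c))) + (s + (x + (y + z))) ≡ (v + s) + (a + x + (b + y + (c + z)))
  lem = solve-∀

miss-dom : ∀ {n} δ (Y X : Subset n) → Dom δ Y X → miss Y ≤ δ + miss X
miss-dom δ [] [] D = z≤n
miss-dom δ (true ∷ Y) (true ∷ X) D = miss-dom δ Y X D
miss-dom δ (false ∷ Y) (false ∷ X) D = ≤-trans (s≤s (miss-dom δ Y X D)) (≤-reflexive (sym (+-suc δ (miss X))))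
miss-dom δ (true ∷ Y) (false ∷ X) D = ≤-trans (miss-dom (suc δ) Y X D) (≤-reflexive (sym (+-suc δ (miss X))))
miss-dom (suc δ) (false ∷ Y) (true ∷ X) D = s≤s (miss-dom δ Y X D)

miss-full : ∀ {n} (A : Subset n) → A ∈F isFull → miss A ≡ 0
miss-full [] _ = refl
miss-full (true ∷ A) h = miss-full A h

module _ (k : ℕ) where
  private
    M = 2 + 2 * k

  𝓕-true⇒ : ∀ s x → s + x ≡ M → suc M + 3 ≤ 2 * suc s → x ≤ k
  𝓕-true⇒ s x eq h = *-cancelˡ-≤ 2 (+-cancelˡ-≤ (suc M + 3) _ _ (begin
    (suc M + 3) + 2 * x ≤⟨ +-monoˡ-≤ (2 * x) h ⟩
    2 * suc s + 2 * x ≡⟨ lem s x ⟩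
    2 + 2 * (s + x) ≡⟨ cong (λ y → 2 + 2 * y) eq ⟩
    2 + 2 * M ≡⟨ lem′ k ⟩
    (suc M + 3) + 2 * k ∎))
    where
    open ≤-Reasoning
    lem : ∀ s x → 2 * (1 + s) + 2 * x ≡ 2 + 2 * (s + x)
    lem = solve-∀
    lem′ : ∀ k → 2 + 2 * (2 + 2 * k) ≡ (1 + (2 + 2 * k) + 3) + 2 * k
    lem′ = solve-∀

  𝓕-true⇐ : ∀ s x → s + x ≡ M → x ≤ k → suc M + 3 ≤ 2 * suc s
  𝓕-true⇐ s x eq h = +-cancelʳ-≤ (2 * x) _ _ (begin
    (suc M + 3) + 2 * x ≤⟨ +-monoʳ-≤ (suc M + 3) (*-monoʳ-≤ 2 h) ⟩
    (suc M + 3) + 2 * k ≡⟨ lem′ k ⟩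
    2 + 2 * M ≡⟨ cong (λ y → 2 + 2 * y) (sym eq) ⟩
    2 + 2 * (s + x) ≡⟨ lem s x ⟩
    2 * suc s + 2 * x ∎)
    where
    open ≤-Reasoning
    lem : ∀ s x → 2 + 2 * (s + x) ≡ 2 * (1 + s) + 2 * x
    lem = solve-∀
    lem′ : ∀ k → (1 + (2 + 2 * k) + 3) + 2 * k ≡ 2 + 2 * (2 + 2 * k)
    lem′ = solve-∀

  𝓕-false⇒ : ∀ s x → s + x ≡ M → 1 + 2 * k ≤ s → x ≤ 1
  𝓕-false⇒ s x eq h = +-cancelˡ-≤ (1 + 2 * k) _ _
    (≤-trans (+-monoˡ-≤ x h) (≤-reflexive (trans eq (lem k))))
    where
    lem : ∀ k → 2 + 2 * k ≡ (1 + 2 * k) + 1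
    lem = solve-∀

  𝓕-false⇐ : ∀ s x → s + x ≡ M → x ≤ 1 → 1 + 2 * k ≤ s
  𝓕-false⇐ s x eq h = +-cancelʳ-≤ 1 _ _ (≤-trans (≤-reflexive (trans (lem k) (sym eq))) (+-monoʳ-≤ s h))
    where
    lem : ∀ k → (1 + 2 * k) + 1 ≡ 2 + 2 * k
    lem = solve-∀

  -- The number of misses after the first element that 𝓕 allows, given whether the first element is
  -- present.
  slack : Bool → ℕ
  slack true = k
  slack false = 1

  𝓕⇒ : ∀ b (B : Subset M) → (b ∷ B) ∈F 𝓕 (suc M) → miss B ≤ slack b
  𝓕⇒ true B h = 𝓕-true⇒ ∣ B ∣ (miss B) (size-miss B) (≤ᵇ⇒≤ _ _ (≡⇒T h))
  𝓕⇒ false B h = 𝓕-false⇒ ∣ B ∣ (miss B) (size-miss B) (≤ᵇ⇒≤ _ _ (≡⇒T h))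

  𝓕⇐ : ∀ b (B : Subset M) → miss B ≤ slack b → (b ∷ B) ∈F 𝓕 (suc M)
  𝓕⇐ true B h = T⇒≡ (≤⇒≤ᵇ (𝓕-true⇐ ∣ B ∣ (miss B) (size-miss B) h))
  𝓕⇐ false B h = T⇒≡ (≤⇒≤ᵇ (𝓕-false⇐ ∣ B ∣ (miss B) (size-miss B) h))

  𝓕-closed : 2 ≤ k → Closed (𝓕 (suc M))
  𝓕-closed 2≤k (true ∷ X) (true ∷ Y) D h = 𝓕⇐ true Y (≤-trans (miss-dom 0 Y X D) (𝓕⇒ true X h))
  𝓕-closed 2≤k (false ∷ X) (false ∷ Y) D h = 𝓕⇐ false Y (≤-trans (miss-dom 0 Y X D) (𝓕⇒ false X h))
  𝓕-closed 2≤k (false ∷ X) (true ∷ Y) D h =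
    -- Gaining the first element may cost one more miss later, so up to two misses must be allowed;
    -- hence 2 ≤ k.
    𝓕⇐ true Y (≤-trans (miss-dom 1 Y X D) (≤-trans (s≤s (𝓕⇒ false X h)) 2≤k))

  common-≥ : ∀ r (A B C : Subset M) → r + (miss A + (miss B + miss C)) ≤ M → r ≤ ∣ A ∩ (B ∩ C) ∣
  common-≥ r A B C h = +-cancelʳ-≤ (miss A + (miss B + miss C)) _ _ (≤-trans h (miss-∩ A B C))

  private
    slack-≤ : 1 ≤ k → ∀ b → slack b ≤ k
    slack-≤ 1≤k true = ≤-refl
    slack-≤ 1≤k false = 1≤k

  𝓕-cross₁ : 2 ≤ k → Cross₁ (𝓕 (suc M))
  𝓕-cross₁ 2≤k (a ∷ A) (b ∷ B) (c ∷ C) p q r = go a b c (𝓕⇒ a A p) (𝓕⇒ b B q) (𝓕⇒ c C r)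
    where
    1≤k = ≤-trans (s≤s z≤n) 2≤k
    two : 1 + (k + (k + 1)) ≡ M
    two = lem k
      where
      lem : ∀ k → 1 + (k + (k + 1)) ≡ 2 + 2 * k
      lem = solve-∀
    rot : 1 + (k + (1 + k)) ≡ M
    rot = lem k
      where
      lem : ∀ k → 1 + (k + (1 + k)) ≡ 2 + 2 * k
      lem = solve-∀
    rot′ : 1 + (1 + (k + k)) ≡ M
    rot′ = lem k
      where
      lem : ∀ k → 1 + (1 + (k + k)) ≡ 2 + 2 * k
      lem = solve-∀
    tail-≤ : ∀ v → ∣ A ∩ (B ∩ C) ∣ ≤ ∣ v ∷ (A ∩ (B ∩ C)) ∣
    tail-≤ v = ≤-trans (m≤n+m _ (bit v)) (≤-reflexive (sym (∣∷∣ v (A ∩ (B ∩ C)))))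
    go : ∀ a b c → miss A ≤ slack a → miss B ≤ slack b → miss C ≤ slack c →
      1 ≤ ∣ (a ∷ A) ∩ ((b ∷ B) ∩ (c ∷ C)) ∣
    go true true true _ _ _ = s≤s z≤n
    go a b false x y z = ≤-trans (common-≥ 1 A B C (≤-trans
      (+-monoʳ-≤ 1 (+-mono-≤ (≤-trans x (slack-≤ 1≤k a)) (+-mono-≤ (≤-trans y (slack-≤ 1≤k b)) z)))
      (≤-reflexive two))) (tail-≤ (a ∧ (b ∧ false)))
    go a false true x y z = ≤-trans (common-≥ 1 A B C (≤-trans
      (+-monoʳ-≤ 1 (+-mono-≤ (≤-trans x (slack-≤ 1≤k a)) (+-mono-≤ y z)))
      (≤-reflexive rot))) (tail-≤ (a ∧ false))
    go false true true x y z = common-≥ 1 A B C (≤-trans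
      (+-monoʳ-≤ 1 (+-mono-≤ x (+-mono-≤ y z))) (≤-reflexive rot′))

  𝓕-cross₃ : 2 ≤ k → Cross₃ (𝓕 (suc M))
  𝓕-cross₃ 2≤k (a ∷ A) (b ∷ B) (true ∷ C) p q r = go a b (𝓕⇒ a A p) (𝓕⇒ b B q)
    where
    zero-miss : ∀ {x y} → miss A + miss B ≤ x → x + y ≡ M → y + (miss A + (miss B + miss C)) ≤ M
    zero-miss {x} {y} h eq rewrite miss-full C r | +-identityʳ (miss B) =
      ≤-trans (+-monoʳ-≤ y h) (≤-reflexive (trans (+-comm y x) eq))
    3≤1+k : 3 ≤ suc k
    3≤1+k = s≤s 2≤k
    3≤2k : 3 ≤ 2 * k
    3≤2k = ≤-trans (n≤1+n 3) (*-monoʳ-≤ 2 2≤k)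
    l₁ : ∀ k → (k + k) + 2 ≡ 2 + 2 * k
    l₁ = solve-∀
    l₂ : ∀ k → (k + 1) + (1 + k) ≡ 2 + 2 * k
    l₂ = solve-∀
    l₃ : ∀ k → (1 + k) + (1 + k) ≡ 2 + 2 * k
    l₃ = solve-∀
    go : ∀ a b → miss A ≤ slack a → miss B ≤ slack b → 3 ≤ ∣ (a ∷ A) ∩ ((b ∷ B) ∩ (true ∷ C)) ∣
    go true true x y = s≤s (common-≥ 2 A B C (zero-miss (+-mono-≤ x y) (l₁ k)))
    go true false x y = ≤-trans 3≤1+k (common-≥ (suc k) A B C (zero-miss (+-mono-≤ x y) (l₂ k)))
    go false true x y = ≤-trans 3≤1+k (common-≥ (suc k) A B C (zero-miss (+-mono-≤ x y) (l₃ k)))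
    go false false x y = ≤-trans 3≤2k (common-≥ (2 * k) A B C (zero-miss (+-mono-≤ x y) refl))

  𝓕-admissible : 2 ≤ k → Admissible (𝓕 (suc M))
  𝓕-admissible 2≤k = cross⇒admissible (𝓕-cross₁ 2≤k) (𝓕-cross₃ 2≤k)

extend-closed : ∀ {m n} (p : m ≤ n) (F : Family m) → Closed F → Closed (extend p F)
extend-closed p F cl X Y D h = cl (restrict p X) (restrict p Y) (restrict-dom p 0 Y X D) h
  where
  restrict-dom : ∀ {m n} (p : m ≤ n) δ (Y X : Subset n) → Dom δ Y X → Dom δ (restrict p Y) (restrict p X)
  restrict-dom {zero} p δ Y X D = tt
  restrict-dom {suc m} {suc n} (s≤s p) δ (true ∷ Y) (true ∷ X) D = restrict-dom p δ Y X D
  restrict-dom {suc m} {suc n} (s≤s p) δ (false ∷ Y) (false ∷ X) D = restrict-dom p δ Y X D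
  restrict-dom {suc m} {suc n} (s≤s p) δ (true ∷ Y) (false ∷ X) D = restrict-dom p (suc δ) Y X D
  restrict-dom {suc m} {suc n} (s≤s p) (suc δ) (false ∷ Y) (true ∷ X) D = restrict-dom p δ Y X D

restrict-∩ : ∀ {m n} (p : m ≤ n) (A B C : Subset n) →
  ∣ restrict p A ∩ (restrict p B ∩ restrict p C) ∣ ≤ ∣ A ∩ (B ∩ C) ∣
restrict-∩ {zero} p A B C = z≤n
restrict-∩ {suc m} {suc n} (s≤s p) (a ∷ A) (b ∷ B) (c ∷ C) = ≤-trans
  (≤-reflexive (∣∷∣ (a ∧ (b ∧ c)) (restrict p A ∩ (restrict p B ∩ restrict p C))))
  (≤-trans (+-monoʳ-≤ (bit (a ∧ (b ∧ c))) (restrict-∩ p A B C))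
    (≤-reflexive (sym (∣∷∣ (a ∧ (b ∧ c)) (A ∩ (B ∩ C))))))

restrict-full : ∀ {m n} (p : m ≤ n) (A : Subset n) → A ∈F isFull → restrict p A ∈F isFull
restrict-full {zero} p A h = refl
restrict-full {suc m} {suc n} (s≤s p) (true ∷ A) h = restrict-full p A h

extend-admissible : ∀ {m n} (p : m ≤ n) (F : Family m) → Admissible F → Admissible (extend p F)
extend-admissible p F adm with c₁ , c₃ ← admissible⇒cross adm = cross⇒admissible
  (λ A B C x y z → ≤-trans (c₁ _ _ _ x y z) (restrict-∩ p A B C))
  (λ A B C x y z → ≤-trans (c₃ _ _ _ x y (restrict-full p C z)) (restrict-∩ p A B C))

-- Equality of densities with denominators cleared, so that no exponent n - m occurs.
card-extend : ∀ {m n} (p : m ≤ n) (F : Family m) → card (extend p F) * 2 ^ m ≡ card F * 2 ^ n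
card-extend {zero} {n} p F = trans (*-identityʳ (card (extend p F))) (const n p)
  where
  constant : ∀ n → (b : Bool) → card {n} (λ _ → b) ≡ bit b * 2 ^ n
  constant zero true = refl
  constant zero false = refl
  constant (suc n) b = trans (card-split {n} (λ _ → b))
    (trans (cong₂ _+_ (constant n b) (constant n b)) (lem (bit b) (2 ^ n)))
    where
    lem : ∀ b x → b * x + b * x ≡ b * (2 * x)
    lem = solve-∀
  const : ∀ n (p : 0 ≤ n) → card (extend p F) ≡ card F * 2 ^ n
  const n p with F []
  ... | true = constant n true
  ... | false = constant n false
card-extend {suc m} {suc n} (s≤s p) F = begin
  card (extend (s≤s p) F) * (2 * 2 ^ m) ≡⟨ cong (_* (2 * 2 ^ m)) (card-split (extend (s≤s p) F)) ⟩
  (card (extend p (F at true)) + card (extend p (F at false))) * (2 * 2 ^ m)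
    ≡⟨ lem (card (extend p (F at true))) (card (extend p (F at false))) (2 ^ m) ⟩
  2 * (card (extend p (F at true)) * 2 ^ m + card (extend p (F at false)) * 2 ^ m)
    ≡⟨ cong (2 *_) (cong₂ _+_ (card-extend p (F at true)) (card-extend p (F at false))) ⟩
  2 * (card (F at true) * 2 ^ n + card (F at false) * 2 ^ n)
    ≡⟨ lem′ (card (F at true)) (card (F at false)) (2 ^ n) ⟩
  (card (F at true) + card (F at false)) * (2 * 2 ^ n) ≡⟨ cong (_* (2 * 2 ^ n)) (sym (card-split F)) ⟩
  card F * (2 * 2 ^ n) ∎
  where
  open ≡-Reasoning
  lem : ∀ a b x → (a + b) * (2 * x) ≡ 2 * (a * x + b * x)
  lem = solve-∀
  lem′ : ∀ a b x → 2 * (a * x + b * x) ≡ (a + b) * (2 * x)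
  lem′ = solve-∀

pad : ∀ {m n} → m ≤ n → Subset m → Subset n
pad {n = n} z≤n [] = full n
pad (s≤s p) (a ∷ A) = a ∷ pad p A

restrict-pad : ∀ {m n} (p : m ≤ n) (A : Subset m) → restrict p (pad p A) ≡ A
restrict-pad z≤n [] = refl
restrict-pad (s≤s p) (a ∷ A) = cong (a ∷_) (restrict-pad p A)

restrict-restrict : ∀ {l m n} (p : l ≤ m) (q : m ≤ n) (r : l ≤ n) (A : Subset n) →
  restrict p (restrict q A) ≡ restrict r A
restrict-restrict {zero} p q r A = refl
restrict-restrict {suc l} {suc m} {suc n} (s≤s p) (s≤s q) (s≤s r) (a ∷ A) =
  cong (a ∷_) (restrict-restrict p q r A)

restrict-miss : ∀ M (p : M ≤ suc M) (A : Subset (suc M)) → miss (restrict p A) ≡ missInit A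
restrict-miss zero p A = refl
restrict-miss (suc M) (s≤s p) (a ∷ A) = cong (gap a +_) (restrict-miss M p A)

closed⇒leftCompressed : ∀ {n} (F : Family n) → Closed F → LeftCompressed F
closed⇒leftCompressed F cl i j i<j A p j∈A i∉A = cl A _ (shift i j A i<j j∈A i∉A) p
  where
  remove : ∀ {n} δ (j : Fin n) (A : Subset n) → j ∈ A → Dom (suc δ) (A [ j ]≔ outside) A
  remove δ Fin.zero (true ∷ A) here = Dom-refl δ A
  remove δ (Fin.suc j) (true ∷ A) (there h) = remove δ j A h
  remove δ (Fin.suc j) (false ∷ A) (there h) = remove δ j A h
  shift : ∀ {n} (i j : Fin n) (A : Subset n) → i Fin.< j → j ∈ A → i ∉ A →
    Dom 0 ((A [ j ]≔ outside) [ i ]≔ inside) A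
  shift Fin.zero (Fin.suc j) (true ∷ A) _ _ i∉ = ⊥-elim (i∉ here)
  shift Fin.zero (Fin.suc j) (false ∷ A) _ (there h) _ = remove 0 j A h
  shift (Fin.suc i) (Fin.suc j) (true ∷ A) (s≤s lt) (there h) i∉ = shift i j A lt h λ q → i∉ (there q)
  shift (Fin.suc i) (Fin.suc j) (false ∷ A) (s≤s lt) (there h) i∉ = shift i j A lt h λ q → i∉ (there q)

-- A left-compressed optimum is not assumed closed under supersets. Its up-closure is still
-- admissible, so by maximality it is the family itself.
up : ∀ {n} → Family n → Family n
up F [] = F []
up F (true ∷ A) = up (λ B → F (true ∷ B) ∨ F (false ∷ B)) A
up F (false ∷ A) = up (F at false) A

Sub : ∀ {n} → Subset n → Subset n → Set
Sub [] [] = ⊤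
Sub (a ∷ A) (b ∷ B) = (a ≡ true → b ≡ true) × Sub A B

up-mono : ∀ {n} (F G : Family n) → F ⊑ G → up F ⊑ up G
up-mono F G h [] p = h [] p
up-mono F G h (true ∷ A) p = up-mono _ _ (λ B q → merge B (∨-split q)) A p
  where
  merge : ∀ B → (true ∷ B) ∈F F ⊎ (false ∷ B) ∈F F → G (true ∷ B) ∨ G (false ∷ B) ≡ true
  merge B (inj₁ e) = ∨-inl (h (true ∷ B) e)
  merge B (inj₂ e) rewrite h (false ∷ B) e = ∨-true (G (true ∷ B))
    where
    ∨-true : ∀ b → b ∨ true ≡ true
    ∨-true true = refl
    ∨-true false = refl
up-mono F G h (false ∷ A) p = up-mono _ _ (λ B → h (false ∷ B)) A p

up-⊒ : ∀ {n} (F : Family n) → F ⊑ up F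
up-⊒ F [] p = p
up-⊒ F (true ∷ A) p = up-mono (F at true) _ (λ B e → ∨-inl e) A (up-⊒ (F at true) A p)
up-⊒ F (false ∷ A) p = up-⊒ (F at false) A p

up-below : ∀ {n} (F : Family n) A → A ∈F up F → Σ (Subset n) λ B → B ∈F F × Sub B A
up-below F [] p = [] , p , tt
up-below F (true ∷ A) p with B , q , s ← up-below (λ B → F (true ∷ B) ∨ F (false ∷ B)) A p with ∨-split q
... | inj₁ e = true ∷ B , e , (λ _ → refl) , s
... | inj₂ e = false ∷ B , e , (λ ()) , s
up-below F (false ∷ A) p with B , q , s ← up-below (F at false) A p = false ∷ B , q , (λ ()) , s

Sub-∩ : ∀ {n} (A B C A′ B′ C′ : Subset n) → Sub A′ A → Sub B′ B → Sub C′ C →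
  ∣ A′ ∩ (B′ ∩ C′) ∣ ≤ ∣ A ∩ (B ∩ C) ∣
Sub-∩ [] [] [] [] [] [] _ _ _ = z≤n
Sub-∩ (a ∷ A) (b ∷ B) (c ∷ C) (a′ ∷ A′) (b′ ∷ B′) (c′ ∷ C′) (x , s) (y , t) (z , u) = begin
  ∣ (a′ ∷ A′) ∩ ((b′ ∷ B′) ∩ (c′ ∷ C′)) ∣ ≡⟨ ∣∷∣ (a′ ∧ (b′ ∧ c′)) (A′ ∩ (B′ ∩ C′)) ⟩
  bit (a′ ∧ (b′ ∧ c′)) + ∣ A′ ∩ (B′ ∩ C′) ∣ ≤⟨ +-mono-≤ (head a′ b′ c′ x y z) (Sub-∩ A B C A′ B′ C′ s t u) ⟩
  bit (a ∧ (b ∧ c)) + ∣ A ∩ (B ∩ C) ∣ ≡⟨ sym (∣∷∣ (a ∧ (b ∧ c)) (A ∩ (B ∩ C))) ⟩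
  ∣ (a ∷ A) ∩ ((b ∷ B) ∩ (c ∷ C)) ∣ ∎
  where
  open ≤-Reasoning
  head : ∀ a′ b′ c′ → (a′ ≡ true → a ≡ true) → (b′ ≡ true → b ≡ true) → (c′ ≡ true → c ≡ true) →
    bit (a′ ∧ (b′ ∧ c′)) ≤ bit (a ∧ (b ∧ c))
  head true true true x y z rewrite x refl | y refl | z refl = ≤-refl
  head true true false _ _ _ = z≤n
  head true false _ _ _ _ = z≤n
  head false _ _ _ _ _ = z≤n

Sub-refl : ∀ {n} (A : Subset n) → Sub A A
Sub-refl [] = tt
Sub-refl (a ∷ A) = (λ e → e) , Sub-refl A

up-admissible : ∀ {n} (F : Family n) → Admissible F → Admissible (up F)
up-admissible F adm with c₁ , c₃ ← admissible⇒cross adm = cross⇒admissible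
  (λ A B C p q r → cross₁ A B C (up-below F A p) (up-below F B q) (up-below F C r))
  (λ A B C p q r → cross₃ A B C (up-below F A p) (up-below F B q) r)
  where
  cross₁ : ∀ A B C → (Σ _ λ A′ → A′ ∈F F × Sub A′ A) → (Σ _ λ B′ → B′ ∈F F × Sub B′ B) →
    (Σ _ λ C′ → C′ ∈F F × Sub C′ C) → 1 ≤ ∣ A ∩ (B ∩ C) ∣
  cross₁ A B C (A′ , p , s) (B′ , q , t) (C′ , r , u) = ≤-trans (c₁ A′ B′ C′ p q r) (Sub-∩ A B C A′ B′ C′ s t u)
  cross₃ : ∀ A B C → (Σ _ λ A′ → A′ ∈F F × Sub A′ A) → (Σ _ λ B′ → B′ ∈F F × Sub B′ B) →
    C ∈F isFull → 3 ≤ ∣ A ∩ (B ∩ C) ∣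
  cross₃ A B C (A′ , p , s) (B′ , q , t) r = ≤-trans (c₃ A′ B′ C p q r) (Sub-∩ A B C A′ B′ C s t (Sub-refl C))

Raised : ∀ {n} → Family n → Set
Raised {zero} F = ⊤
Raised {suc n} F = ((F at false) ⊑ (F at true)) × Raised (F at true) × Raised (F at false)

up-raised : ∀ {n} (F : Family n) → Raised (up F)
up-raised {zero} F = tt
up-raised {suc n} F = up-mono (F at false) _ (λ B e → weaken B e) , up-raised _ , up-raised (F at false)
  where
  weaken : ∀ B → (false ∷ B) ∈F F → F (true ∷ B) ∨ F (false ∷ B) ≡ true
  weaken B e with F (true ∷ B)
  ... | true = refl
  ... | false = e

raised-transfer : ∀ {n} (F G : Family n) → F ⊑ G → G ⊑ F → Raised G → Raised F
raised-transfer {zero} F G _ _ _ = tt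
raised-transfer {suc n} F G h h′ (r , s , t) =
  (λ A p → h′ (true ∷ A) (r A (h (false ∷ A) p))) ,
  raised-transfer (F at true) (G at true) (λ A → h (true ∷ A)) (λ A → h′ (true ∷ A)) s ,
  raised-transfer (F at false) (G at false) (λ A → h (false ∷ A)) (λ A → h′ (false ∷ A)) t

raised⇒stable : ∀ {n} (F : Family n) → LeftCompressed F → Raised F → Stable F
raised⇒stable {zero} F lc _ = tt
raised⇒stable {suc n} F lc (r , s , t) = r , exchange F lc ,
  raised⇒stable (F at true) (lower true) s , raised⇒stable (F at false) (lower false) t
  where
  lower : ∀ b → LeftCompressed (F at b)
  lower b i j i<j A p j∈ i∉ = lc (Fin.suc i) (Fin.suc j) (s≤s i<j) (b ∷ A) p (there j∈) λ { (there q) → i∉ q }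
  exchange : ∀ {n} (F : Family (suc n)) → LeftCompressed F → Swap F
  exchange {zero} F lc = tt
  exchange {suc n} F lc A p = lc Fin.zero (Fin.suc Fin.zero) (s≤s z≤n) (false ∷ true ∷ A) p (there here) λ ()

-- Densities and optimality

/-≤ : ∀ a b c d .⦃ _ : NonZero b ⦄ .⦃ _ : NonZero d ⦄ → a * d ≤ c * b → (ℤ.+ a ℚ./ b) ℚ.≤ (ℤ.+ c ℚ./ d)
/-≤ a (suc b) c (suc d) h = ℚ.toℚᵘ-cancel-≤ (ℚᵘ.≤-trans
  (ℚᵘ.≤-reflexive (ℚ.toℚᵘ-fromℚᵘ (ℚᵘ.mkℚᵘ (ℤ.+ a) b)))
  (ℚᵘ.≤-trans
    (ℚᵘ.*≤* (subst₂ ℤ._≤_ (ℤ.pos-* a (suc d)) (ℤ.pos-* c (suc b)) (ℤ.+≤+ h)))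
    (ℚᵘ.≤-reflexive (ℚᵘ.≃-sym (ℚ.toℚᵘ-fromℚᵘ (ℚᵘ.mkℚᵘ (ℤ.+ c) d))))))

w-≤ : ∀ {m n} (F : Family m) (G : Family n) → card F * 2 ^ n ≤ card G * 2 ^ m → w F ℚ.≤ w G
w-≤ {m} {n} F G = /-≤ (card F) (2 ^ m) (card G) (2 ^ n) ⦃ m^n≢0 2 m ⦄ ⦃ m^n≢0 2 n ⦄

w-cong : ∀ {m n} (F : Family m) (G : Family n) → card F * 2 ^ n ≡ card G * 2 ^ m → w F ≡ w G
w-cong F G eq = ℚ.≤-antisym (w-≤ F G (≤-reflexive eq)) (w-≤ G F (≤-reflexive (sym eq)))

w-injective : ∀ {n} (F G : Family n) → w F ≡ w G → card F ≡ card G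
w-injective {n} F G eq = *-cancelʳ-≡ (card F) (card G) (2 ^ n) ⦃ m^n≢0 2 n ⦄
  (ℚ.normalize-injective-≃ (card F) (card G) (2 ^ n) (2 ^ n) ⦃ m^n≢0 2 n ⦄ ⦃ m^n≢0 2 n ⦄ eq)

-- This dichotomy yields both the maximum and its uniqueness: a family of the same size contained in
-- T equals T.
Extremal : ∀ {n} → Family n → Set
Extremal T = ∀ F → Closed F → Admissible F → F ⊑ T ⊎ card F < card T

⊑-antisym : ∀ {n} (F G : Family n) → F ⊑ G → G ⊑ F → ∀ A → F A ≡ G A
⊑-antisym F G h h′ A with F A in p | G A in q
... | true | true = refl
... | false | false = refl
... | true | false = trans (sym (h A p)) q
... | false | true = trans (sym p) (h′ A q)

extremal⇒optimal : ∀ {n} (T : Family n) q → Extremal T → Closed T → Admissible T → w T ≡ q →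
  IsW n q × UniqueLCOptimum q T
extremal⇒optimal {n} T q ex cl adm eq =
  ((λ F a → subst (w F ℚ.≤_) eq (w-≤ F T (*-monoˡ-≤ (2 ^ n) (bound F a)))) , T , adm , eq) ,
  (adm , closed⇒leftCompressed T cl , eq) , unique
  where
  bound : ∀ F → Admissible F → card F ≤ card T
  bound F a with G , st , a′ , e ← compress F a = subst (_≤ card T) e (below-T (ex G (stable⇒closed G st) a′))
    where
    below-T : G ⊑ T ⊎ card G < card T → card G ≤ card T
    below-T (inj₁ h) = card-mono G T h
    below-T (inj₂ lt) = <⇒≤ lt
  unique : ∀ F → Admissible F → LeftCompressed F → w F ≡ q → ∀ A → F A ≡ T A
  unique F a lc e = conclude (ex F closedF a)
    where
    same : card F ≡ card T
    same = w-injective F T (trans e (sym eq))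
    up-⊑ : up F ⊑ F
    up-⊑ = ⊑-full F (up F) (up-⊒ F) (≤-trans (bound (up F) (up-admissible F a)) (≤-reflexive (sym same)))
    closedF : Closed F
    closedF = stable⇒closed F (raised⇒stable F lc (raised-transfer F (up F) (up-⊒ F) up-⊑ (up-raised F)))
    conclude : F ⊑ T ⊎ card F < card T → ∀ A → F A ≡ T A
    conclude (inj₂ lt) = ⊥-elim (<-irrefl same lt)
    conclude (inj₁ h) = ⊑-antisym F T h (⊑-full F T h (≤-reflexive (sym same)))

-- Adding free elements preserves closedness, admissibility and density, so extremality passes down
-- from the larger dimension.
extremal-restrict : ∀ {m n} (p : m ≤ n) (T : Family m) (T′ : Family n) → (∀ A → T′ A ≡ extend p T A) →
  Extremal T′ → Extremal T
extremal-restrict {m} {n} p T T′ h ex F cl adm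
  with ex (extend p F) (extend-closed p F cl) (extend-admissible p F adm)
... | inj₁ s = inj₁ λ A q → subst (_∈F T) (restrict-pad p A) (trans (sym (h (pad p A)))
        (s (pad p A) (subst (_∈F F) (sym (restrict-pad p A)) q)))
... | inj₂ lt = inj₂ (*-cancelʳ-< (2 ^ n) _ _ (subst₂ _<_ (card-extend p F)
        (trans (cong (_* 2 ^ m) (card-cong T′ (extend p T) h)) (card-extend p T))
        (*-monoˡ-< (2 ^ m) ⦃ m^n≢0 2 m ⦄ lt)))

everyV : ∀ d → (Subset d → Bool) → Bool
everyV zero p = p []
everyV (suc d) p = everyV d (p ∘ (true ∷_)) ∧ everyV d (p ∘ (false ∷_))

everyV-sound : ∀ d p → everyV d p ≡ true → ∀ P → p P ≡ true
everyV-sound zero p h [] = h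
everyV-sound (suc d) p h (true ∷ P) = everyV-sound d _ (proj₁ (∧-split h)) P
everyV-sound (suc d) p h (false ∷ P) = everyV-sound d _ (proj₂ (∧-split {everyV d (p ∘ (true ∷_))} h)) P

seven-prefix : Subset 7
seven-prefix = true ∷ true ∷ true ∷ true ∷ false ∷ false ∷ false ∷ []

leads : Subset 7 → Bool
leads P with lead 0 seven-prefix P
... | just _ = true
... | nothing = false

-- A check of all 128 prefixes: each lies in 𝓕₇ or is dominated by 1111000, and in the latter case
-- closure would produce `outside₇`.
⊑-seven : ∀ j (F : Family (7 + j)) → Closed F → ¬ (outside₇ (7 + j) ∈F F) → (p : 7 ≤ 7 + j) → F ⊑ extend p (𝓕 7)
⊑-seven j F cl out p (a ∷ b ∷ c ∷ d ∷ e ∷ f ∷ g ∷ A) q =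
  decide (everyV-sound 7 (λ P → leads P ∨ 𝓕 7 P) refl P)
  where
  P : Subset 7
  P = a ∷ b ∷ c ∷ d ∷ e ∷ f ∷ g ∷ []
  decide : leads P ∨ 𝓕 7 P ≡ true → 𝓕 7 P ≡ true
  decide h with lead 0 seven-prefix P in eq
  ... | nothing = h
  ... | just δ = ⊥-elim (out (cl _ _ (dom-lead 0 seven-prefix P (full j) A eq (Dom-full δ A)) q))

⊑-seven′ : ∀ {n} (F : Family n) → Closed F → ¬ (outside₇ n ∈F F) → (p : 7 ≤ n) → F ⊑ extend p (𝓕 7)
⊑-seven′ {n} F cl out p = go (n ∸ 7) (sym (m+[n∸m]≡n p)) F cl out p
  where
  go : ∀ j {n} → n ≡ 7 + j → (F : Family n) → Closed F → ¬ (outside₇ n ∈F F) → (p : 7 ≤ n) → F ⊑ extend p (𝓕 7)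
  go j refl = ⊑-seven j

module _ (k : ℕ) where
  private
    n = 4 + 2 * k
    M = 2 + 2 * k

  target-𝓕 : (p : suc M ≤ n) → ∀ A → target k A ≡ extend p (𝓕 (suc M)) A
  target-𝓕 (s≤s p) A = ⊑-antisym (target k) (extend (s≤s p) (𝓕 (suc M))) into from A
    where
    into : target k ⊑ extend (s≤s p) (𝓕 (suc M))
    into (true ∷ A) h = 𝓕⇐ k true (restrict p A) (subst (_≤ k) (sym (restrict-miss M p A))
      (s≤s⁻¹ (<ᵇ⇒< (missInit A) (suc k) (≡⇒T h))))
    into (false ∷ A) h = 𝓕⇐ k false (restrict p A) (subst (_≤ 1) (sym (restrict-miss M p A))
      (s≤s⁻¹ (<ᵇ⇒< (missInit A) 2 (≡⇒T h))))
    from : extend (s≤s p) (𝓕 (suc M)) ⊑ target k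
    from (true ∷ A) h = T⇒≡ (<⇒<ᵇ (s≤s (subst (_≤ k) (restrict-miss M p A) (𝓕⇒ k true (restrict p A) h))))
    from (false ∷ A) h = T⇒≡ (<⇒<ᵇ (s≤s (subst (_≤ 1) (restrict-miss M p A) (𝓕⇒ k false (restrict p A) h))))

  7≤n : 2 ≤ k → 7 ≤ n
  7≤n h = ≤-trans (n≤1+n 7) (+-monoʳ-≤ 4 (*-monoʳ-≤ 2 h))

  card-seven : 2 ≤ k → (F : Family n) → Closed F → ¬ (outside₇ n ∈F F) → card F * 2 ^ 7 ≤ 29 * 2 ^ n
  card-seven h F cl out = ≤-trans
    (*-monoˡ-≤ (2 ^ 7) (card-mono F (extend (7≤n h) (𝓕 7)) (⊑-seven′ F cl out (7≤n h))))
    (≤-reflexive (card-extend (7≤n h) (𝓕 7)))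

  extremal-target : 35 ≤ k → Extremal (target {3 + 2 * k} k)
  extremal-target le F cl adm = cases (F (outside₇ n)) refl
    where
    κ = kat (2 * suc k) 1
    2≤k : 2 ≤ k
    2≤k = ≤-trans (m≤m+n 2 33) le
    kat-29′ : 29 * 2 ^ (3 + 2 * k) ≤ 64 * κ
    kat-29′ = let d , e = offset 35 k le in kat-29 d k e
    lem : ∀ x → 29 * (2 * x) ≡ 2 * (29 * x)
    lem = solve-∀
    lem′ : ∀ x → 2 * (64 * x) ≡ x * 128
    lem′ = solve-∀
    F≤κ : ¬ (outside₇ n ∈F F) → card F ≤ κ
    F≤κ out = *-cancelʳ-≤ (card F) κ 128 (begin
      card F * 128 ≤⟨ card-seven 2≤k F cl out ⟩
      29 * 2 ^ n ≡⟨ lem (2 ^ (3 + 2 * k)) ⟩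
      2 * (29 * 2 ^ (3 + 2 * k)) ≤⟨ *-monoʳ-≤ 2 kat-29′ ⟩
      2 * (64 * κ) ≡⟨ lem′ κ ⟩
      κ * 128 ∎)
      where open ≤-Reasoning
    κ<target : κ < card {n} (target k)
    κ<target = ≤-trans (≤-reflexive (+-comm 1 κ)) (≤-trans (+-monoʳ-≤ κ (s≤s z≤n))
      (≤-reflexive (sym (card-target k))))
    cases : ∀ b → F (outside₇ n) ≡ b → F ⊑ target k ⊎ card F < card {n} (target k)
    cases true eq = core-35 k F (good F cl adm) eq le
    cases false eq = inj₂ (≤-<-trans (F≤κ (false≢true eq)) κ<target)

  extremal-seven : k ≡ 34 → (p : 7 ≤ n) → Extremal (extend p (𝓕 7))
  extremal-seven e p F cl adm = cases (F (outside₇ n)) refl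
    where
    open ≤-Reasoning
    lem : ∀ x → x * 128 ≡ 2 * (64 * x)
    lem = solve-∀
    lem′ : ∀ x → 2 * (29 * x) ≡ 29 * (2 * x)
    lem′ = solve-∀
    cases : ∀ b → F (outside₇ n) ≡ b → F ⊑ extend p (𝓕 7) ⊎ card F < card (extend p (𝓕 7))
    cases false eq = inj₁ (⊑-seven′ F cl (false≢true eq) p)
    cases true eq = inj₂ (*-cancelʳ-< (2 ^ 7) (card F) (card (extend p (𝓕 7))) (begin-strict
      card F * 128 ≡⟨ lem (card F) ⟩
      2 * (64 * card F) <⟨ *-monoʳ-< 2 (core-34 k F (good F cl adm) eq e) ⟩
      2 * (29 * 2 ^ (3 + 2 * k)) ≡⟨ lem′ (2 ^ (3 + 2 * k)) ⟩
      29 * 2 ^ n ≡⟨ sym (card-extend p (𝓕 7)) ⟩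
      card (extend p (𝓕 7)) * 2 ^ 7 ∎))

w-extend : ∀ {m n} (p : m ≤ n) (F : Family m) → w (extend p F) ≡ w F
w-extend p F = w-cong (extend p F) F (card-extend p F)

part-i : (n : ℕ) → (7≤n : 7 ≤ n) → n ≤ 72 →
  IsW n (w (𝓕 7)) × UniqueLCOptimum {n} (w (𝓕 7)) (extend 7≤n (𝓕 7))
part-i n p q = extremal⇒optimal (extend p (𝓕 7)) (w (𝓕 7)) (from-72 34 refl q)
  (extend-closed p (𝓕 7) (𝓕-closed 2 ≤-refl)) (extend-admissible p (𝓕 7) (𝓕-admissible 2 ≤-refl))
  (w-extend p (𝓕 7))
  where
  -- With k = 34 the dimension 4 + 2k is 72, from which every smaller n is obtained by restriction.
  from-72 : ∀ k → k ≡ 34 → n ≤ 4 + 2 * k → Extremal (extend p (𝓕 7))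
  from-72 k e q = extremal-restrict q (extend p (𝓕 7)) (extend (≤-trans p q) (𝓕 7))
    (λ A → cong (𝓕 7) (sym (restrict-restrict p q (≤-trans p q) A))) (extremal-seven k e (≤-trans p q))

part-ii : (n : ℕ) → 73 ≤ n → n % 2 ≡ 1 → IsW n (w (𝓕 n)) × UniqueLCOptimum {n} (w (𝓕 n)) (𝓕 n)
part-ii n le odd = go (n / 2) (trans (m≡m%n+[m/n]*n n 2) (cong (_+ n / 2 * 2) odd)) le
  where
  go : ∀ h {n} → n ≡ 1 + h * 2 → 73 ≤ n → IsW n (w (𝓕 n)) × UniqueLCOptimum {n} (w (𝓕 n)) (𝓕 n)
  go zero refl (s≤s ())
  go (suc k) eq le = odd-case k (trans eq (lem k)) le
    where
    lem : ∀ k → 1 + (1 + k) * 2 ≡ 3 + 2 * k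
    lem = solve-∀
    odd-case : ∀ k {n} → n ≡ 3 + 2 * k → 73 ≤ n → IsW n (w (𝓕 n)) × UniqueLCOptimum {n} (w (𝓕 n)) (𝓕 n)
    odd-case k refl le = extremal⇒optimal (𝓕 (3 + 2 * k)) (w (𝓕 (3 + 2 * k)))
      (extremal-restrict (n≤1+n _) (𝓕 (3 + 2 * k)) (target k) (target-𝓕 k (n≤1+n _)) (extremal-target k 35≤k))
      (𝓕-closed k 2≤k) (𝓕-admissible k 2≤k) refl
      where
      35≤k : 35 ≤ k
      35≤k = *-cancelˡ-≤ {35} {k} 2 (+-cancelˡ-≤ 3 70 (2 * k) le)
      2≤k : 2 ≤ k
      2≤k = ≤-trans (m≤m+n 2 33) 35≤k

part-iii : (n : ℕ) → 74 ≤ n → n % 2 ≡ 0 →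
  IsW n (w (𝓕 (n ∸ 1))) × UniqueLCOptimum {n} (w (𝓕 (n ∸ 1))) (extend (m∸n≤m n 1) (𝓕 (n ∸ 1)))
part-iii n le even = go (n / 2) (trans (m≡m%n+[m/n]*n n 2) (cong (_+ n / 2 * 2) even)) le
  where
  Goal : ℕ → Set
  Goal n = IsW n (w (𝓕 (n ∸ 1))) × UniqueLCOptimum {n} (w (𝓕 (n ∸ 1))) (extend (m∸n≤m n 1) (𝓕 (n ∸ 1)))
  even-case : ∀ k {n} → n ≡ 4 + 2 * k → 74 ≤ n → Goal n
  even-case k refl le = extremal⇒optimal (extend p (𝓕 (3 + 2 * k))) (w (𝓕 (3 + 2 * k))) extremal
    (extend-closed p (𝓕 (3 + 2 * k)) (𝓕-closed k 2≤k)) (extend-admissible p (𝓕 (3 + 2 * k)) (𝓕-admissible k 2≤k))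
    (w-extend p (𝓕 (3 + 2 * k)))
    where
    p : 3 + 2 * k ≤ 4 + 2 * k
    p = m∸n≤m (4 + 2 * k) 1
    35≤k : 35 ≤ k
    35≤k = *-cancelˡ-≤ {35} {k} 2 (+-cancelˡ-≤ 4 70 (2 * k) le)
    2≤k : 2 ≤ k
    2≤k = ≤-trans (m≤m+n 2 33) 35≤k
    extremal : Extremal (extend p (𝓕 (3 + 2 * k)))
    extremal F cl adm = cases (extremal-target k 35≤k F cl adm)
      where
      cases : F ⊑ target k ⊎ card F < card {4 + 2 * k} (target k) →
        F ⊑ extend p (𝓕 (3 + 2 * k)) ⊎ card F < card (extend p (𝓕 (3 + 2 * k)))
      cases (inj₁ h) = inj₁ λ A q → trans (sym (target-𝓕 k p A)) (h A q)
      cases (inj₂ lt) = inj₂ (<-≤-trans lt (≤-reflexive (card-cong (target k) _ (target-𝓕 k p))))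
  go : ∀ h {n} → n ≡ h * 2 → 74 ≤ n → Goal n
  go zero refl ()
  go (suc zero) refl (s≤s (s≤s ()))
  go (suc (suc k)) eq le = even-case k (trans eq (lem k)) le
    where
    lem : ∀ k → (2 + k) * 2 ≡ 4 + 2 * k
    lem = solve-∀

theorem1 : ((n : ℕ) → (7≤n : 7 ≤ n) → n ≤ 72 →
    IsW n (w (𝓕 7)) × UniqueLCOptimum {n} (w (𝓕 7)) (extend 7≤n (𝓕 7)))
    × ((n : ℕ) → 73 ≤ n → n % 2 ≡ 1 →
    IsW n (w (𝓕 n)) × UniqueLCOptimum {n} (w (𝓕 n)) (𝓕 n))
    × ((n : ℕ) → 74 ≤ n → n % 2 ≡ 0 →
    IsW n (w (𝓕 (n ∸ 1))) × UniqueLCOptimum {n} (w (𝓕 (n ∸ 1))) (extend (m∸n≤m n 1) (𝓕 (n ∸ 1))))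
theorem1 = part-i , part-ii , part-iii
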